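{- For every positive integer $n$, every diagonal set $P$ of $n$ points and every axis-aligned rectangle $R$ containing $P$ in its interior, the diameter of the graph of rectangulations $G(P)$ is at most $11n$.
   Context: A finite point set in the plane is noncorectilinear if its points have pairwise distinct $x$-coordinates and pairwise distinct $y$-coordinates. A point set is diagonal if all its points lie on the graph of a strictly increasing function (such a set is noncorectilinear). Let $P$ be a noncorectilinear set of $n$ points in the interior of an axis-aligned rectangle $R$. A rectangulation of $P$ (within $R$) is a subdivision of $R$ into rectangles by exactly $n$ pairwise noncrossing axis-parallel (horizontal or vertical) line segments, each containing exactly one point of $P$, this point lying in the relative interior of the segment. (So each endpoint of a segment lies on the boundary of $R$ or in the relative interior of an orthogonal segment.) Flip$(r,p)$: let $r$ be a rectangulation of $P$ and $p\in P$ such that the segment $s$ containing $p$ does not contain any endpoints of other segments. The operation changes the orientation of $s$ from vertical to horizontal or vice versa (replacing $s$ by the orthogonal segment through $p$ that extends in both directions until it reaches another segment or the boundary of $R$). Rotate$(r,c)$: let $s_1=ab$ be a segment of $r$ containing $p\in P$, and let $s_2=cd$ be a segment of $r$ such that its endpoint $c$ lies in $ap\subset s_1$ and $ac$ does not contain any endpoints of other segments. The operation shortens $s_1$ to $cb$ and extends $s_2$ beyond $c$ until it reaches another segment or the boundary of $R$. The graph of rectangulations $G(P)$ has as vertices all rectangulations of $P$, and $r_1,r_2$ are adjacent iff a single flip or rotate operation on $r_1$ produces $r_2$. Both operations are reversible, so $G(P)$ is undirected. The diameter is the maximum graph distance between two vertices (a finite bound includes the assertion of connectivity). -}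

module Defs where

open import Level using (_⊔_)
open import Data.Nat as ℕ using (ℕ; zero; suc)
open import Data.Fin using (Fin)
open import Data.Product using (_×_; _,_; ∃-syntax)
open import Data.Sum using (_⊎_)
open import Function.Definitions using (Injective)
open import Relation.Nullary using (¬_)
open import Relation.Binary.Bundles using (StrictTotalOrder)
open import Relation.Binary.Morphism.Structures using (IsOrderHomomorphism)
open import Relation.Binary.PropositionalEquality using (_≡_; _≢_)
import Relation.Binary.Construct.StrictToNonStrict as StrictToNonStrict

data Orientation : Set where
  horizontal vertical : Orientation

perp : Orientation → Orientation
perp horizontal = vertical
perp vertical   = horizontal

data End : Set where
  low high : End

opposite : End → End
opposite low  = high
opposite high = low

-- All notions below use only the order of the coordinate line, which is
-- therefore an arbitrary strict total order (with its setoid equality); the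
-- Euclidean plane is the case where it is ℝ.
module Plane {c ℓ₁ ℓ₂} (𝕃 : StrictTotalOrder c ℓ₁ ℓ₂) where

  open StrictTotalOrder 𝕃 using (Carrier; _≈_; _<_)
  open StrictToNonStrict _≈_ _<_ using (_≤_)

  record Point : Set c where
    constructor pt
    field
      x y : Carrier
  open Point public

  infix 4 _≈ₚ_
  _≈ₚ_ : Point → Point → Set ℓ₁
  u ≈ₚ v = x u ≈ x v × y u ≈ y v

  ------------------------------------------------------------------------
  -- Point sets: n distinct points, listed in no particular order

  NonCorectilinear : ∀ {n} → (Fin n → Point) → Set ℓ₁
  NonCorectilinear P = ∀ i j → i ≢ j → ¬ (x (P i) ≈ x (P j)) × ¬ (y (P i) ≈ y (P j))

  record IsDiagonalSet {n} (P : Fin n → Point) : Set (c ⊔ ℓ₁ ⊔ ℓ₂) where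
    field
      distinct         : Injective _≡_ _≈ₚ_ P
      f                : Carrier → Carrier
      strictIncreasing : IsOrderHomomorphism _≈_ _≈_ _<_ _<_ f
      onGraph          : ∀ i → y (P i) ≈ f (x (P i))

  diagonal⇒nonCorectilinear : ∀ {n} {P : Fin n → Point} →
                              IsDiagonalSet P → NonCorectilinear P
  diagonal⇒nonCorectilinear {P = P} D i j i≢j = x≉ , y≉
    where
    open IsDiagonalSet D
    open IsOrderHomomorphism strictIncreasing using (cong; mono)
    open StrictTotalOrder 𝕃 using (compare; module Eq; irrefl)
    open import Relation.Binary.Definitions using (tri<; tri≈; tri>)

    x≉ : ¬ (x (P i) ≈ x (P j))
    x≉ e = i≢j (distinct (e , Eq.trans (onGraph i) (Eq.trans (cong e) (Eq.sym (onGraph j)))))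

    y≉ : ¬ (y (P i) ≈ y (P j))
    y≉ e with compare (x (P i)) (x (P j))
    ... | tri≈ _ x≈ _ = x≉ x≈
    ... | tri< x< _ _ = irrefl (Eq.trans (Eq.sym (onGraph i)) (Eq.trans e (onGraph j))) (mono x<)
    ... | tri> _ _ x> = irrefl (Eq.trans (Eq.sym (onGraph j)) (Eq.trans (Eq.sym e) (onGraph i))) (mono x>)

  ------------------------------------------------------------------------
  -- Rectangles

  record Rectangle : Set (c ⊔ ℓ₂) where
    field
      left right bottom top : Carrier
      left<right : left < right
      bottom<top : bottom < top
  open Rectangle public

  infix 4 _∈ᴿ_ _∈int_ _∈∂_
  _∈ᴿ_ : Point → Rectangle → Set (ℓ₁ ⊔ ℓ₂)
  q ∈ᴿ R = (left R ≤ x q × x q ≤ right R) × (bottom R ≤ y q × y q ≤ top R)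

  _∈int_ : Point → Rectangle → Set ℓ₂
  q ∈int R = (left R < x q × x q < right R) × (bottom R < y q × y q < top R)

  _∈∂_ : Point → Rectangle → Set (ℓ₁ ⊔ ℓ₂)
  q ∈∂ R = q ∈ᴿ R × ¬ (q ∈int R)

  ------------------------------------------------------------------------
  -- Axis-parallel segments

  -- The coordinate that varies along a line of the given orientation, the one
  -- that is constant on it, and the point with these two coordinates.
  along across : Orientation → Point → Carrier
  along  horizontal = x
  along  vertical   = y
  across horizontal = y
  across vertical   = x

  fromCoords : Orientation → (a b : Carrier) → Point
  fromCoords horizontal a b = pt a b
  fromCoords vertical   a b = pt b a

  record Segment : Set (c ⊔ ℓ₂) where
    field
      dir       : Orientation
      at lo hi  : Carrier
      lo<hi     : lo < hi
  open Segment public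

  infix 4 _∈ˢ_ _∈relint_ _≈ₛ_
  _∈ˢ_ : Point → Segment → Set (ℓ₁ ⊔ ℓ₂)
  q ∈ˢ s = across (dir s) q ≈ at s × lo s ≤ along (dir s) q × along (dir s) q ≤ hi s

  _∈relint_ : Point → Segment → Set (ℓ₁ ⊔ ℓ₂)
  q ∈relint s = across (dir s) q ≈ at s × lo s < along (dir s) q × along (dir s) q < hi s

  endpoint : Segment → End → Point
  endpoint s low  = fromCoords (dir s) (lo s) (at s)
  endpoint s high = fromCoords (dir s) (hi s) (at s)

  _≈ₛ_ : Segment → Segment → Set ℓ₁
  s ≈ₛ t = dir s ≡ dir t × at s ≈ at t × lo s ≈ lo t × hi s ≈ hi t

  Noncrossing : Segment → Segment → Set (c ⊔ ℓ₁ ⊔ ℓ₂)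
  Noncrossing s t = ∀ q → ¬ (q ∈relint s × q ∈relint t)

  Between : Carrier → Carrier → Carrier → Set (ℓ₁ ⊔ ℓ₂)
  Between a b m = (a ≤ m × m ≤ b) ⊎ (b ≤ m × m ≤ a)

  -- The closed segment uv given by its ends in either order, and the same
  -- without its ends; only used for u, v on a common axis-parallel line.
  infix 4 _∈[_,_] _∈⟨_,_⟩
  _∈[_,_] _∈⟨_,_⟩ : Point → Point → Point → Set (ℓ₁ ⊔ ℓ₂)
  q ∈[ u , v ] = Between (x u) (x v) (x q) × Between (y u) (y v) (y q)
  q ∈⟨ u , v ⟩ = q ∈[ u , v ] × ¬ (q ≈ₚ u) × ¬ (q ≈ₚ v)

  ------------------------------------------------------------------------
  -- Rectangulations of P within R

  module _ {n} (P : Fin n → Point) (R : Rectangle) where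

    -- Q is a face: its interior avoids the segments and its sides run along
    -- the segments and the boundary of R.
    record IsFace (seg : Fin n → Segment) (Q : Rectangle) : Set (c ⊔ ℓ₁ ⊔ ℓ₂) where
      field
        inside : ∀ q → q ∈ᴿ Q → q ∈ᴿ R
        empty  : ∀ q → q ∈int Q → ∀ i → ¬ (q ∈ˢ seg i)
        sides  : ∀ q → q ∈∂ Q → q ∈∂ R ⊎ ∃[ i ] q ∈ˢ seg i

    -- Each segment contains exactly one of the n points, and no two of the n
    -- noncrossing segments share theirs (it is interior to both), so the
    -- segments are indexed by the points they contain.
    -- If P is noncorectilinear and the order is that of ℝ, `ends` follows from
    -- the other fields.
    record IsRectangulation (seg : Fin n → Segment) : Set (c ⊔ ℓ₁ ⊔ ℓ₂) where
      field
        inside      : ∀ i q → q ∈ˢ seg i → q ∈ᴿ R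
        contains    : ∀ i → P i ∈relint seg i
        onlyPoint   : ∀ i j → P j ∈ˢ seg i → j ≡ i
        noncrossing : ∀ i j → i ≢ j → Noncrossing (seg i) (seg j)
        subdivides  : ∀ q → q ∈int R → (∀ i → ¬ (q ∈ˢ seg i)) →
                      ∃[ Q ] IsFace seg Q × q ∈int Q
        ends        : ∀ i e → endpoint (seg i) e ∈∂ R ⊎
                      ∃[ j ] dir (seg j) ≡ perp (dir (seg i)) × endpoint (seg i) e ∈relint seg j

    record Rectangulation : Set (c ⊔ ℓ₁ ⊔ ℓ₂) where
      field
        seg              : Fin n → Segment
        isRectangulation : IsRectangulation seg
    open Rectangulation public

    infix 4 _≈ᵣ_
    _≈ᵣ_ : Rectangulation → Rectangulation → Set ℓ₁
    r ≈ᵣ r′ = ∀ i → seg r i ≈ₛ seg r′ i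

    ----------------------------------------------------------------------
    -- Operations

    Blocked : Rectangulation → Fin n → Point → Set (ℓ₁ ⊔ ℓ₂)
    Blocked r i q = q ∈∂ R ⊎ ∃[ j ] j ≢ i × q ∈ˢ seg r j

    -- Going from u, the i-th segment first reaches another segment of r or
    -- the boundary of R at v.
    ExtendsUntil : Rectangulation → Fin n → Point → Point → Set (c ⊔ ℓ₁ ⊔ ℓ₂)
    ExtendsUntil r i u v = Blocked r i v × (∀ q → q ∈⟨ u , v ⟩ → ¬ Blocked r i q)

    record Flip (r : Rectangulation) (i : Fin n) (r′ : Rectangulation) : Set (c ⊔ ℓ₁ ⊔ ℓ₂) where
      field
        noEndpoints : ∀ j → j ≢ i → ∀ e → ¬ (endpoint (seg r j) e ∈ˢ seg r i)
        unchanged   : ∀ j → j ≢ i → seg r′ j ≈ₛ seg r j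
        turned      : dir (seg r′ i) ≡ perp (dir (seg r i))
        extended    : ∀ e → ExtendsUntil r i (P i) (endpoint (seg r′ i) e)

    -- s₁ = ab and s₂ = cd are the i-th and the k-th segment of r, with a and c
    -- the e₁-end of s₁ and the e₂-end of s₂; s₂ is extended from c to c′.
    record Rotate (r : Rectangulation) (i : Fin n) (e₁ : End) (k : Fin n) (e₂ : End)
                  (r′ : Rectangulation) : Set (c ⊔ ℓ₁ ⊔ ℓ₂) where
      private
        s₁  = seg r i
        s₂  = seg r k
        s₁′ = seg r′ i
        s₂′ = seg r′ k
      field
        i≢k         : i ≢ k
        onArm       : endpoint s₂ e₂ ∈[ endpoint s₁ e₁ , P i ]
        noEndpoints : ∀ j → j ≢ i → j ≢ k → ∀ e →
                      ¬ (endpoint (seg r j) e ∈[ endpoint s₁ e₁ , endpoint s₂ e₂ ])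
        unchanged   : ∀ j → j ≢ i → j ≢ k → seg r′ j ≈ₛ seg r j
        dir₁        : dir s₁′ ≡ dir s₁
        keepB       : endpoint s₁′ (opposite e₁) ≈ₚ endpoint s₁ (opposite e₁)
        shortened   : endpoint s₁′ e₁ ≈ₚ endpoint s₂ e₂
        dir₂        : dir s₂′ ≡ dir s₂
        keepD       : endpoint s₂′ (opposite e₂) ≈ₚ endpoint s₂ (opposite e₂)
        beyondC     : endpoint s₂ e₂ ∈relint s₂′
        extended    : ExtendsUntil r k (endpoint s₂ e₂) (endpoint s₂′ e₂)

    ----------------------------------------------------------------------
    -- The graph of rectangulations

    Adjacent : Rectangulation → Rectangulation → Set (c ⊔ ℓ₁ ⊔ ℓ₂)
    Adjacent r r′ = (∃[ i ] Flip r i r′) ⊎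
                    (∃[ i ] ∃[ e₁ ] ∃[ k ] ∃[ e₂ ] Rotate r i e₁ k e₂ r′)

    data Walk : Rectangulation → Rectangulation → ℕ → Set (c ⊔ ℓ₁ ⊔ ℓ₂) where
      stop : ∀ {r r′} → r ≈ᵣ r′ → Walk r r′ zero
      step : ∀ {r r′ r″ m} → Adjacent r r′ → Walk r′ r″ m → Walk r r″ (suc m)

    DiameterAtMost : ℕ → Set (c ⊔ ℓ₁ ⊔ ℓ₂)
    DiameterAtMost d = ∀ r r′ → ∃[ m ] m ℕ.≤ d × Walk r r′ m

{-# OPTIONS --safe #-}
module Submission where

-- As the points increase, it is known on which side of the diagonal two grid
-- lines cross. Hence a rectangulation amounts to the orientation of the segment
-- of each point together with the indices of the two perpendicular segments that
-- stop it; a rotation changes one T-junction, a flip one orientation.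
--
-- Fix an orientation o, and let v be the number of segments of orientation o.
-- All segments can be given orientation o in 5n + v operations. (1) Mark every
-- second segment in each run of consecutive segments not of orientation o. From
-- the last marked segment to the first, rotate away the ends on it, then flip
-- it. No end moved off a marked segment lands on a marked one, so this takes
-- at most n + v operations. (2) Now no two consecutive segments are perpendicular
-- to o, so at most two rotations take either end of a segment of orientation o to
-- the boundary. (3) The remaining segments can be flipped one by one. Steps (2)
-- and (3) take at most four operations per point.
--
-- Given two rectangulations, the four values of v (for both choices of o) sum to 2n,
-- so for one choice of o both reach the common target within 2·5n + n operations.

open import Defs
import Level
open import Data.Bool using (Bool; true; false; _∧_; not; if_then_else_) renaming (_≟_ to _≟ᵇ_)
open import Data.Bool.Properties using (¬-not)
open import Data.Nat.Solver using (module +-*-Solver)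
open import Data.Empty using (⊥)
open import Data.Nat hiding (compare)
open import Data.Nat.Properties
open import Data.Fin using (Fin; zero; suc; fromℕ<; punchOut)
import Data.Fin.Properties as Fin
open import Data.Product using (_×_; _,_; ∃-syntax; proj₁; proj₂)
open import Data.Sum using (_⊎_; inj₁; inj₂; [_,_]′; swap)
open import Function using (_∘_; case_of_; id)
open import Relation.Binary.Bundles using (StrictTotalOrder)
open import Relation.Binary.Morphism.Structures using (IsOrderHomomorphism)
import Relation.Binary.Construct.StrictToNonStrict as StrictToNonStrict
open import Relation.Binary.Definitions using (tri<; tri≈; tri>)
open import Relation.Binary.PropositionalEquality hiding (_≗_)
open import Relation.Nullary using (¬_; Dec; yes; no; does; contradiction)
open import Relation.Nullary.Decidable using (_×-dec_; _⊎-dec_; ¬?; map′; dec-true; dec-false)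
open import Relation.Unary using (Decidable)
open import Algebra.Properties.CommutativeSemigroup +-commutativeSemigroup using (interchange; x∙yz≈y∙xz)

-- The conditions of a flip or rotation follow from the validity of the two configurations involved,
-- and validity only compares indices, pair by pair; this makes T-junctions a workable model.
-- Marking whole runs would spoil the count in (1): an end rotated off a segment could land on the
-- next marked one of the same run, over and over. With an unmarked parallel neighbour below each
-- mark, every operation lowers the number of marks plus the number of ends on marked segments. A
-- segment of orientation `o` contributes at most its two ends and any other at most itself, whence
-- `n + v`. Isolation serves (2) and (3) in the same way: a segment that stops an end must reach
-- across the line of that end, and there it would cross a segment of orientation `o`, known by
-- isolation, that already extends to the boundary. With `v` and `h` segments of the two kinds after
-- (1), steps (2) and (3) cost at most `2v + 2v + h`, and this is at most `4n`. The original
-- orientations thus enter the bound through (1) alone.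

_≟ₒ_ : (a b : Orientation) → Dec (a ≡ b)
horizontal ≟ₒ horizontal = yes refl
horizontal ≟ₒ vertical   = no λ ()
vertical   ≟ₒ horizontal = no λ ()
vertical   ≟ₒ vertical   = yes refl

perp≢ : ∀ a → perp a ≢ a
perp≢ horizontal ()
perp≢ vertical ()

≢⇒perp : ∀ {a b} → a ≢ b → a ≡ perp b
≢⇒perp {horizontal} {horizontal} a≢b = contradiction refl a≢b
≢⇒perp {horizontal} {vertical}   a≢b = refl
≢⇒perp {vertical}   {horizontal} a≢b = refl
≢⇒perp {vertical}   {vertical}   a≢b = contradiction refl a≢b

≢∧≢⇒≡ : ∀ {a b c : Orientation} → a ≢ c → b ≢ c → a ≡ b
≢∧≢⇒≡ a≢c b≢c = trans (≢⇒perp a≢c) (sym (≢⇒perp b≢c))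

-- Updates, bounded search and finite sums

_[_↦_] : ∀ {a} {A : Set a} → (ℕ → A) → ℕ → A → ℕ → A
(f [ i ↦ v ]) j with j ≟ i
... | yes _ = v
... | no  _ = f j

↦-here : ∀ {a} {A : Set a} (f : ℕ → A) i v → (f [ i ↦ v ]) i ≡ v
↦-here f i v with i ≟ i
... | yes _  = refl
... | no i≢i = contradiction refl i≢i

↦-there : ∀ {a} {A : Set a} (f : ℕ → A) {i j} v → j ≢ i → (f [ i ↦ v ]) j ≡ f j
↦-there f {i} {j} v j≢i with j ≟ i
... | yes j≡i = contradiction j≡i j≢i
... | no _    = refl

least : ∀ {p} {P : ℕ → Set p} → Decidable P → ∀ b →
        (∃[ m ] m < b × P m × (∀ j → j < m → ¬ P j)) ⊎ (∀ j → j < b → ¬ P j)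
least P? zero    = inj₂ λ _ ()
least P? (suc b) with least P? b
... | inj₁ (m , m<b , Pm , min) = inj₁ (m , m<n⇒m<1+n m<b , Pm , min)
... | inj₂ none with P? b
...   | yes Pb = inj₁ (b , n<1+n b , Pb , none)
...   | no ¬Pb = inj₂ λ j j<1+b → case m≤n⇒m<n∨m≡n (s≤s⁻¹ j<1+b) of λ where
  (inj₁ j<b)  → none j j<b
  (inj₂ refl) → ¬Pb

greatest : ∀ {p} {P : ℕ → Set p} → Decidable P → ∀ b →
           (∃[ m ] m < b × P m × (∀ j → m < j → j < b → ¬ P j)) ⊎ (∀ j → j < b → ¬ P j)
greatest P? zero    = inj₂ λ _ ()
greatest P? (suc b) with P? b
... | yes Pb = inj₁ (b , n<1+n b , Pb , λ j b<j j<1+b → contradiction b<j (≤⇒≯ (s≤s⁻¹ j<1+b)))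
... | no ¬Pb with greatest P? b
...   | inj₁ (m , m<b , Pm , max) = inj₁ (m , m<n⇒m<1+n m<b , Pm , λ j m<j j<1+b →
          case m≤n⇒m<n∨m≡n (s≤s⁻¹ j<1+b) of λ where
            (inj₁ j<b)  → max j m<j j<b
            (inj₂ refl) → ¬Pb)
...   | inj₂ none = inj₂ λ j j<1+b → case m≤n⇒m<n∨m≡n (s≤s⁻¹ j<1+b) of λ where
  (inj₁ j<b)  → none j j<b
  (inj₂ refl) → ¬Pb

anyBelow? : ∀ {p} {P : ℕ → Set p} → Decidable P → ∀ b → Dec (∃[ m ] m < b × P m)
anyBelow? P? b with least P? b
... | inj₁ (m , m<b , Pm , _) = yes (m , m<b , Pm)
... | inj₂ none = no λ (m , m<b , Pm) → none m m<b Pm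

nextAbove : ∀ {p} {P : ℕ → Set p} → Decidable P → ∀ {a b} → a < b → P b →
            ∃[ m ] a < m × m ≤ b × P m × (∀ j → a < j → j < m → ¬ P j)
nextAbove P? {a} {b} a<b Pb with least (λ j → a <? j ×-dec P? j) (suc b)
... | inj₁ (m , m<1+b , (a<m , Pm) , min) =
      m , a<m , s≤s⁻¹ m<1+b , Pm , λ j a<j j<m Pj → min j j<m (a<j , Pj)
... | inj₂ none = contradiction (a<b , Pb) (none b (n<1+n b))

nextBelow : ∀ {p} {P : ℕ → Set p} → Decidable P → ∀ {a} → 0 < a → P 0 →
            ∃[ m ] m < a × P m × (∀ j → m < j → j < a → ¬ P j)
nextBelow P? {a} 0<a P0 with greatest P? a
... | inj₁ found = found
... | inj₂ none  = contradiction P0 (none 0 0<a)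

∑ : (ℕ → ℕ) → ℕ → ℕ
∑ f zero    = 0
∑ f (suc b) = f (suc b) + ∑ f b

∑-mono-≤ : ∀ {f g} b → (∀ j → 0 < j → j ≤ b → f j ≤ g j) → ∑ f b ≤ ∑ g b
∑-mono-≤ zero    f≤g = z≤n
∑-mono-≤ (suc b) f≤g = +-mono-≤ (f≤g (suc b) z<s ≤-refl)
                                (∑-mono-≤ b λ j 0<j j≤b → f≤g j 0<j (m≤n⇒m≤1+n j≤b))

∑-mono-< : ∀ {f g} b → (∀ j → 0 < j → j ≤ b → f j ≤ g j) →
           ∀ i → 0 < i → i ≤ b → f i < g i → ∑ f b < ∑ g b
∑-mono-< zero    f≤g i 0<i i≤0 fi<gi = contradiction 0<i (≤⇒≯ i≤0)
∑-mono-< (suc b) f≤g i 0<i i≤1+b fi<gi with m≤n⇒m<n∨m≡n i≤1+b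
... | inj₁ i<1+b = +-mono-≤-< (f≤g (suc b) z<s ≤-refl)
      (∑-mono-< b (λ j 0<j j≤b → f≤g j 0<j (m≤n⇒m≤1+n j≤b)) i 0<i (s≤s⁻¹ i<1+b) fi<gi)
... | inj₂ refl  = +-mono-<-≤ fi<gi (∑-mono-≤ b λ j 0<j j≤b → f≤g j 0<j (m≤n⇒m≤1+n j≤b))

∑-+ : ∀ f g b → ∑ (λ j → f j + g j) b ≡ ∑ f b + ∑ g b
∑-+ f g zero    = refl
∑-+ f g (suc b) rewrite ∑-+ f g b = interchange (f (suc b)) (g (suc b)) (∑ f b) (∑ g b)

∑-const : ∀ c b → ∑ (λ _ → c) b ≡ b * c
∑-const c zero    = refl
∑-const c (suc b) = cong (c +_) (∑-const c b)

∑-cong : ∀ {f g} b → (∀ j → 0 < j → j ≤ b → f j ≡ g j) → ∑ f b ≡ ∑ g b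
∑-cong zero    f≡g = refl
∑-cong (suc b) f≡g = cong₂ _+_ (f≡g (suc b) z<s ≤-refl)
                               (∑-cong b λ j 0<j j≤b → f≡g j 0<j (m≤n⇒m≤1+n j≤b))

∑-split-first : ∀ f b → ∑ f (suc b) ≡ f 1 + ∑ (f ∘ suc) b
∑-split-first f zero    = refl
∑-split-first f (suc b) = trans (cong (f (2 + b) +_) (∑-split-first f b))
  (x∙yz≈y∙xz (f (2 + b)) (f 1) (∑ (f ∘ suc) b))

∑-reverse : ∀ f b → ∑ (λ i → f (suc b ∸ i)) b ≡ ∑ f b
∑-reverse f zero    = refl
∑-reverse f (suc b) = trans
  (cong₂ _+_ (cong f (m+n∸n≡m 1 (suc b)))
             (trans (∑-cong b λ i _ i≤b → cong f (+-∸-assoc 1 (m≤n⇒m≤1+n i≤b)))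
                    (∑-reverse (f ∘ suc) b)))
  (sym (∑-split-first f b))

-- Configurations: rectangulations as systems of T-junctions

module Configurations (n : ℕ) where

  N : ℕ
  N = suc n

  In : ℕ → Set
  In i = 0 < i × i < N

  -- The indices 1, …, n are the points in increasing order; lo i and hi i are the
  -- indices of the segments that stop the i-th one, or 0 and N for the boundary.
  -- The fields constrain only the indices in In; other values are junk. In nc, the
  -- only possible crossing is between the arm of i towards hi i and the arm of j
  -- towards lo j.
  record Config : Set where
    field
      d     : ℕ → Orientation
      lo hi : ℕ → ℕ
      lo<   : ∀ {i} → In i → lo i < i
      <hi   : ∀ {i} → In i → i < hi i
      hi≤N  : ∀ {i} → In i → hi i ≤ N
      hiT   : ∀ {i} → In i → hi i < N → d (hi i) ≢ d i × lo (hi i) < i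
      loT   : ∀ {i} → In i → 0 < lo i → d (lo i) ≢ d i × i < hi (lo i)
      nc    : ∀ {i j} → 0 < i → i < j → j < N → d i ≢ d j → hi i ≤ j ⊎ i ≤ lo j
  open Config public

  hi-In : ∀ C {i} → In i → hi C i < N → In (hi C i)
  hi-In C i∈ hi<N = <-trans (proj₁ i∈) (<hi C i∈) , hi<N

  lo-In : ∀ C {i} → In i → 0 < lo C i → In (lo C i)
  lo-In C i∈ 0<lo = 0<lo , <-trans (lo< C i∈) (proj₂ i∈)

  -- An arm of `k` running past the bar `hi C i` would cross that bar, whose low arm reaches below
  -- `i` and hence below `k`.
  hi-laminar : ∀ C {i k} → 0 < i → i < k → k < N → d C i ≡ d C k → k < hi C i → hi C k ≤ hi C i
  hi-laminar C {i} {k} 0<i i<k k<N di≡dk k<hii with hi C k ≤? hi C i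
  ... | yes hik≤hii = hik≤hii
  ... | no  hik≰hii = case nc C (<-trans 0<i i<k) k<hii hii<N (λ e → proj₁ T (trans (sym e) (sym di≡dk))) of λ where
      (inj₁ hik≤hii) → contradiction hik≤hii hik≰hii
      (inj₂ k≤lo)    → contradiction k≤lo (<⇒≱ (<-trans (proj₂ T) i<k))
    where
    hii<N = <-≤-trans (≰⇒> hik≰hii) (hi≤N C (<-trans 0<i i<k , k<N))
    T = hiT C (0<i , <-trans i<k k<N) hii<N

  lo-laminar : ∀ C {i k} → 0 < i → i < k → k < N → d C i ≡ d C k → lo C k < i → lo C k ≤ lo C i
  lo-laminar C {i} {k} 0<i i<k k<N di≡dk lok<i with lo C k ≤? lo C i
  ... | yes lok≤loi = lok≤loi
  ... | no  lok≰loi = case nc C 0<lok lok<i (<-trans i<k k<N) (λ e → proj₁ T (trans e di≡dk)) of λ where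
      (inj₁ hi≤i)    → contradiction hi≤i (<⇒≱ (<-trans i<k (proj₂ T)))
      (inj₂ lok≤loi) → contradiction lok≤loi lok≰loi
    where
    0<lok = ≤-<-trans z≤n (≰⇒> lok≰loi)
    T = loT C (<-trans 0<i i<k , k<N) 0<lok

  infix 4 _≗_
  _≗_ : Config → Config → Set
  A ≗ B = ∀ {j} → In j → d A j ≡ d B j × lo A j ≡ lo B j × hi A j ≡ hi B j

  ≗-sym : ∀ {A B} → A ≗ B → B ≗ A
  ≗-sym A≗B j∈ = let dd , ll , hh = A≗B j∈ in sym dd , sym ll , sym hh

  ≗-trans : ∀ {A B C} → A ≗ B → B ≗ C → A ≗ C
  ≗-trans A≗B B≗C j∈ = let dd , ll , hh = A≗B j∈ ; dd′ , ll′ , hh′ = B≗C j∈ in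
    trans dd dd′ , trans ll ll′ , trans hh hh′

  -- That no segment ends on `i`, and that the new ends of `i` are its first obstacles, follows from
  -- the validity of `A` and `B`.
  record Turn (i : ℕ) (A B : Config) : Set where
    field
      i∈     : In i
      turned : d B i ≢ d A i
      same   : ∀ {j} → In j → j ≢ i → d A j ≡ d B j × lo A j ≡ lo B j × hi A j ≡ hi B j

  -- That the shortened piece carries no other endpoint and that the other segment is
  -- extended exactly to its first obstacle follows from the validity of A and B.
  record Rot (i k : ℕ) (A B : Config) : Set where
    field
      i∈     : In i
      k∈     : In k
      i<k    : i < k
      hiA    : hi A i ≡ k
      loB    : lo B k ≡ i
      sameD  : ∀ {j} → In j → d A j ≡ d B j
      sameLo : ∀ {j} → In j → j ≢ k → lo A j ≡ lo B j
      sameHi : ∀ {j} → In j → j ≢ i → hi A j ≡ hi B j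

  -- `raise` moves the high end of `i` up past `k`, `lower` the low end of `k` down past `i`. Each
  -- is the other read backwards, so reversing a rotation only exchanges the constructors.
  data Adj (A B : Config) : Set where
    turn  : ∀ {i} → Turn i A B → Adj A B
    raise : ∀ {i k} → Rot i k A B → Adj A B
    lower : ∀ {i k} → Rot i k B A → Adj A B

  Adj-sym : ∀ {A B} → Adj A B → Adj B A
  Adj-sym (turn t) = turn record
    { i∈ = i∈ ; turned = turned ∘ sym
    ; same = λ j∈ j≢i → let dd , ll , hh = same j∈ j≢i in sym dd , sym ll , sym hh }
    where open Turn t
  Adj-sym (raise r) = lower r
  Adj-sym (lower r) = raise r

  Rot-respˡ : ∀ {i k A A′ B} → A′ ≗ A → Rot i k A B → Rot i k A′ B
  Rot-respˡ e r = record
    { i∈ = i∈ ; k∈ = k∈ ; i<k = i<k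
    ; hiA = trans (proj₂ (proj₂ (e i∈))) hiA
    ; loB = loB
    ; sameD = λ j∈ → trans (proj₁ (e j∈)) (sameD j∈)
    ; sameLo = λ j∈ ne → trans (proj₁ (proj₂ (e j∈))) (sameLo j∈ ne)
    ; sameHi = λ j∈ ne → trans (proj₂ (proj₂ (e j∈))) (sameHi j∈ ne) }
    where open Rot r

  Rot-respʳ : ∀ {i k A B B′} → B ≗ B′ → Rot i k A B → Rot i k A B′
  Rot-respʳ e r = record
    { i∈ = i∈ ; k∈ = k∈ ; i<k = i<k
    ; hiA = hiA
    ; loB = trans (sym (proj₁ (proj₂ (e k∈)))) loB
    ; sameD = λ j∈ → trans (sameD j∈) (proj₁ (e j∈))
    ; sameLo = λ j∈ ne → trans (sameLo j∈ ne) (proj₁ (proj₂ (e j∈)))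
    ; sameHi = λ j∈ ne → trans (sameHi j∈ ne) (proj₂ (proj₂ (e j∈))) }
    where open Rot r

  Adj-respˡ : ∀ {A A′ B} → A′ ≗ A → Adj A B → Adj A′ B
  Adj-respˡ e (turn t) = turn record
    { i∈ = i∈ ; turned = λ x → turned (trans x (proj₁ (e i∈)))
    ; same = λ j∈ ne → let dd , ll , hh = e j∈ ; dd′ , ll′ , hh′ = same j∈ ne in
               trans dd dd′ , trans ll ll′ , trans hh hh′ }
    where open Turn t
  Adj-respˡ e (raise r) = raise (Rot-respˡ e r)
  Adj-respˡ {A} {A′} e (lower r) = lower (Rot-respʳ (≗-sym {A′} {A} e) r)

  data CWalk : Config → Config → ℕ → Set where
    stop : ∀ {A B} → A ≗ B → CWalk A B 0
    step : ∀ {A B C m} → Adj A B → CWalk B C m → CWalk A C (suc m)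

  CWalk-respˡ : ∀ {A A′ B m} → A′ ≗ A → CWalk A B m → CWalk A′ B m
  CWalk-respˡ {A} {A′} {B} e (stop e′) = stop (≗-trans {A′} {A} {B} e e′)
  CWalk-respˡ                e (step a w) = step (Adj-respˡ e a) w

  infixr 5 _++ʷ_
  _++ʷ_ : ∀ {A B C k m} → CWalk A B k → CWalk B C m → CWalk A C (k + m)
  stop e   ++ʷ v = CWalk-respˡ e v
  step a w ++ʷ v = step a (w ++ʷ v)

  CWalk-sym : ∀ {A B m} → CWalk A B m → CWalk B A m
  CWalk-sym {A} {B} (stop e) = stop (≗-sym {A} {B} e)
  CWalk-sym {m = suc m} (step {A} {B} {C} a w) =
    subst (CWalk C A) (+-comm m 1) (CWalk-sym w ++ʷ step (Adj-sym a) (stop λ _ → refl , refl , refl))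

  infix 4 _⟶[_]_
  _⟶[_]_ : Config → ℕ → Config → Set
  A ⟶[ b ] B = ∃[ m ] m ≤ b × CWalk A B m

  done : ∀ {A b} → A ⟶[ b ] A
  done = 0 , z≤n , stop λ _ → refl , refl , refl

  infixr 5 _⊙_
  _⊙_ : ∀ {A B C a b} → A ⟶[ a ] B → B ⟶[ b ] C → A ⟶[ a + b ] C
  (k , k≤a , w) ⊙ (m , m≤b , v) = k + m , +-mono-≤ k≤a m≤b , w ++ʷ v

  ⟶-sym : ∀ {A B b} → A ⟶[ b ] B → B ⟶[ b ] A
  ⟶-sym (m , m≤b , w) = m , m≤b , CWalk-sym w

  ⟶-mono : ∀ {A B a b} → a ≤ b → A ⟶[ a ] B → A ⟶[ b ] B
  ⟶-mono a≤b (m , m≤a , w) = m , ≤-trans m≤a a≤b , w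

  single : ∀ {A B} → Adj A B → A ⟶[ 1 ] B
  single a = 1 , ≤-refl , step a (stop λ _ → refl , refl , refl)

  -- The elementary moves: extending an end, turning a segment

  module _ (C : Config) {i : ℕ} (i∈ : In i) (hi<N : hi C i < N)
           (first : ∀ j → 0 < j → j < i → hi C j ≢ hi C i) where
    private
      k = hi C i
      k∈ = hi-In C i∈ hi<N
      T = hiT C i∈ hi<N

      Stops : ℕ → Set
      Stops m = m ≡ N ⊎ (d C m ≢ d C i × lo C m < i)

      Stops? : Decidable Stops
      Stops? m = (m ≟ N) ⊎-dec (¬? (d C m ≟ₒ d C i) ×-dec (lo C m <? i))

      -- The boundary `N` stops everything, so the search above `k` succeeds.
      found = nextAbove Stops? hi<N (inj₁ refl)
      m = proj₁ found
      k<m = proj₁ (proj₂ found)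
      m≤N = proj₁ (proj₂ (proj₂ found))
      Sm = proj₁ (proj₂ (proj₂ (proj₂ found)))
      min = proj₂ (proj₂ (proj₂ (proj₂ found)))

      m-stops : m < N → d C m ≢ d C i × lo C m < i
      m-stops m<N = [ (λ m≡N → contradiction m≡N (<⇒≢ m<N)) , id ]′ Sm

      i<k = <hi C i∈

      lo′ hi′ : ℕ → ℕ
      lo′ = lo C [ k ↦ i ]
      hi′ = hi C [ i ↦ m ]

      lo′-≤ : ∀ {j a} → (j ≡ k → i < a) → lo C j < a → lo′ j < a
      lo′-≤ {j} at-k lo<a with j ≟ k
      ... | yes j≡k = at-k j≡k
      ... | no _    = lo<a

      extended : Config
      extended = record
        { d = d C ; lo = lo′ ; hi = hi′
        ; lo< = λ {j} j∈ → lo′-≤ (λ { refl → i<k }) (lo< C j∈)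
        ; <hi = λ {j} j∈ → <hi′ j∈
        ; hi≤N = λ {j} j∈ → hi′≤N j∈
        ; hiT = λ {j} j∈ → hiT′ j∈
        ; loT = λ {j} j∈ → loT′ j∈
        ; nc = λ {a} {b} → nc′ {a} {b}
        }
        where
        <hi′ : ∀ {j} → In j → j < hi′ j
        <hi′ {j} j∈ with j ≟ i
        ... | yes refl = <-trans i<k k<m
        ... | no _     = <hi C j∈

        hi≤hi′ : ∀ j → hi C j ≤ hi′ j
        hi≤hi′ j with j ≟ i
        ... | yes refl = <⇒≤ k<m
        ... | no _     = ≤-refl

        hi′≤N : ∀ {j} → In j → hi′ j ≤ N
        hi′≤N {j} j∈ with j ≟ i
        ... | yes refl = m≤N
        ... | no _     = hi≤N C j∈

        hiT′ : ∀ {j} → In j → hi′ j < N → d C (hi′ j) ≢ d C j × lo′ (hi′ j) < j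
        hiT′ {j} j∈ h<N with j ≟ i
        ... | yes refl = proj₁ (m-stops h<N) ,
                         lo′-≤ (λ m≡k → contradiction (sym m≡k) (<⇒≢ k<m)) (proj₂ (m-stops h<N))
        ... | no j≢i = proj₁ (hiT C j∈ h<N) , lo′-≤ after (proj₂ (hiT C j∈ h<N))
          where
          -- After the move `k` begins at `i`, so whatever ends on its low arm must lie above `i`;
          -- this is what `first` secures.
          after : hi C j ≡ k → i < j
          after hij≡k with <-cmp i j
          ... | tri< i<j _ _ = i<j
          ... | tri≈ _ i≡j _ = contradiction (sym i≡j) j≢i
          ... | tri> _ _ j<i = contradiction hij≡k (first j (proj₁ j∈) j<i)

        loT′ : ∀ {j} → In j → 0 < lo′ j → d C (lo′ j) ≢ d C j × j < hi′ (lo′ j)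
        loT′ {j} j∈ 0<l with j ≟ k
        ... | yes refl = (λ e → proj₁ T (sym e)) , subst (k <_) (sym (↦-here (hi C) i m)) k<m
        ... | no _     = proj₁ (loT C j∈ 0<l) , <-≤-trans (proj₂ (loT C j∈ 0<l)) (hi≤hi′ (lo C j))

        nc′ : ∀ {a b} → 0 < a → a < b → b < N → d C a ≢ d C b → hi′ a ≤ b ⊎ a ≤ lo′ b
        nc′ {a} {b} 0<a a<b b<N da≢db with a ≟ i | b ≟ k
        ... | yes refl | yes _ = inj₂ ≤-refl
        ... | no _ | yes refl = case nc C 0<a a<b b<N da≢db of λ where
              (inj₁ hi≤) → inj₁ hi≤
              (inj₂ a≤)  → inj₂ (≤-trans a≤ (<⇒≤ (proj₂ T)))
        ... | no _ | no _ = nc C 0<a a<b b<N da≢db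
        ... | yes refl | no b≢k with <-cmp b k
        ...   | tri≈ _ b≡k _ = contradiction b≡k b≢k
        ...   | tri< b<k _ _ = case nc C 0<a a<b b<N da≢db of λ where
                (inj₁ k≤b) → contradiction k≤b (<⇒≱ b<k)
                (inj₂ i≤l) → inj₂ i≤l
        ...   | tri> _ _ k<b with m ≤? b
        ...     | yes m≤b = inj₁ m≤b
        ...     | no m≰b = inj₂ (≮⇒≥ λ l<i → min b k<b (≰⇒> m≰b) (inj₂ ((da≢db ∘ sym) , l<i)))

    abstract
      -- By `first`, the piece cut off from the bar stops no other segment. The last component is
      -- the minimality of the new stop; its mirror image in `extendLow` locates the ends that are
      -- moved down.
      extendHigh : ∃[ D ] Rot i (hi C i) C D × hi C i < hi D i ×
                   (∀ j → hi C i < j → j < hi D i → d C j ≢ d C i → i ≤ lo C j)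
      extendHigh = extended
        , record
          { i∈ = i∈ ; k∈ = k∈ ; i<k = i<k ; hiA = refl ; loB = ↦-here (lo C) k i
          ; sameD = λ _ → refl
          ; sameLo = λ _ j≢k → sym (↦-there (lo C) i j≢k)
          ; sameHi = λ _ j≢i → sym (↦-there (hi C) m j≢i) }
        , subst (k <_) (sym (↦-here (hi C) i m)) k<m
        , λ j k<j j<h dj≢ → ≮⇒≥ λ l<i →
            min j k<j (subst (j <_) (↦-here (hi C) i m) j<h) (inj₂ (dj≢ , l<i))

  module _ (C : Config) {i : ℕ} (i∈ : In i)
           (freeHi : ∀ j → In j → hi C j ≢ i) (freeLo : ∀ j → In j → lo C j ≢ i) where
    private
      -- Once `i` is turned, its obstacles are the segments parallel to its old direction whose arm
      -- runs past it, with the boundary as the last resort.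
      Above Below : ℕ → Set
      Above m = m ≡ N ⊎ (d C m ≡ d C i × lo C m < i)
      Below l = l ≡ 0 ⊎ (d C l ≡ d C i × i < hi C l)

      Above? : Decidable Above
      Above? m = (m ≟ N) ⊎-dec ((d C m ≟ₒ d C i) ×-dec (lo C m <? i))

      Below? : Decidable Below
      Below? l = (l ≟ 0) ⊎-dec ((d C l ≟ₒ d C i) ×-dec (i <? hi C l))

      above = nextAbove Above? (proj₂ i∈) (inj₁ refl)
      m = proj₁ above
      i<m = proj₁ (proj₂ above)
      m≤N = proj₁ (proj₂ (proj₂ above))
      Am = proj₁ (proj₂ (proj₂ (proj₂ above)))
      min = proj₂ (proj₂ (proj₂ (proj₂ above)))

      below = nextBelow Below? (proj₁ i∈) (inj₁ refl)
      l = proj₁ below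
      l<i = proj₁ (proj₂ below)
      Bl = proj₁ (proj₂ (proj₂ below))
      max = proj₂ (proj₂ (proj₂ below))

      d′ : ℕ → Orientation
      d′ = d C [ i ↦ perp (d C i) ]

      lo′ hi′ : ℕ → ℕ
      lo′ = lo C [ i ↦ l ]
      hi′ = hi C [ i ↦ m ]

      perp≢′ : ∀ {a} → a ≡ d C i → a ≢ perp (d C i)
      perp≢′ refl e = perp≢ _ (sym e)

      turnedConfig : Config
      turnedConfig = record
        { d = d′ ; lo = lo′ ; hi = hi′
        ; lo< = λ {j} j∈ → lo<′ j∈
        ; <hi = λ {j} j∈ → <hi′ j∈
        ; hi≤N = λ {j} j∈ → hi′≤N j∈
        ; hiT = λ {j} j∈ → hiT′ j∈
        ; loT = λ {j} j∈ → loT′ j∈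
        ; nc = λ {a} {b} → nc′ {a} {b}
        }
        where
        lo<′ : ∀ {j} → In j → lo′ j < j
        lo<′ {j} j∈ with j ≟ i
        ... | yes refl = l<i
        ... | no _     = lo< C j∈

        <hi′ : ∀ {j} → In j → j < hi′ j
        <hi′ {j} j∈ with j ≟ i
        ... | yes refl = i<m
        ... | no _     = <hi C j∈

        hi′≤N : ∀ {j} → In j → hi′ j ≤ N
        hi′≤N {j} j∈ with j ≟ i
        ... | yes refl = m≤N
        ... | no _     = hi≤N C j∈

        hiT′ : ∀ {j} → In j → hi′ j < N → d′ (hi′ j) ≢ d′ j × lo′ (hi′ j) < j
        hiT′ {j} j∈ h<N with j ≟ i
        ... | yes refl
            rewrite ↦-there (d C) (perp (d C i)) (>⇒≢ i<m) | ↦-there (lo C) l (>⇒≢ i<m)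
            = [ (λ m≡N → contradiction m≡N (<⇒≢ h<N)) , (λ (dm , lm) → perp≢′ dm , lm) ]′ Am
        ... | no j≢i
            rewrite ↦-there (d C) (perp (d C i)) (freeHi j j∈) | ↦-there (lo C) l (freeHi j j∈)
            = hiT C j∈ h<N

        loT′ : ∀ {j} → In j → 0 < lo′ j → d′ (lo′ j) ≢ d′ j × j < hi′ (lo′ j)
        loT′ {j} j∈ 0<l with j ≟ i
        ... | yes refl
            rewrite ↦-there (d C) (perp (d C i)) (<⇒≢ l<i) | ↦-there (hi C) m (<⇒≢ l<i)
            = [ (λ l≡0 → contradiction l≡0 (>⇒≢ 0<l)) , (λ (dl , hl) → perp≢′ dl , hl) ]′ Bl
        ... | no j≢i
            rewrite ↦-there (d C) (perp (d C i)) (freeLo j j∈) | ↦-there (hi C) m (freeLo j j∈)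
            = loT C j∈ 0<l

        nc′ : ∀ {a b} → 0 < a → a < b → b < N → d′ a ≢ d′ b → hi′ a ≤ b ⊎ a ≤ lo′ b
        nc′ {a} {b} 0<a a<b b<N da≢db with a ≟ i | b ≟ i
        ... | yes refl | yes refl = contradiction a<b (<-irrefl refl)
        ... | no _ | no _ = nc C 0<a a<b b<N da≢db
        ... | yes refl | no _ with m ≤? b
        ...   | yes m≤b = inj₁ m≤b
        ...   | no m≰b = inj₂ (≮⇒≥ λ lb<i → min b a<b (≰⇒> m≰b)
                  (inj₂ (≢∧≢⇒≡ (da≢db ∘ sym) (perp≢ _ ∘ sym) , lb<i)))
        nc′ {a} {b} 0<a a<b b<N da≢db | no _ | yes refl with a ≤? l
        ...   | yes a≤l = inj₂ a≤l
        ...   | no a≰l = inj₁ (≮⇒≥ λ i<ha → max a (≰⇒> a≰l) a<b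
                  (inj₂ (≢∧≢⇒≡ da≢db (perp≢ _ ∘ sym) , i<ha)))

    abstract
      -- `freeHi` and `freeLo` are the precondition of a flip: no segment loses its stop when `i`
      -- turns. The last two components express that both new arms run to their first obstacle.
      turnSegment : ∃[ D ] Turn i C D ×
                    (∀ j → i < j → j < hi D i → d C j ≡ d C i → i ≤ lo C j) ×
                    (∀ j → lo D i < j → j < i → d C j ≡ d C i → hi C j ≤ i)
      turnSegment = turnedConfig
        , record
          { i∈ = i∈
          ; turned = λ e → perp≢ _ (trans (sym (↦-here (d C) i (perp (d C i)))) e)
          ; same = λ _ j≢i → sym (↦-there (d C) (perp (d C i)) j≢i)
                           , sym (↦-there (lo C) l j≢i) , sym (↦-there (hi C) m j≢i) }
        , (λ j i<j j<h dj → ≮⇒≥ λ lj<i →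
             min j i<j (subst (j <_) (↦-here (hi C) i m) j<h) (inj₂ (dj , lj<i)))
        , (λ j l<j j<i dj → ≮⇒≥ λ i<hj →
             max j (subst (_< j) (↦-here (lo C) i l) l<j) j<i (inj₂ (dj , i<hj)))

-- The half turn of a configuration

module Reflection (n : ℕ) where
  open Configurations n

  rv : ℕ → ℕ
  rv i = N ∸ i

  rv-rv : ∀ {i} → i ≤ N → rv (rv i) ≡ i
  rv-rv = m∸[m∸n]≡n

  rv-< : ∀ {i j} → i < j → j ≤ N → rv j < rv i
  rv-< i<j j≤N = ∸-monoʳ-< i<j j≤N

  rv-In : ∀ {i} → In i → In (rv i)
  rv-In (0<i , i<N) = m<n⇒0<n∸m i<N , rv-< 0<i (<⇒≤ i<N)

  rv-rv-In : ∀ {i} → In i → rv (rv i) ≡ i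
  rv-rv-In i∈ = rv-rv (<⇒≤ (proj₂ i∈))

  rv-<ˡ : ∀ {i j} → In i → rv i < j → j ≤ N → rv j < i
  rv-<ˡ {i} {j} i∈ rvi<j j≤N = subst (rv j <_) (rv-rv-In i∈) (rv-< rvi<j j≤N)

  rv-<ʳ : ∀ {i j} → In i → j < rv i → i < rv j
  rv-<ʳ {i} {j} i∈ j<rvi = subst (_< rv j) (rv-rv-In i∈) (rv-< j<rvi (m∸n≤m N i))

  rv-≤ˡ : ∀ {i j} → In i → rv i ≤ j → rv j ≤ i
  rv-≤ˡ {i} {j} i∈ rvi≤j = subst (rv j ≤_) (rv-rv-In i∈) (∸-monoʳ-≤ N rvi≤j)

  rv-≤ʳ : ∀ {i j} → In i → j ≤ rv i → i ≤ rv j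
  rv-≤ʳ {i} {j} i∈ j≤rvi = subst (_≤ rv j) (rv-rv-In i∈) (∸-monoʳ-≤ N j≤rvi)

  rv-pos : ∀ {i} → rv i < N → 0 < i
  rv-pos {zero}  N<N = contradiction N<N (<-irrefl refl)
  rv-pos {suc i} _   = z<s

  rv-bound : ∀ {i} → 0 < rv i → i < N
  rv-bound 0<rv = m∸n≢0⇒n<m (>⇒≢ 0<rv)

  lo≤N : ∀ C {i} → In i → lo C i ≤ N
  lo≤N C i∈ = <⇒≤ (<-trans (lo< C i∈) (proj₂ i∈))

  -- A half turn of the picture: both coordinate orders are reversed, so orientations stay while
  -- `lo` and `hi` trade places. It turns results on high ends into results on low ends.
  rev : Config → Config
  rev C = record
    { d  = d C ∘ rv
    ; lo = rv ∘ hi C ∘ rv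
    ; hi = rv ∘ lo C ∘ rv
    ; lo< = λ i∈ → rv-<ˡ i∈ (<hi C (rv-In i∈)) (hi≤N C (rv-In i∈))
    ; <hi = λ i∈ → rv-<ʳ i∈ (lo< C (rv-In i∈))
    ; hi≤N = λ {i} _ → m∸n≤m N (lo C (rv i))
    ; hiT = hiT′
    ; loT = loT′
    ; nc = nc′
    }
    where
    hiT′ : ∀ {i} → In i → rv (lo C (rv i)) < N →
           d C (rv (rv (lo C (rv i)))) ≢ d C (rv i) × rv (hi C (rv (rv (lo C (rv i))))) < i
    hiT′ {i} i∈ h<N rewrite rv-rv (lo≤N C (rv-In i∈)) =
      let d≢ , i<hi = loT C (rv-In i∈) (rv-pos h<N) in
      d≢ , rv-<ˡ i∈ i<hi (hi≤N C (lo-In C (rv-In i∈) (rv-pos h<N)))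

    loT′ : ∀ {i} → In i → 0 < rv (hi C (rv i)) →
           d C (rv (rv (hi C (rv i)))) ≢ d C (rv i) × i < rv (lo C (rv (rv (hi C (rv i)))))
    loT′ {i} i∈ 0<l rewrite rv-rv (hi≤N C (rv-In i∈)) =
      let d≢ , lo<i = hiT C (rv-In i∈) (rv-bound 0<l) in
      d≢ , rv-<ʳ i∈ lo<i

    nc′ : ∀ {i j} → 0 < i → i < j → j < N → d C (rv i) ≢ d C (rv j) →
          rv (lo C (rv i)) ≤ j ⊎ i ≤ rv (hi C (rv j))
    nc′ {i} {j} 0<i i<j j<N di≢dj =
      [ (λ hi≤ → inj₂ (rv-≤ʳ i∈ hi≤))
      , (λ ≤lo → inj₁ (rv-≤ˡ j∈ ≤lo)) ]′
      (nc C (proj₁ (rv-In j∈)) (rv-< i<j (<⇒≤ j<N)) (proj₂ (rv-In i∈)) (di≢dj ∘ sym))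
      where
      i∈ = 0<i , <-trans i<j j<N
      j∈ = <-trans 0<i i<j , j<N

  rev-rev : ∀ C → rev (rev C) ≗ C
  rev-rev C {j} j∈ rewrite rv-rv-In j∈ = refl , rv-rv (lo≤N C j∈) , rv-rv (hi≤N C j∈)

  rv-≢ : ∀ {i j} → In i → In j → i ≢ rv j → rv i ≢ j
  rv-≢ i∈ j∈ i≢ refl = i≢ (sym (rv-rv-In i∈))

  -- The high end of `i` on `k` turns into a low end of `rv i` on `rv k`, which is the state after a
  -- rotation of that pair; hence `A` and `B` change places.
  rev-Rot : ∀ {i k A B} → Rot i k A B → Rot (rv k) (rv i) (rev B) (rev A)
  rev-Rot {A = A} {B} r = record
    { i∈ = rv-In k∈ ; k∈ = rv-In i∈ ; i<k = rv-< i<k (<⇒≤ (proj₂ k∈))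
    ; hiA = cong rv (trans (cong (lo B) (rv-rv-In k∈)) loB)
    ; loB = cong rv (trans (cong (hi A) (rv-rv-In i∈)) hiA)
    ; sameD = λ j∈ → sym (sameD (rv-In j∈))
    ; sameLo = λ j∈ ne → cong rv (sym (sameHi (rv-In j∈) (rv-≢ j∈ i∈ ne)))
    ; sameHi = λ j∈ ne → cong rv (sym (sameLo (rv-In j∈) (rv-≢ j∈ k∈ ne)))
    }
    where open Rot r

  rev-Turn : ∀ {i A B} → Turn i A B → Turn (rv i) (rev A) (rev B)
  rev-Turn {A = A} {B} t = record
    { i∈ = rv-In i∈
    ; turned = λ e → turned (trans (cong (d B) (sym (rv-rv-In i∈))) (trans e (cong (d A) (rv-rv-In i∈))))
    ; same = λ j∈ ne → let dd , ll , hh = same (rv-In j∈) (rv-≢ j∈ i∈ ne) in dd , cong rv hh , cong rv ll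
    }
    where open Turn t

  rev-Adj : ∀ {A B} → Adj A B → Adj (rev A) (rev B)
  rev-Adj (turn t)  = turn (rev-Turn t)
  rev-Adj (raise r) = lower (rev-Rot r)
  rev-Adj (lower r) = raise (rev-Rot r)

  rev-CWalk : ∀ {A B m} → CWalk A B m → CWalk (rev A) (rev B) m
  rev-CWalk (stop e)   = stop λ j∈ → let dd , ll , hh = e (rv-In j∈) in dd , cong rv hh , cong rv ll
  rev-CWalk (step a w) = step (rev-Adj a) (rev-CWalk w)

  rev-⟶ : ∀ {A B b} → rev A ⟶[ b ] B → A ⟶[ b ] rev B
  rev-⟶ {A} {B} (m , m≤b , w) =
    m , m≤b , CWalk-respˡ (≗-sym {rev (rev A)} {A} (rev-rev A)) (rev-CWalk w)

  -- The mirror image of `extendHigh`. As `rev-Rot` reverses the direction, the rotation comes out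
  -- from `D` to `C`, the form that `lower` takes.
  extendLow : ∀ C {i} → In i → 0 < lo C i → (∀ j → i < j → j < N → lo C j ≢ lo C i) →
              ∃[ D ] Rot (lo C i) i D C × lo D i < lo C i ×
              (∀ j → lo D i < j → j < lo C i → d C j ≢ d C i → hi C j ≤ i)
  extendLow C {i} i∈ 0<lo last = rev D , rot , lo<lo , clear
    where
    i≡ = rv-rv-In i∈
    l = lo C i
    l∈ = lo-In C i∈ 0<lo

    hi≡ : hi (rev C) (rv i) ≡ rv l
    hi≡ = cong (rv ∘ lo C) i≡

    first : ∀ j → 0 < j → j < rv i → hi (rev C) j ≢ hi (rev C) (rv i)
    first j 0<j j<rvi e = last (rv j)
      (subst (_< rv j) i≡ (rv-< j<rvi (<⇒≤ (proj₂ (rv-In i∈)))))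
      (proj₂ (rv-In (0<j , <-trans j<rvi (proj₂ (rv-In i∈)))))
      (trans (sym (rv-rv (lo≤N C (rv-In (0<j , <-trans j<rvi (proj₂ (rv-In i∈)))))))
             (trans (cong rv (trans e hi≡)) (rv-rv-In l∈)))

    ext = extendHigh (rev C) (rv-In i∈) (subst (_< N) (sym hi≡) (proj₂ (rv-In l∈))) first
    D = proj₁ ext

    rot : Rot l i (rev D) C
    rot = subst₂ (λ a b → Rot a b (rev D) C) (trans (cong rv hi≡) (rv-rv-In l∈)) i≡
            (Rot-respʳ (rev-rev C) (rev-Rot (proj₁ (proj₂ ext))))

    lo<lo : rv (hi D (rv i)) < l
    lo<lo = subst (rv (hi D (rv i)) <_) (trans (cong rv hi≡) (rv-rv-In l∈))
              (rv-< (proj₁ (proj₂ (proj₂ ext))) (hi≤N D (rv-In i∈)))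

    clear : ∀ j → rv (hi D (rv i)) < j → j < l → d C j ≢ d C i → hi C j ≤ i
    clear j l′<j j<l dj≢di = subst (hi C j ≤_) i≡
      (subst (_≤ rv (rv i)) (rv-rv (hi≤N C j∈)) (∸-monoʳ-≤ N rvi≤))
      where
      j∈ = ≤-<-trans z≤n l′<j , <-trans j<l (proj₂ l∈)
      jj = rv-rv-In j∈
      rvi≤ : rv i ≤ rv (hi C j)
      rvi≤ = subst (λ z → rv i ≤ rv (hi C z)) jj (proj₂ (proj₂ (proj₂ ext)) (rv j)
        (subst (_< rv j) (sym hi≡) (rv-< j<l (<⇒≤ (proj₂ l∈))))
        (subst (rv j <_) (rv-rv {hi D (rv i)} (hi≤N D (rv-In i∈))) (rv-< l′<j (<⇒≤ (proj₂ j∈))))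
        λ e → dj≢di (trans (sym (cong (d C) jj)) (trans e (cong (d C) i≡))))

-- Isolating the segments not of orientation `o`

does-true : ∀ {p} {P : Set p} (P? : Dec P) → does P? ≡ true → P
does-true (yes p) _ = p

bit : Bool → ℕ
bit true  = 1
bit false = 0

bit≤1 : ∀ b → bit b ≤ 1
bit≤1 true  = ≤-refl
bit≤1 false = z≤n

bit-mono : ∀ {a b} → (a ≡ true → b ≡ true) → bit a ≤ bit b
bit-mono {false} _   = z≤n
bit-mono {true}  a⇒b rewrite a⇒b refl = ≤-refl

bit-< : ∀ {a b} → a ≡ false → b ≡ true → bit a < bit b
bit-< refl refl = ≤-refl

module Straightening (n : ℕ) (o : Orientation) where
  open Configurations n
  open Reflection n using (rev; rev-⟶; rv; rv-In; rv-rv-In; extendLow)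

  opposed : ∀ {a b} → a ≢ o → a ≢ b → b ≡ o
  opposed a≢o a≢b = ≢∧≢⇒≡ (a≢b ∘ sym) (a≢o ∘ sym)

  Isolated : Config → Set
  Isolated C = ∀ {j} → 0 < j → suc j < N → d C j ≢ o → d C (suc j) ≡ o

  count : (Orientation → Bool) → Config → ℕ
  count p C = ∑ (λ i → bit (p (d C i))) n

  is-o not-o : Orientation → Bool
  is-o a = does (a ≟ₒ o)
  not-o = not ∘ is-o

  pos : ∀ {i} → i ≤ n → i < N
  pos = s≤s

  -- A marked segment follows an unmarked parallel one, so that an end moved off it
  -- downwards, as well as its own lower end once it is turned, is stopped by the latter.
  record Marking (K : ℕ → Bool) (C : Config) : Set where
    field
      inside  : ∀ {j} → K j ≡ true → In j
      marked≢ : ∀ {j} → K j ≡ true → d C j ≢ o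
      before    : ∀ {j} → K (suc j) ≡ true → In j × d C j ≢ o × K j ≡ false
      covers  : ∀ {j} → 0 < j → suc j < N → d C j ≢ o → d C (suc j) ≢ o →
                K j ≡ true ⊎ K (suc j) ≡ true

  -- A bound on the operations still to come: a segment of orientation `o` is charged for each end
  -- on a marked segment, any other one for its own flip if it is marked. The sum `Φ` drops with
  -- each operation of this stage.
  φ : (ℕ → Bool) → Config → ℕ → ℕ
  φ K C i = if is-o (d C i) then bit (K (hi C i)) + bit (K (lo C i)) else bit (K i)

  Φ : (ℕ → Bool) → Config → ℕ
  Φ K C = ∑ (φ K C) n

  φ-o : ∀ K C {i} → d C i ≡ o → φ K C i ≡ bit (K (hi C i)) + bit (K (lo C i))
  φ-o K C {i} di≡o with d C i ≟ₒ o
  ... | yes _ = refl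
  ... | no di≢o = contradiction di≡o di≢o

  φ-≢o : ∀ K C {i} → d C i ≢ o → φ K C i ≡ bit (K i)
  φ-≢o K C {i} di≢o with d C i ≟ₒ o
  ... | yes di≡o = contradiction di≡o di≢o
  ... | no _ = refl

  φ-mono : ∀ {K K′ C D i} → d C i ≡ d D i →
           (d D i ≡ o → K′ (hi D i) ≡ true → K (hi C i) ≡ true) →
           (d D i ≡ o → K′ (lo D i) ≡ true → K (lo C i) ≡ true) →
           (K′ i ≡ true → K i ≡ true) → φ K′ D i ≤ φ K C i
  φ-mono {K} {K′} {C} {D} {i} dd hh ll kk = case d D i ≟ₒ o of λ where
    (yes di≡o) → subst₂ _≤_ (sym (φ-o K′ D di≡o)) (sym (φ-o K C (trans dd di≡o)))
                   (+-mono-≤ (bit-mono (hh di≡o)) (bit-mono (ll di≡o)))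
    (no di≢o)  → subst₂ _≤_ (sym (φ-≢o K′ D di≢o)) (sym (φ-≢o K C (di≢o ∘ trans (sym dd))))
                   (bit-mono kk)

  Marking-resp : ∀ {K C D} → (∀ {j} → In j → d C j ≡ d D j) → Marking K C → Marking K D
  Marking-resp dd M = record
    { inside  = inside
    ; marked≢ = λ kj e → marked≢ kj (trans (dd (inside kj)) e)
    ; before    = λ k → let j∈ , dj≢ , kj = before k in j∈ , (λ e → dj≢ (trans (dd j∈) e)) , kj
    ; covers  = λ 0<j j<N dj≢ dsj≢ →
        covers 0<j j<N (dj≢ ∘ trans (sym (dd (0<j , <-trans (n<1+n _) j<N))))
                       (dsj≢ ∘ trans (sym (dd (z<s , j<N))))
    }
    where open Marking M

  module _ (K : ℕ → Bool) (C : Config) (M : Marking K C) where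
    open Marking M

    -- The marked segment `suc j` is parallel to `j`, and parallel segments do not stop each other.
    reachesOver : ∀ {j} → K (suc j) ≡ true → suc j < hi C j
    reachesOver {j} k = case m≤n⇒m<n∨m≡n (<hi C j∈) of λ where
        (inj₁ sj<hi) → sj<hi
        (inj₂ sj≡hi) → contradiction
          (trans (cong (d C) (sym sj≡hi)) (≢∧≢⇒≡ (marked≢ k) dj≢o))
          (proj₁ (hiT C j∈ (subst (_< N) sj≡hi (proj₂ (inside k)))))
      where
      j∈ = proj₁ (before k)
      dj≢o = proj₁ (proj₂ (before k))

    -- As `j` is the last mark, an end that moves up beyond it leaves the marked segments for good.
    -- The only low end that changes is that of `j` itself, and `j` is not charged for its ends.
    unhitHigh : ∀ {j i} → K j ≡ true → (∀ m → j < m → K m ≡ false) →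
                In i → hi C i ≡ j → (∀ t → t < i → ¬ (0 < t × hi C t ≡ j)) →
                ∃[ D ] Adj C D × Marking K D × Φ K D < Φ K C
    unhitHigh {i = i} kj above i∈ refl min =
      D , raise rot , Marking-resp {K} {C} {D} sameD M , ∑-mono-< n others i (proj₁ i∈) (s≤s⁻¹ (proj₂ i∈)) atI
      where
      ext = extendHigh C i∈ (proj₂ (inside kj)) (λ t 0<t t<i e → min t t<i (0<t , e))
      D = proj₁ ext
      rot = proj₁ (proj₂ ext)
      j<hi = proj₁ (proj₂ (proj₂ ext))
      open Rot rot hiding (i∈)

      di≡o : d C i ≡ o
      di≡o = opposed (marked≢ kj) (proj₁ (hiT C i∈ (proj₂ (inside kj))))

      sameLo-o : ∀ {t} → In t → d D t ≡ o → lo C t ≡ lo D t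
      sameLo-o t∈ dt≡o = sameLo t∈ λ { refl → marked≢ kj (trans (sameD t∈) dt≡o) }

      others : ∀ t → 0 < t → t ≤ n → φ K D t ≤ φ K C t
      others t 0<t t≤n = φ-mono {K} {K} {C} {D} (sameD t∈)
        (λ _ → hh)
        (λ dt≡o → trans (cong K (sameLo-o t∈ dt≡o)))
        (λ k → k)
        where
        t∈ = 0<t , pos t≤n
        hh : K (hi D t) ≡ true → K (hi C t) ≡ true
        hh k with t ≟ i
        ... | yes refl = kj
        ... | no t≢i = trans (cong K (sameHi t∈ t≢i)) k

      atI : φ K D i < φ K C i
      atI = subst₂ _<_ (sym (φ-o K D dD≡o)) (sym (φ-o K C di≡o))
        (+-mono-<-≤ (bit-< (above (hi D i) j<hi) kj) (bit-mono (trans (cong K (sameLo-o i∈ dD≡o)))))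
        where dD≡o = trans (sym (sameD i∈)) di≡o

    -- The unmarked parallel neighbour `j` reaches at least as high as `suc j` by `hi-laminar`,
    -- hence past `l`; so it catches the end that comes down from `suc j`.
    unhitLow : ∀ {j l} → K (suc j) ≡ true →
               In l → lo C l ≡ suc j → (∀ t → l < t → t < N → ¬ (0 < t × lo C t ≡ suc j)) →
               ∃[ D ] Adj C D × Marking K D × Φ K D < Φ K C
    unhitLow {j} {l} kj l∈ lo≡ max =
      D , lower rot , Marking-resp {K} {C} {D} (sym ∘ sameD) M ,
      ∑-mono-< n others l (proj₁ l∈) (s≤s⁻¹ (proj₂ l∈)) atL
      where
      0<lo = subst (0 <_) (sym lo≡) z<s
      ext = extendLow C l∈ 0<lo
              (λ t l<t t<N e → max t l<t t<N (<-trans (proj₁ l∈) l<t , trans e lo≡))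
      D = proj₁ ext
      rot = proj₁ (proj₂ ext)
      clear = proj₂ (proj₂ (proj₂ ext))
      open Rot rot hiding (i∈)
      T = loT C l∈ 0<lo
      klo : K (lo C l) ≡ true
      klo = trans (cong K lo≡) kj
      j∈ = proj₁ (before kj)
      dj≢o = proj₁ (proj₂ (before kj))
      dsj≡dj : d C (suc j) ≡ d C j
      dsj≡dj = ≢∧≢⇒≡ (marked≢ kj) dj≢o

      dl≡o : d C l ≡ o
      dl≡o = opposed (marked≢ klo) (proj₁ T)

      l<hij : l < hi C j
      l<hij = <-≤-trans (subst (λ z → l < hi C z) lo≡ (proj₂ T))
                (hi-laminar C (proj₁ j∈) (n<1+n j) (proj₂ (inside kj)) (sym dsj≡dj) (reachesOver kj))

      lo′≡j : lo D l ≡ j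
      lo′≡j = case m≤n⇒m<n∨m≡n (s≤s⁻¹ (subst (lo D l <_) lo≡ (proj₁ (proj₂ (proj₂ ext))))) of λ where
        (inj₁ lo<j) → contradiction
          (clear j lo<j (subst (j <_) (sym lo≡) (n<1+n j)) (λ e → dj≢o (trans e dl≡o)))
          (<⇒≱ l<hij)
        (inj₂ lo≡j) → lo≡j

      sameHi-o : ∀ {t} → In t → d D t ≡ o → hi D t ≡ hi C t
      sameHi-o t∈ dt≡o = sameHi t∈ λ { refl → marked≢ klo (trans (sym (sameD t∈)) dt≡o) }

      others : ∀ t → 0 < t → t ≤ n → φ K D t ≤ φ K C t
      others t 0<t t≤n = φ-mono {K} {K} {C} {D} (sym (sameD t∈))
        (λ dt≡o → trans (cong K (sym (sameHi-o t∈ dt≡o))))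
        (λ _ → ll)
        (λ k → k)
        where
        t∈ = 0<t , pos t≤n
        ll : K (lo D t) ≡ true → K (lo C t) ≡ true
        ll k with t ≟ l
        ... | yes refl = klo
        ... | no t≢l = trans (cong K (sym (sameLo t∈ t≢l))) k

      atL : φ K D l < φ K C l
      atL = subst₂ _<_ (sym (φ-o K D dD≡o)) (sym (φ-o K C dl≡o))
        (+-mono-≤-< (bit-mono (trans (cong K (sym (sameHi-o l∈ dD≡o)))))
                    (bit-< (trans (cong K lo′≡j) (proj₂ (proj₂ (before kj)))) klo))
        where dD≡o = trans (sameD l∈) dl≡o

    -- The upper new end lies beyond the last mark, and the lower one is caught by the unmarked
    -- neighbour `j`, which reaches over `suc j`. So the charge of `suc j` falls from 1 to 0
    -- although it now pays for its ends.
    turnMarked : ∀ {j} → K (suc j) ≡ true → (∀ m → suc j < m → K m ≡ false) →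
                 (∀ t → In t → hi C t ≢ suc j) → (∀ t → In t → lo C t ≢ suc j) →
                 ∃[ D ] ∃[ K′ ] Adj C D × Marking K′ D × Φ K′ D < Φ K C
    turnMarked {j} kj above freeHi freeLo =
      D , K′ , turn t , M′ , ∑-mono-< n others (suc j) z<s (s≤s⁻¹ (proj₂ (inside kj))) atJ
      where
      T = turnSegment C (inside kj) freeHi freeLo
      D = proj₁ T
      t = proj₁ (proj₂ T)
      clear = proj₂ (proj₂ (proj₂ T))
      open Turn t hiding (i∈)
      K′ : ℕ → Bool
      K′ = K [ suc j ↦ false ]

      j∈ = proj₁ (before kj)
      dj≢o = proj₁ (proj₂ (before kj))

      dD≡o : d D (suc j) ≡ o
      dD≡o = opposed (marked≢ kj) (turned ∘ sym)

      K′⇒K : ∀ m → K′ m ≡ true → m ≢ suc j × K m ≡ true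
      K′⇒K m k with m ≟ suc j
      ... | no m≢sj = m≢sj , k

      K⇒K′ : ∀ {m} → m ≢ suc j → K m ≡ true → K′ m ≡ true
      K⇒K′ m≢sj k = trans (↦-there K false m≢sj) k

      K′-false : ∀ m → K m ≡ false → K′ m ≡ false
      K′-false m k with m ≟ suc j
      ... | yes _ = refl
      ... | no _ = k

      M′ : Marking K′ D
      M′ = record
        { inside = λ {m} k → inside (proj₂ (K′⇒K m k))
        ; marked≢ = λ {m} k e → let m≢ , km = K′⇒K m k in
            marked≢ km (trans (proj₁ (same (inside km) m≢)) e)
        ; before = λ {m} k → let m∈ , dm≢o , km = before (proj₂ (K′⇒K (suc m) k)) in
            m∈ , (λ e → dm≢o (trans (proj₁ (same m∈ λ { refl → case trans (sym kj) km of λ () })) e)) ,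
            K′-false m km
        ; covers = λ {m} 0<m sm<N dm≢o dsm≢o →
            let m≢ = λ { refl → dm≢o dD≡o }
                sm≢ = λ { refl → dsm≢o dD≡o } in
            [ inj₁ ∘ K⇒K′ m≢ , inj₂ ∘ K⇒K′ sm≢ ]′
              (covers 0<m sm<N (dm≢o ∘ trans (sym (proj₁ (same (0<m , <-trans (n<1+n _) sm<N) m≢))))
                               (dsm≢o ∘ trans (sym (proj₁ (same (z<s , sm<N) sm≢)))))
        }

      lo≡j : lo D (suc j) ≡ j
      lo≡j = case m≤n⇒m<n∨m≡n (s≤s⁻¹ (lo< D (inside kj))) of λ where
        (inj₁ lo<j) → contradiction (clear j lo<j (n<1+n j) (≢∧≢⇒≡ dj≢o (marked≢ kj)))
                                    (<⇒≱ (reachesOver kj))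
        (inj₂ lo≡j) → lo≡j

      atJ : φ K′ D (suc j) < φ K C (suc j)
      atJ = subst₂ _<_ (sym φ≡0) (sym (trans (φ-≢o K C (marked≢ kj)) (cong bit kj))) z<s
        where
        φ≡0 : φ K′ D (suc j) ≡ 0
        φ≡0 = trans (φ-o K′ D dD≡o) (cong₂ _+_
          (cong bit (K′-false (hi D (suc j)) (above _ (<hi D (inside kj)))))
          (cong bit (trans (cong K′ lo≡j) (K′-false j (proj₂ (proj₂ (before kj)))))))

      others : ∀ m → 0 < m → m ≤ n → φ K′ D m ≤ φ K C m
      others m 0<m m≤n = case m ≟ suc j of λ where
        (yes refl) → <⇒≤ atJ
        (no m≢sj)  → let dd , ll , hh = same (0<m , pos m≤n) m≢sj in
          φ-mono {K} {K′} {C} {D} dd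
            (λ _ k → trans (cong K hh) (proj₂ (K′⇒K _ k)))
            (λ _ k → trans (cong K ll) (proj₂ (K′⇒K _ k)))
            (λ k → proj₂ (K′⇒K m k))

    isolateStep : Isolated C ⊎ ∃[ D ] ∃[ K′ ] Adj C D × Marking K′ D × Φ K′ D < Φ K C
    isolateStep with greatest (λ j → K j ≟ᵇ true) N
    -- Once no mark is left, `covers` excludes two consecutive segments off `o`.
    ... | inj₂ none = inj₁ λ {j} 0<j sj<N dj≢o → case d C (suc j) ≟ₒ o of λ where
            (yes e) → e
            (no dsj≢o) → case covers 0<j sj<N dj≢o dsj≢o of λ where
              (inj₁ kj)  → contradiction kj (none j (<-trans (n<1+n j) sj<N))
              (inj₂ ksj) → contradiction ksj (none (suc j) sj<N)
    ... | inj₁ (zero , _ , kj , _) = contradiction (proj₁ (inside kj)) (<-irrefl refl)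
    ... | inj₁ (suc j , j<N , kj , maxK) = inj₂ step′
      where
      above : ∀ m → suc j < m → K m ≡ false
      above m j<m = ¬-not λ km → maxK m j<m (proj₂ (inside km)) km

      step′ : ∃[ D ] ∃[ K′ ] Adj C D × Marking K′ D × Φ K′ D < Φ K C
      -- Ends are removed from the tips of the two arms inwards, as a rotation requires: the lowest
      -- segment first on the low arm, the highest first on the high arm.
      step′ with least (λ i → (0 <? i) ×-dec (hi C i ≟ suc j)) N
      ... | inj₁ (i , i<N , (0<i , hi≡) , min) =
            let D , r = unhitHigh kj above (0<i , i<N) hi≡ min in D , K , r
      ... | inj₂ noHigh with greatest (λ l → (0 <? l) ×-dec (lo C l ≟ suc j)) N
      ...   | inj₁ (l , l<N , (0<l , lo≡) , max) =
              let D , r = unhitLow kj (0<l , l<N) lo≡ max in D , K , r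
      ...   | inj₂ noLow = turnMarked kj above
              (λ t t∈ e → noHigh t (proj₂ t∈) (proj₁ t∈ , e))
              (λ t t∈ e → noLow t (proj₂ t∈) (proj₁ t∈ , e))

  isolateMarked : ∀ b K C → Marking K C → Φ K C ≤ b → ∃[ D ] C ⟶[ b ] D × Isolated D
  isolateMarked b K C M Φ≤b with isolateStep K C M
  ... | inj₁ iso = C , done , iso
  isolateMarked zero K C M Φ≤b | inj₂ (D , K′ , a , M′ , Φ<) = contradiction (<-≤-trans Φ< Φ≤b) λ ()
  isolateMarked (suc b) K C M Φ≤b | inj₂ (D , K′ , a , M′ , Φ<) =
    let E , w , iso = isolateMarked b K′ D M′ (s≤s⁻¹ (<-≤-trans Φ< Φ≤b)) in
    E , single a ⊙ w , iso

  module _ (C : Config) where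
    private
      Marks : (ℕ → Bool) → ℕ → Set
      Marks K j = 0 < j × suc j < N × d C j ≢ o × d C (suc j) ≢ o × K j ≡ false

      Marks? : ∀ K → Decidable (Marks K)
      Marks? K j = (0 <? j) ×-dec (suc j <? N) ×-dec ¬? (d C j ≟ₒ o) ×-dec ¬? (d C (suc j) ≟ₒ o)
                   ×-dec (K j ≟ᵇ false)

      -- Greedy alternation along each run, starting with its second member. The constant function
      -- handed to `Marks?` makes the recursion structural, since `K (suc j)` consults only `K j`.
      K : ℕ → Bool
      K zero    = false
      K (suc j) = does (Marks? (λ _ → K j) j)

    marking : Marking K C
    marking = record
      { inside = λ { {suc j} k → z<s , proj₁ (proj₂ (does-true (Marks? (λ _ → K j) j) k)) }
      ; marked≢ = λ { {suc j} k → proj₁ (proj₂ (proj₂ (proj₂ (does-true (Marks? (λ _ → K j) j) k)))) }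
      ; before = λ {j} k → let 0<j , sj<N , dj , _ , kj = does-true (Marks? (λ _ → K j) j) k in
          (0<j , <-trans (n<1+n j) sj<N) , dj , kj
      ; covers = λ {j} 0<j sj<N dj dsj → case K j ≟ᵇ true of λ where
          (yes kj) → inj₁ kj
          (no ¬kj) → inj₂ (dec-true (Marks? (λ _ → K j) j) (0<j , sj<N , dj , dsj , ¬-not ¬kj))
      }

    isolate : ∃[ D ] C ⟶[ n + count is-o C ] D × Isolated D
    isolate = isolateMarked _ K C marking bound
      where
      -- Two ends against `1 + 1` for orientation `o`, one flip against `1 + 0` otherwise.
      φ≤ : ∀ i → 0 < i → i ≤ n → φ K C i ≤ 1 + bit (is-o (d C i))
      φ≤ i _ _ with is-o (d C i)
      ... | true  = +-mono-≤ (bit≤1 (K (hi C i))) (bit≤1 (K (lo C i)))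
      ... | false = subst (_≤ 1) refl (bit≤1 (K i))

      bound : Φ K C ≤ n + count is-o C
      bound = ≤-trans (∑-mono-≤ n φ≤) (≤-reflexive (trans (∑-+ (λ _ → 1) _ n)
                (cong (_+ count is-o C) (trans (∑-const 1 n) (*-identityʳ n)))))

-- Extending to the boundary and turning the isolated segments

module Straight (n : ℕ) (o : Orientation) where
  open Configurations n
  open Reflection n using (rev; rev-⟶; rv; rv-In; rv-rv-In; rv-<; rv-rv; lo≤N; rv-bound)
  open Straightening n o

  AllHigh AllLow : Config → Set
  AllHigh C = ∀ {i} → In i → d C i ≡ o → hi C i ≡ N
  AllLow  C = ∀ {i} → In i → d C i ≡ o → lo C i ≡ 0

  -- Raising high ends of segments of orientation `o` shortens low arms of perpendicular bars only,
  -- so the low ends in question survive. After the half turn this becomes `KeepsHigh`, by which the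
  -- lowering pass does not undo the raising one.
  KeepsLow KeepsHigh : Config → Config → Set
  KeepsLow  C D = ∀ {i} → In i → d C i ≡ d D i × (d C i ≡ o → lo C i ≡ lo D i)
  KeepsHigh C D = ∀ {i} → In i → d C i ≡ d D i × (d C i ≡ o → hi C i ≡ hi D i)

  ψ : Config → ℕ → ℕ
  ψ C i = bit (is-o (d C i) ∧ not (does (hi C i ≟ N)))

  Ψ : Config → ℕ
  Ψ C = ∑ (ψ C) n

  Ψ≤ : ∀ C → Ψ C ≤ count is-o C
  Ψ≤ C = ∑-mono-≤ n λ i _ _ → bit-mono (∧-true (is-o (d C i)))
    where
    ∧-true : ∀ a {b} → a ∧ b ≡ true → a ≡ true
    ∧-true true _ = refl

  Ψ-< : ∀ {C D i} → In i → (∀ {t} → In t → d C t ≡ d D t) → (∀ {t} → In t → t ≢ i → hi C t ≡ hi D t) →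
        d C i ≡ o → hi C i ≢ N → hi D i ≡ N → Ψ D < Ψ C
  Ψ-< {C} {D} {i} i∈ dd hh di≡o hi≢N hi≡N = ∑-mono-< n others i (proj₁ i∈) (s≤s⁻¹ (proj₂ i∈)) atI
    where
    ψD≡0 : ψ D i ≡ 0
    ψD≡0 rewrite dec-true (hi D i ≟ N) hi≡N with is-o (d D i)
    ... | true  = refl
    ... | false = refl

    ψC≡1 : ψ C i ≡ 1
    ψC≡1 rewrite dec-true (d C i ≟ₒ o) di≡o | dec-false (hi C i ≟ N) hi≢N = refl

    atI : ψ D i < ψ C i
    atI = subst₂ _<_ (sym ψD≡0) (sym ψC≡1) z<s

    others : ∀ t → 0 < t → t ≤ n → ψ D t ≤ ψ C t
    others t 0<t t≤n = case t ≟ i of λ where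
      (yes refl) → <⇒≤ atI
      (no t≢i)   → ≤-reflexive (sym (cong₂ (λ a h → bit (is-o a ∧ not (does (h ≟ N))))
                                       (dd (0<t , pos t≤n)) (hh (0<t , pos t≤n) t≢i)))

  Hit : Config → ℕ → ℕ → Set
  Hit C j i = 0 < i × d C i ≡ o × hi C i ≡ j

  Hit? : ∀ C j → Decidable (Hit C j)
  Hit? C j i = (0 <? i) ×-dec (d C i ≟ₒ o) ×-dec (hi C i ≟ j)

  module _ (C : Config) (iso : Isolated C) {i j : ℕ} (i∈ : In i) (di≡o : d C i ≡ o)
           (hi≡j : hi C i ≡ j) (j<N : j < N) (min : ∀ t → t < i → ¬ Hit C j t)
           (max : ∀ m → j < m → m < N → ∀ t → t < N → ¬ Hit C m t) where
    private
      hi<N : hi C i < N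
      hi<N = subst (_< N) (sym hi≡j) j<N

      -- `min` concerns segments of orientation `o`, but whatever ends on the bar `j` is
      -- perpendicular to it and so parallel to `i`.
      firstC : ∀ t → 0 < t → t < i → hi C t ≢ hi C i
      firstC t 0<t t<i e = min t t<i
        (0<t , trans (≢∧≢⇒≡ dt≢ (proj₁ (hiT C i∈ hi<N) ∘ sym)) di≡o , trans e hi≡j)
        where
        t∈ = 0<t , <-trans t<i (proj₂ i∈)
        dt≢ : d C t ≢ d C (hi C i)
        dt≢ x = proj₁ (hiT C t∈ (subst (_< N) (sym e) hi<N)) (trans (cong (d C) e) (sym x))

      -- `j` is the highest index below `N` at which a high end of orientation `o` stops.
      beyond : ∀ {t} → In t → d C t ≡ o → j < hi C t → hi C t ≡ N
      beyond {t} t∈ dt≡o j<hi = case m≤n⇒m<n∨m≡n (hi≤N C t∈) of λ where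
        (inj₁ hi<N) → contradiction (proj₁ t∈ , dt≡o , refl) (max (hi C t) j<hi hi<N t (proj₂ t∈))
        (inj₂ hi≡N) → hi≡N

      ext₁ = extendHigh C i∈ hi<N firstC
      D₁ = proj₁ ext₁
      rot₁ = proj₁ (proj₂ ext₁)
      j<m : j < hi D₁ i
      j<m = subst (_< hi D₁ i) hi≡j (proj₁ (proj₂ (proj₂ ext₁)))
      module R₁ = Rot rot₁

      dhi≢o : d C (hi C i) ≢ o
      dhi≢o e = proj₁ (hiT C i∈ hi<N) (trans e (sym di≡o))

      keeps₁ : KeepsLow C D₁
      keeps₁ t∈ = R₁.sameD t∈ , λ dt≡o → R₁.sameLo t∈ λ { refl → dhi≢o dt≡o }

    -- A first extension can only be stopped by a bar that nobody hits; the
    -- segment just above that bar is isolated from it and reaches N, so a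
    -- second extension is not stopped at all.
    raiseOne : ∃[ D ] C ⟶[ 2 ] D × KeepsLow C D × Ψ D < Ψ C
    raiseOne with m≤n⇒m<n∨m≡n (hi≤N D₁ i∈)
    ... | inj₂ m≡N = D₁ , ⟶-mono (s≤s z≤n) (single (raise rot₁)) , keeps₁ ,
          Ψ-< {C} {D₁} i∈ R₁.sameD R₁.sameHi di≡o (<⇒≢ hi<N) m≡N
    ... | inj₁ m<N = D₂ , single (raise rot₁) ⊙ single (raise rot₂) , keeps₂ ,
          Ψ-< {C} {D₂} i∈ (proj₁ ∘ keeps₂) (λ t∈ t≢i → trans (R₁.sameHi t∈ t≢i) (R₂.sameHi t∈ t≢i))
              di≡o (<⇒≢ hi<N) m′≡N
      where
      m = hi D₁ i
      m∈ : In m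
      m∈ = hi-In D₁ i∈ m<N

      dm≢o : d C m ≢ o
      dm≢o e = proj₁ (hiT D₁ i∈ m<N)
        (trans (sym (R₁.sameD m∈)) (trans e (trans (sym di≡o) (R₁.sameD i∈))))

      -- `m` lies above `j`, so in `C` it stops no high end of orientation `o`; the first rotation
      -- adds that of `i` only.
      firstD₁ : ∀ t → 0 < t → t < i → hi D₁ t ≢ hi D₁ i
      firstD₁ t 0<t t<i e = max m j<m m<N t (proj₂ t∈) (0<t , dt≡o , hit)
        where
        t∈ = 0<t , <-trans t<i (proj₂ i∈)
        hit : hi C t ≡ m
        hit = trans (R₁.sameHi t∈ (<⇒≢ t<i)) e
        dt≡o : d C t ≡ o
        dt≡o = opposed dm≢o (subst (λ z → d C z ≢ d C t) hit (proj₁ (hiT C t∈ (subst (_< N) (sym hit) m<N))))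

      ext₂ = extendHigh D₁ i∈ m<N firstD₁
      D₂ = proj₁ ext₂
      rot₂ = proj₁ (proj₂ ext₂)
      module R₂ = Rot rot₂

      keeps₂ : KeepsLow C D₂
      keeps₂ t∈ = trans (R₁.sameD t∈) (R₂.sameD t∈) , λ dt≡o →
        trans (proj₂ (keeps₁ t∈) dt≡o) (R₂.sameLo t∈ λ { refl → dm≢o dt≡o })

      -- A further bar `m′` would have a low arm reaching below `i` and so cross `suc m`, a segment
      -- of orientation `o` that ends above `j` and therefore at `N`.
      notBelow : ¬ (hi D₂ i < N)
      notBelow m′<N = case m≤n⇒m<n∨m≡n m<m′ of λ where
          (inj₂ sm≡m′) → dm′≢o (trans (cong (d C) (sym sm≡m′)) dsm≡o)
          (inj₁ sm<m′) → case nc C z<s sm<m′ m′<N (λ e → dm′≢o (trans (sym e) dsm≡o)) of λ where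
            (inj₁ hi≤m′) → <⇒≱ m′<N (subst (_≤ m′) hism≡N hi≤m′)
            (inj₂ sm≤lo) → <⇒≱ (<-trans lo<i (<-trans i<m (n<1+n m))) sm≤lo
        where
        m′ = hi D₂ i
        m<m′ : m < m′
        m<m′ = proj₁ (proj₂ (proj₂ ext₂))
        i<m = <hi D₁ i∈
        m′∈ = hi-In D₂ i∈ m′<N
        dm′≢o : d C m′ ≢ o
        dm′≢o e = proj₁ (hiT D₂ i∈ m′<N)
          (trans (sym (proj₁ (keeps₂ m′∈))) (trans e (trans (sym di≡o) (proj₁ (keeps₂ i∈)))))
        sm<N = ≤-<-trans m<m′ m′<N
        dsm≡o : d C (suc m) ≡ o
        dsm≡o = iso (proj₁ m∈) sm<N dm≢o
        hism≡N : hi C (suc m) ≡ N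
        hism≡N = beyond (z<s , sm<N) dsm≡o (<-trans j<m (<-trans (n<1+n m) (<hi C (z<s , sm<N))))
        lo<i : lo C m′ < i
        lo<i = subst (_< i) (sym (trans
          (R₁.sameLo m′∈ (>⇒≢ (subst (_< m′) (sym hi≡j) (<-trans j<m m<m′))))
          (R₂.sameLo m′∈ (>⇒≢ m<m′)))) (proj₂ (hiT D₂ i∈ m′<N))

      m′≡N : hi D₂ i ≡ N
      m′≡N = ≤-antisym (hi≤N D₂ i∈) (≮⇒≥ notBelow)

  raiseStep : ∀ C → Isolated C → AllHigh C ⊎ ∃[ D ] C ⟶[ 2 ] D × KeepsLow C D × Ψ D < Ψ C
  raiseStep C iso with greatest (λ j → anyBelow? (Hit? C j) N) N
  ... | inj₂ none = inj₁ λ {i} i∈ di≡o → case m≤n⇒m<n∨m≡n (hi≤N C i∈) of λ where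
        (inj₁ hi<N) → contradiction (i , proj₂ i∈ , proj₁ i∈ , di≡o , refl) (none (hi C i) hi<N)
        (inj₂ hi≡N) → hi≡N
  ... | inj₁ (j , j<N , (i₀ , i₀<N , hit₀) , max) with least (Hit? C j) N
  ...   | inj₂ none = contradiction hit₀ (none i₀ i₀<N)
  ...   | inj₁ (i , i<N , (0<i , di≡o , hi≡j) , min) =
          inj₂ (raiseOne C iso (0<i , i<N) di≡o hi≡j j<N min
            (λ m j<m m<N t t<N hit → max m j<m m<N (t , t<N , hit)))

  Isolated-resp : ∀ {C D} → (∀ {j} → In j → d C j ≡ d D j) → Isolated C → Isolated D
  Isolated-resp dd iso 0<j sj<N dj≢o =
    trans (sym (dd (z<s , sj<N))) (iso 0<j sj<N (dj≢o ∘ trans (sym (dd (0<j , <-trans (n<1+n _) sj<N)))))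

  raiseAll : ∀ b C → Isolated C → Ψ C ≤ b → ∃[ D ] C ⟶[ b * 2 ] D × KeepsLow C D × AllHigh D
  raiseAll b C iso Ψ≤b with raiseStep C iso
  ... | inj₁ tops = C , done , (λ _ → refl , λ _ → refl) , tops
  raiseAll zero    C iso Ψ≤b | inj₂ (D , w , keeps , Ψ<) = contradiction (<-≤-trans Ψ< Ψ≤b) λ ()
  raiseAll (suc b) C iso Ψ≤b | inj₂ (D , w , keeps , Ψ<) =
    let E , w′ , keeps′ , tops = raiseAll b D (Isolated-resp {C} {D} (proj₁ ∘ keeps) iso)
                                   (s≤s⁻¹ (<-≤-trans Ψ< Ψ≤b)) in
    E , w ⊙ w′
      , (λ i∈ → trans (proj₁ (keeps i∈)) (proj₁ (keeps′ i∈)) , λ di≡o →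
           trans (proj₂ (keeps i∈) di≡o) (proj₂ (keeps′ i∈) (trans (sym (proj₁ (keeps i∈))) di≡o)))
      , tops

  raiseHigh : ∀ C → Isolated C → ∃[ D ] C ⟶[ count is-o C * 2 ] D × KeepsLow C D × AllHigh D
  raiseHigh C iso = raiseAll (count is-o C) C iso (Ψ≤ C)

  count-cong : ∀ p {C D} → (∀ {j} → In j → d C j ≡ d D j) → count p C ≡ count p D
  count-cong p dd = ∑-cong n λ j 0<j j≤n → cong (bit ∘ p) (dd (0<j , pos j≤n))

  Isolated-rev : ∀ C → Isolated C → Isolated (rev C)
  Isolated-rev C iso {j} 0<j sj<N dj≢o = case d C (rv (suc j)) ≟ₒ o of λ where
      (yes e)   → e
      (no ds≢o) → contradiction
        (trans (cong (d C) rvj≡) (iso (proj₁ (rv-In {suc j} (z<s , sj<N))) (subst (_< N) rvj≡ rvj<N) ds≢o))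
        dj≢o
    where
    rvj≡ : rv j ≡ suc (rv (suc j))
    rvj≡ = +-∸-assoc 1 (<⇒≤ (s≤s⁻¹ sj<N))
    rvj<N : rv j < N
    rvj<N = proj₂ (rv-In {j} (0<j , <-trans (n<1+n j) sj<N))

  -- The half turn of `raiseHigh`; by `∑-reverse` the number of segments of orientation `o`, and
  -- with it the cost, is the same for `rev C`.
  lowerLow : ∀ C → Isolated C → ∃[ D ] C ⟶[ count is-o C * 2 ] D × KeepsHigh C D × AllLow D
  lowerLow C iso with raiseHigh (rev C) (Isolated-rev C iso)
  ... | D , w , keeps , tops =
        rev D
      , subst (λ z → C ⟶[ z * 2 ] rev D) (∑-reverse (λ i → bit (is-o (d C i))) n) (rev-⟶ w)
      , keeps′
      , λ i∈ dD≡o → trans (cong rv (tops (rv-In i∈) dD≡o)) (n∸n≡0 N)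
    where
    keeps′ : KeepsHigh C (rev D)
    keeps′ {i} i∈ with keeps (rv-In i∈)
    ... | dd , ll rewrite rv-rv-In i∈ = dd , λ di≡o →
          trans (sym (rv-rv (hi≤N C i∈))) (cong rv (ll di≡o))

  module _ (C : Config) (iso : Isolated C) (tops : AllHigh C) (bottoms : AllLow C)
           {j : ℕ} (j∈ : In j) (dj≢o : d C j ≢ o) where
    private
      -- A segment ending on `j` would have orientation `o`, and those end on the boundary only.
      freeHi : ∀ t → In t → hi C t ≢ j
      freeHi t t∈ refl = <⇒≢ (proj₂ j∈) (tops t∈ (opposed dj≢o (proj₁ (hiT C t∈ (proj₂ j∈)))))

      freeLo : ∀ t → In t → lo C t ≢ j
      freeLo t t∈ refl = >⇒≢ (proj₁ j∈) (bottoms t∈ (opposed dj≢o (proj₁ (loT C t∈ (proj₁ j∈)))))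

      T = turnSegment C j∈ freeHi freeLo
      D = proj₁ T
      open Turn (proj₁ (proj₂ T)) hiding (i∈)

      dD≡o : d D j ≡ o
      dD≡o = opposed dj≢o (turned ∘ sym)

      -- A bar `m` stopping the turned segment would reach below `j`. It would then cross `suc j`,
      -- which has orientation `o` by isolation and extends to `N`.
      hiD≡N : hi D j ≡ N
      hiD≡N = ≤-antisym (hi≤N D j∈) (≮⇒≥ λ m<N → stopped (hi D j) refl m<N)
        where
        stopped : ∀ m → hi D j ≡ m → ¬ (m < N)
        stopped m refl m<N = case m≤n⇒m<n∨m≡n j<m of λ where
            (inj₂ sj≡m) → dm≢o (trans (cong (d C) (sym sj≡m)) dsj≡o)
            (inj₁ sj<m) → case nc C z<s sj<m m<N (λ e → dm≢o (trans (sym e) dsj≡o)) of λ where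
              (inj₁ hi≤m)  → <⇒≱ m<N (subst (_≤ m) (tops (z<s , sj<N) dsj≡o) hi≤m)
              (inj₂ sj≤lo) → <⇒≱ (<-trans lo<j (n<1+n j)) sj≤lo
          where
          j<m = <hi D j∈
          m∈ = hi-In D j∈ m<N
          m≢j = >⇒≢ j<m
          H = hiT D j∈ m<N
          dm≢o : d C m ≢ o
          dm≢o e = proj₁ H (trans (sym (proj₁ (same m∈ m≢j))) (trans e (sym dD≡o)))
          lo<j : lo C m < j
          lo<j = subst (_< j) (sym (proj₁ (proj₂ (same m∈ m≢j)))) (proj₂ H)
          sj<N = ≤-<-trans j<m m<N
          dsj≡o = iso (proj₁ j∈) sj<N dj≢o

      -- Here the witness is `suc l`, the neighbour of the stopping bar `l`: it has orientation `o`
      -- and extends down to 0, so the high arm of `l`, which passes `j`, would cross it.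
      loD≡0 : lo D j ≡ 0
      loD≡0 = n≤0⇒n≡0 (≮⇒≥ λ 0<l → stopped (lo D j) refl 0<l)
        where
        stopped : ∀ l → lo D j ≡ l → ¬ (0 < l)
        stopped l refl 0<l = case m≤n⇒m<n∨m≡n l<j of λ where
            (inj₂ sl≡j) → dj≢o (trans (cong (d C) (sym sl≡j)) dsl≡o)
            (inj₁ sl<j) → case nc C 0<l (n<1+n l) sl<N (λ e → dl≢o (trans e dsl≡o)) of λ where
              (inj₁ hi≤sl) → <⇒≱ (<-trans sl<j j<hi) hi≤sl
              (inj₂ l≤lo)  → <⇒≱ 0<l (subst (l ≤_) (bottoms (z<s , sl<N) dsl≡o) l≤lo)
          where
          l<j = lo< D j∈
          l∈ = lo-In D j∈ 0<l
          l≢j = <⇒≢ l<j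
          L = loT D j∈ 0<l
          dl≢o : d C l ≢ o
          dl≢o e = proj₁ L (trans (sym (proj₁ (same l∈ l≢j))) (trans e (sym dD≡o)))
          j<hi : j < hi C l
          j<hi = subst (j <_) (sym (proj₂ (proj₂ (same l∈ l≢j)))) (proj₂ L)
          sl<N = ≤-<-trans l<j (proj₂ j∈)
          dsl≡o = iso 0<l sl<N dl≢o

      atJ : bit (not-o (d D j)) < bit (not-o (d C j))
      atJ = bit-< (cong not (dec-true (d D j ≟ₒ o) dD≡o)) (cong not (dec-false (d C j ≟ₒ o) dj≢o))

      others : ∀ t → 0 < t → t ≤ n → bit (not-o (d D t)) ≤ bit (not-o (d C t))
      others t 0<t t≤n = case t ≟ j of λ where
        (yes refl) → <⇒≤ atJ
        (no t≢j)   → ≤-reflexive (cong (bit ∘ not-o) (sym (proj₁ (same (0<t , pos t≤n) t≢j))))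

    turnOne : ∃[ D ] Adj C D × Isolated D × AllHigh D × AllLow D × count not-o D < count not-o C
    turnOne = D , turn (proj₁ (proj₂ T)) , iso′ , high′ , low′ ,
              ∑-mono-< n others j (proj₁ j∈) (s≤s⁻¹ (proj₂ j∈)) atJ
      where
      iso′ : Isolated D
      iso′ {t} 0<t st<N dt≢o with suc t ≟ j
      ... | yes refl = dD≡o
      ... | no st≢j = trans (sym (proj₁ (same (z<s , st<N) st≢j)))
            (iso 0<t st<N (dt≢o ∘ trans (sym (proj₁ (same (0<t , <-trans (n<1+n t) st<N)
              λ { refl → dt≢o dD≡o })))))

      high′ : AllHigh D
      high′ {t} t∈ dt≡o with t ≟ j
      ... | yes refl = hiD≡N
      ... | no t≢j = let dd , _ , hh = same t∈ t≢j in trans (sym hh) (tops t∈ (trans dd dt≡o))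

      low′ : AllLow D
      low′ {t} t∈ dt≡o with t ≟ j
      ... | yes refl = loD≡0
      ... | no t≢j = let dd , ll , _ = same t∈ t≢j in trans (sym ll) (bottoms t∈ (trans dd dt≡o))

  Straight : Config → Set
  Straight C = ∀ {i} → In i → d C i ≡ o × lo C i ≡ 0 × hi C i ≡ N

  turnAll : ∀ b C → Isolated C → AllHigh C → AllLow C → count not-o C ≤ b → ∃[ D ] C ⟶[ b ] D × Straight D
  turnAll b C iso tops bottoms c≤b with least (λ j → (0 <? j) ×-dec ¬? (d C j ≟ₒ o)) N
  ... | inj₂ none = C , done , λ {i} i∈ → case d C i ≟ₒ o of λ where
        (yes e)   → e , bottoms i∈ e , tops i∈ e
        (no di≢o) → contradiction (proj₁ i∈ , di≢o) (none i (proj₂ i∈))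
  ... | inj₁ (j , j<N , (0<j , dj≢o) , _) with turnOne C iso tops bottoms (0<j , j<N) dj≢o
  turnAll zero    C _ _ _ c≤b | inj₁ _ | D , a , iso , tops , bottoms , c< = contradiction (<-≤-trans c< c≤b) λ ()
  turnAll (suc b) C _ _ _ c≤b | inj₁ _ | D , a , iso , tops , bottoms , c< =
    let E , w , s = turnAll b D iso tops bottoms (s≤s⁻¹ (<-≤-trans c< c≤b)) in E , single a ⊙ w , s

  count-split : ∀ C → count is-o C + count not-o C ≡ n
  count-split C = trans (sym (∑-+ _ _ n))
    (trans (∑-cong n λ i _ _ → one (is-o (d C i))) (trans (∑-const 1 n) (*-identityʳ n)))
    where
    one : ∀ b → bit b + bit (not b) ≡ 1
    one true  = refl
    one false = refl

  -- `v` and `h` are counted after isolation and stay fixed until the final flips. Raising and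
  -- lowering cost `2 * v` each and the flips cost `h`; as `v + h ≡ n`, this is at most `4 * n`, on
  -- top of `n + count is-o C` for isolation.
  straighten : ∀ C → ∃[ D ] C ⟶[ 5 * n + count is-o C ] D × Straight D
  straighten C =
    let A , w₁ , isoA           = isolate C
        B , w₂ , keepsB , highB = raiseHigh A isoA
        isoB = Isolated-resp {A} {B} (proj₁ ∘ keepsB) isoA
        D , w₃ , keepsD , lowD  = lowerLow B isoB
        isoD = Isolated-resp {B} {D} (proj₁ ∘ keepsD) isoB
        highD : AllHigh D
        highD i∈ di≡o = let dd , hh = keepsD i∈ ; e = trans dd di≡o in trans (sym (hh e)) (highB i∈ e)
        E , w₄ , straight = turnAll (count not-o D) D isoD highD lowD ≤-refl
        v = count is-o D
        vB : count is-o B ≡ v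
        vB = count-cong is-o {B} {D} (proj₁ ∘ keepsD)
        vA : count is-o A ≡ v
        vA = trans (count-cong is-o {A} {B} (proj₁ ∘ keepsB)) vB
    in E
     , ⟶-mono (subst₂ (λ a b → n + count is-o C + (a * 2 + (b * 2 + count not-o D)) ≤ 5 * n + count is-o C)
         (sym vA) (sym vB) (cost (count is-o C) v (count not-o D) (count-split D)))
         (w₁ ⊙ w₂ ⊙ w₃ ⊙ w₄)
     , straight
    where
    cost : ∀ c v h → v + h ≡ n → n + c + (v * 2 + (v * 2 + h)) ≤ 5 * n + c
    cost c v h refl = subst₂ _≤_ (sym (lhs c v h)) (sym (rhs c v h)) (m≤m+n _ (3 * h))
      where
      open +-*-Solver
      lhs : ∀ c v h → v + h + c + (v * 2 + (v * 2 + h)) ≡ 5 * v + 2 * h + c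
      lhs = solve 3 (λ c v h → v :+ h :+ c :+ (v :* con 2 :+ (v :* con 2 :+ h)) := con 5 :* v :+ con 2 :* h :+ c) refl
      rhs : ∀ c v h → 5 * (v + h) + c ≡ 5 * v + 2 * h + c + 3 * h
      rhs = solve 3 (λ c v h → con 5 :* (v :+ h) :+ c := con 5 :* v :+ con 2 :* h :+ c :+ con 3 :* h) refl

-- The bound for configurations

module Diameter (n : ℕ) where
  open Configurations n
  module V = Straight n vertical
  module H = Straight n horizontal

  #v #h : Config → ℕ
  #v = Straightening.count n vertical (Straightening.is-o n vertical)
  #h = Straightening.count n horizontal (Straightening.is-o n horizontal)

  #v+#h : ∀ C → #v C + #h C ≡ n
  #v+#h C = trans (cong (#v C +_) (∑-cong n λ i _ _ → agree (d C i))) (V.count-split C)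
    where
    agree : ∀ a → bit (does (a ≟ₒ horizontal)) ≡ bit (not (does (a ≟ₒ vertical)))
    agree horizontal = refl
    agree vertical   = refl

  -- For each `o` all straight configurations agree up to `_≗_`, so the two walks join without a
  -- further step.
  meet : ∀ {o A B C D a b} → Straight.Straight n o C → Straight.Straight n o D →
         A ⟶[ 5 * n + a ] C → B ⟶[ 5 * n + b ] D → a + b ≤ n → A ⟶[ 11 * n ] B
  meet {A = A} {B} {C} {D} {a} {b} sC sD u w a+b≤n =
    ⟶-mono (≤-trans (≤-reflexive (e₁ n a b)) (≤-trans (+-monoʳ-≤ (10 * n) a+b≤n) (≤-reflexive (e₂ n))))
      (u ⊙ joined ⊙ ⟶-sym w)
    where
    joined : C ⟶[ 0 ] D
    joined = 0 , z≤n , stop λ i∈ →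
      let dc , lc , hc = sC i∈ ; dd , ld , hd = sD i∈ in
      trans dc (sym dd) , trans lc (sym ld) , trans hc (sym hd)
    open +-*-Solver
    e₁ : ∀ n a b → 5 * n + a + (0 + (5 * n + b)) ≡ 10 * n + (a + b)
    e₁ = solve 3 (λ n a b → con 5 :* n :+ a :+ (con 0 :+ (con 5 :* n :+ b)) := con 10 :* n :+ (a :+ b)) refl
    e₂ : ∀ n → 10 * n + n ≡ 11 * n
    e₂ = solve 1 (λ n → con 10 :* n :+ n := con 11 :* n) refl

  connected : ∀ A B → A ⟶[ 11 * n ] B
  connected A B with #v A + #v B ≤? n
  ... | yes v≤n = let C , u , sC = V.straighten A ; D , w , sD = V.straighten B in
                  meet {vertical} {A} {B} {C} {D} sC sD u w v≤n
  ... | no v≰n  = let C , u , sC = H.straighten A ; D , w , sD = H.straighten B in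
                  meet {horizontal} {A} {B} {C} {D} sC sD u w (few {#v A} {#v B} {#h A} {#h B} (#v+#h A) (#v+#h B) v≰n)
    where
    few : ∀ {v v′ h h′} → v + h ≡ n → v′ + h′ ≡ n → ¬ (v + v′ ≤ n) → h + h′ ≤ n
    few {v} {v′} {h} {h′} e e′ v≰n = ≮⇒≥ λ n<h →
      <-irrefl (trans (sym (cong₂ _+_ e e′)) (interchange v h v′ h′)) (+-mono-< (≰⇒> v≰n) n<h)

-- Ranking the points

cardinality : ∀ {m} → (Fin m → Bool) → ℕ
cardinality {zero}  p = 0
cardinality {suc m} p = bit (p zero) + cardinality (p ∘ suc)

cardinality-mono-≤ : ∀ {m} {p q : Fin m → Bool} → (∀ i → p i ≡ true → q i ≡ true) →
                     cardinality p ≤ cardinality q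
cardinality-mono-≤ {zero}  p⊆q = z≤n
cardinality-mono-≤ {suc m} p⊆q = +-mono-≤ (bit-mono (p⊆q zero)) (cardinality-mono-≤ (p⊆q ∘ suc))

cardinality-mono-< : ∀ {m} {p q : Fin m → Bool} → (∀ i → p i ≡ true → q i ≡ true) →
                     ∀ i → p i ≡ false → q i ≡ true → cardinality p < cardinality q
cardinality-mono-< p⊆q zero    pi qi = +-mono-<-≤ (bit-< pi qi) (cardinality-mono-≤ (p⊆q ∘ suc))
cardinality-mono-< p⊆q (suc i) pi qi = +-mono-≤-< (bit-mono (p⊆q zero)) (cardinality-mono-< (p⊆q ∘ suc) i pi qi)

cardinality-full : ∀ m → cardinality {m} (λ _ → true) ≡ m
cardinality-full zero    = refl
cardinality-full (suc m) = cong suc (cardinality-full m)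

-- If `k` were missed, punching it out would inject `Fin (suc m)` into `Fin m`.
injective⇒hits : ∀ {m} (f : Fin (suc m) → Fin (suc m)) → (∀ {i j} → f i ≡ f j → i ≡ j) →
                 ∀ k → ∃[ i ] f i ≡ k
injective⇒hits f f-inj k with Fin.any? (λ i → f i Fin.≟ k)
... | yes hit = hit
... | no miss = contradiction
      (Fin.injective⇒≤ {f = λ i → punchOut (k≢f i)}
        λ {i} {j} e → f-inj (Fin.punchOut-injective (k≢f i) (k≢f j) e))
      1+n≰n
  where
  k≢f : ∀ i → k ≢ f i
  k≢f i e = miss (i , sym e)

module Ranking {c ℓ₁ ℓ₂} (𝕃 : StrictTotalOrder c ℓ₁ ℓ₂) {m : ℕ}
               (key : Fin (suc m) → StrictTotalOrder.Carrier 𝕃)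
               (key-injective : ∀ i j → StrictTotalOrder._≈_ 𝕃 (key i) (key j) → i ≡ j) where

  open StrictTotalOrder 𝕃 using (compare; module Eq)
    renaming (_<_ to _⊏_; _<?_ to _⊏?_; trans to ⊏-trans; irrefl to ⊏-irrefl)
  open Configurations (suc m) using (N; In)

  private
    below : Fin (suc m) → Fin (suc m) → Bool
    below i j = does (key j ⊏? key i)

    rank₀ : Fin (suc m) → ℕ
    rank₀ i = cardinality (below i)

    not-below : ∀ i → below i i ≡ false
    not-below i = dec-false (key i ⊏? key i) (⊏-irrefl Eq.refl)

    rank₀< : ∀ i → rank₀ i < suc m
    rank₀< i = subst (rank₀ i <_) (cardinality-full (suc m))
      (cardinality-mono-< {p = below i} (λ _ _ → refl) i (not-below i) refl)

    rank₀-mono : ∀ {i j} → key i ⊏ key j → rank₀ i < rank₀ j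
    rank₀-mono {i} {j} ki<kj = cardinality-mono-< {p = below i} {q = below j}
      (λ t t∈ → dec-true (key t ⊏? key j) (⊏-trans (does-true (key t ⊏? key i) t∈) ki<kj))
      i (not-below i) (dec-true (key i ⊏? key j) ki<kj)

    rank₀-injective : ∀ {i j} → rank₀ i ≡ rank₀ j → i ≡ j
    rank₀-injective {i} {j} e with compare (key i) (key j)
    ... | tri< ki<kj _ _ = contradiction e (<⇒≢ (rank₀-mono ki<kj))
    ... | tri≈ _ ki≈kj _ = key-injective i j ki≈kj
    ... | tri> _ _ kj<ki = contradiction (sym e) (<⇒≢ (rank₀-mono kj<ki))

    hit : ∀ {k} → k < suc m → ∃[ i ] rank₀ i ≡ k
    hit k<m = let i , e = injective⇒hits (λ i → fromℕ< (rank₀< i))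
                            (λ e → rank₀-injective (Fin.fromℕ<-injective _ _ _ _ e)) (fromℕ< k<m) in
      i , Fin.fromℕ<-injective _ _ _ _ e

  -- The shift by one leaves index 0 to the low side of `R`.
  rank : Fin (suc m) → ℕ
  rank i = suc (rank₀ i)

  rank-In : ∀ i → In (rank i)
  rank-In i = z<s , s≤s (rank₀< i)

  rank-injective : ∀ {i j} → rank i ≡ rank j → i ≡ j
  rank-injective e = rank₀-injective (suc-injective e)

  private
    idx-dec : ∀ k → Dec (∃[ i ] rank i ≡ k)
    idx-dec k = Fin.any? (λ i → rank i ≟ k)

  idx : ℕ → Fin (suc m)
  idx k with idx-dec k
  ... | yes (i , _) = i
  -- A default: this case concerns indices outside `In`, which are the rank of no point.
  ... | no _        = zero

  rank-idx : ∀ {k} → In k → rank (idx k) ≡ k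
  rank-idx {suc k} (_ , k<N) with idx-dec (suc k)
  ... | yes (i , e) = e
  ... | no none     = let i , e = hit (s≤s⁻¹ k<N) in contradiction (i , cong suc e) none

  idx-rank : ∀ i → idx (rank i) ≡ i
  idx-rank i = rank-injective (rank-idx (rank-In i))

  key-mono : ∀ {a b} → In a → In b → a < b → key (idx a) ⊏ key (idx b)
  key-mono {a} {b} a∈ b∈ a<b with compare (key (idx a)) (key (idx b))
  ... | tri< ka<kb _ _ = ka<kb
  ... | tri≈ _ ka≈kb _ = contradiction
        (trans (sym (rank-idx a∈)) (trans (cong rank (key-injective _ _ ka≈kb)) (rank-idx b∈))) (<⇒≢ a<b)
  ... | tri> _ _ kb<ka = contradiction
        (subst₂ _<_ (rank-idx b∈) (rank-idx a∈) (s≤s (rank₀-mono kb<ka))) (<⇒≯ a<b)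

-- Grid coordinates

perp-perp : ∀ o → perp (perp o) ≡ o
perp-perp horizontal = refl
perp-perp vertical   = refl

module Grid {c ℓ₁ ℓ₂} (𝕃 : StrictTotalOrder c ℓ₁ ℓ₂) {m : ℕ}
            (P : Fin (suc m) → Plane.Point 𝕃) (R : Plane.Rectangle 𝕃)
            (D : Plane.IsDiagonalSet 𝕃 P) (inR : ∀ i → Plane._∈int_ 𝕃 (P i) R) where

  open Plane 𝕃 public renaming (lo to loˢ; hi to hiˢ)
  open StrictTotalOrder 𝕃 public using (Carrier; _≈_; compare; module Eq; <-resp-≈)
    renaming (_<_ to _⊏_; _<?_ to _⊏?_; trans to ⊏-trans; irrefl to ⊏-irrefl)
  module ≤ = StrictToNonStrict _≈_ _⊏_
  open ≤ public using () renaming (_≤_ to _⊑_)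

  ⊑-trans : ∀ {a b e} → a ⊑ b → b ⊑ e → a ⊑ e
  ⊑-trans = ≤.trans Eq.isEquivalence <-resp-≈ ⊏-trans

  ⊏-⊑-trans : ∀ {a b e} → a ⊏ b → b ⊑ e → a ⊏ e
  ⊏-⊑-trans = ≤.<-≤-trans ⊏-trans (proj₁ <-resp-≈)

  ⊑-⊏-trans : ∀ {a b e} → a ⊑ b → b ⊏ e → a ⊏ e
  ⊑-⊏-trans = ≤.≤-<-trans Eq.sym ⊏-trans (proj₂ <-resp-≈)

  ⊑-antisym : ∀ {a b} → a ⊑ b → b ⊑ a → a ≈ b
  ⊑-antisym = ≤.antisym Eq.isEquivalence ⊏-trans ⊏-irrefl

  ⊏⇒⋢ : ∀ {a b} → a ⊏ b → ¬ (b ⊑ a)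
  ⊏⇒⋢ a<b b≤a = ⊏-irrefl Eq.refl (⊏-⊑-trans a<b b≤a)

  ≮⇒⊒ : ∀ {a b} → ¬ (a ⊏ b) → b ⊑ a
  ≮⇒⊒ {a} {b} a≮b with compare a b
  ... | tri< a<b _ _ = contradiction a<b a≮b
  ... | tri≈ _ a≈b _ = inj₂ (Eq.sym a≈b)
  ... | tri> _ _ b<a = inj₁ b<a

  ≈⇒⊑ : ∀ {a b} → a ≈ b → a ⊑ b
  ≈⇒⊑ = inj₂

  ≡⇒≈ : ∀ {a b} → a ≡ b → a ≈ b
  ≡⇒≈ = Eq.reflexive

  across-along : ∀ o q → across o q ≡ along (perp o) q
  across-along horizontal q = refl
  across-along vertical   q = refl

  side : Rectangle → Orientation → End → Carrier
  side Q horizontal low  = left Q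
  side Q horizontal high = right Q
  side Q vertical   low  = bottom Q
  side Q vertical   high = top Q

  ∈ᴿ-side : ∀ {q Q} → q ∈ᴿ Q → ∀ o → side Q o low ⊑ along o q × along o q ⊑ side Q o high
  ∈ᴿ-side (h , v) horizontal = h
  ∈ᴿ-side (h , v) vertical   = v

  side-∈ᴿ : ∀ {q Q} → (∀ o → side Q o low ⊑ along o q × along o q ⊑ side Q o high) → q ∈ᴿ Q
  side-∈ᴿ s = s horizontal , s vertical

  ∈int-side : ∀ {q Q} → q ∈int Q → ∀ o → side Q o low ⊏ along o q × along o q ⊏ side Q o high
  ∈int-side (h , v) horizontal = h
  ∈int-side (h , v) vertical   = v

  ∈∂-low : ∀ {q Q} o → q ∈ᴿ Q → along o q ≈ side Q o low → q ∈∂ Q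
  ∈∂-low {q} {Q} o q∈ e = q∈ , λ q∈int → ⊏-irrefl (Eq.sym e) (proj₁ (∈int-side {q} {Q} q∈int o))

  ∈∂-high : ∀ {q Q} o → q ∈ᴿ Q → along o q ≈ side Q o high → q ∈∂ Q
  ∈∂-high {q} {Q} o q∈ e = q∈ , λ q∈int → ⊏-irrefl e (proj₂ (∈int-side {q} {Q} q∈int o))

  ∈∂-cases : ∀ {q Q} → q ∈∂ Q → ∃[ o ] (along o q ≈ side Q o low ⊎ along o q ≈ side Q o high)
  ∈∂-cases {q} {Q} (((inj₂ e , _) , _) , _) = horizontal , inj₁ (Eq.sym e)
  ∈∂-cases {q} {Q} (((_ , inj₂ e) , _) , _) = horizontal , inj₂ e
  ∈∂-cases {q} {Q} ((_ , (inj₂ e , _)) , _) = vertical , inj₁ (Eq.sym e)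
  ∈∂-cases {q} {Q} ((_ , (_ , inj₂ e)) , _) = vertical , inj₂ e
  ∈∂-cases {q} {Q} (((inj₁ a , inj₁ b) , (inj₁ e , inj₁ f)) , ¬int) = contradiction ((a , b) , (e , f)) ¬int

  side-⊏ : ∀ Q o → side Q o low ⊏ side Q o high
  side-⊏ Q horizontal = left<right Q
  side-⊏ Q vertical   = bottom<top Q

  private
    module D = IsDiagonalSet D
    module f = IsOrderHomomorphism D.strictIncreasing

    x-injective : ∀ i j → x (P i) ≈ x (P j) → i ≡ j
    x-injective i j e = D.distinct (e , Eq.trans (D.onGraph i) (Eq.trans (f.cong e) (Eq.sym (D.onGraph j))))

  open Ranking 𝕃 (x ∘ P) x-injective public
  open Configurations (suc m) public

  -- The indices 0 and N stand for the lower left and the upper right corner of R.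
  crd : Orientation → ℕ → Carrier
  crd o zero = side R o low
  crd o (suc k) with suc k <? N
  ... | yes _ = along o (P (idx (suc k)))
  ... | no _  = side R o high

  crd-In : ∀ o {k} → In k → crd o k ≡ along o (P (idx k))
  crd-In o {suc k} (_ , k<N) with suc k <? N
  ... | yes _   = refl
  ... | no k≮N = contradiction k<N k≮N

  crd-rank : ∀ o i → crd o (rank i) ≡ along o (P i)
  crd-rank o i = trans (crd-In o (rank-In i)) (cong (along o ∘ P) (idx-rank i))

  crd-N : ∀ o → crd o N ≡ side R o high
  crd-N o with N <? N
  ... | yes N<N = contradiction N<N (<-irrefl refl)
  ... | no _    = refl

  -- One ranking serves both axes, because `f` carries the order of the x-coordinates over to the
  -- y-coordinates.
  along-mono : ∀ o {a b} → In a → In b → a < b → along o (P (idx a)) ⊏ along o (P (idx b))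
  along-mono horizontal a∈ b∈ a<b = key-mono a∈ b∈ a<b
  along-mono vertical {a} {b} a∈ b∈ a<b =
    proj₁ <-resp-≈ (Eq.sym (D.onGraph (idx b)))
      (proj₂ <-resp-≈ (Eq.sym (D.onGraph (idx a))) (f.mono (key-mono a∈ b∈ a<b)))

  crd-mono-< : ∀ o {a b} → a < b → b ≤ N → crd o a ⊏ crd o b
  crd-mono-< o {a} {b} a<b b≤N with m≤n⇒m<n∨m≡n b≤N
  crd-mono-< o {zero}  a<b _ | inj₂ refl = subst (side R o low ⊏_) (sym (crd-N o)) (side-⊏ R o)
  crd-mono-< o {suc a} a<b _ | inj₂ refl =
    subst₂ _⊏_ (sym (crd-In o (z<s , a<b))) (sym (crd-N o)) (proj₂ (∈int-side (inR (idx (suc a))) o))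
  crd-mono-< o {zero}  {b} a<b _ | inj₁ b<N =
    subst (side R o low ⊏_) (sym (crd-In o (a<b , b<N))) (proj₁ (∈int-side (inR (idx b)) o))
  crd-mono-< o {suc a} {b} a<b _ | inj₁ b<N =
    subst₂ _⊏_ (sym (crd-In o a∈)) (sym (crd-In o b∈)) (along-mono o a∈ b∈ a<b)
    where
    a∈ = z<s , <-trans a<b b<N
    b∈ = <-trans z<s a<b , b<N

  crd-mono-≤ : ∀ o {a b} → a ≤ b → b ≤ N → crd o a ⊑ crd o b
  crd-mono-≤ o a≤b b≤N with m≤n⇒m<n∨m≡n a≤b
  ... | inj₁ a<b  = inj₁ (crd-mono-< o a<b b≤N)
  ... | inj₂ refl = inj₂ Eq.refl

  crd-cancel-< : ∀ o {a b} → a ≤ N → crd o a ⊏ crd o b → a < b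
  crd-cancel-< o a≤N lt = ≰⇒> λ b≤a → ⊏⇒⋢ lt (crd-mono-≤ o b≤a a≤N)

  crd-cancel-≤ : ∀ o {a b} → a ≤ N → crd o a ⊑ crd o b → a ≤ b
  crd-cancel-≤ o a≤N le = ≮⇒≥ λ b<a → ⊏⇒⋢ (crd-mono-< o b<a a≤N) le

  crd-injective : ∀ o {a b} → a ≤ N → b ≤ N → crd o a ≈ crd o b → a ≡ b
  crd-injective o a≤N b≤N e =
    ≤-antisym (crd-cancel-≤ o a≤N (inj₂ e)) (crd-cancel-≤ o b≤N (inj₂ (Eq.sym e)))

-- Faces of a configuration

-- The k-th face (0 ≤ k ≤ n) is the one met by the diagonal between the k-th and
-- the (k+1)-st point; its lower sides lie on the segments k and lo k, its upper
-- sides on the segments k+1 and hi (k+1).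
module Faces (n : ℕ) (C : Configurations.Config n) where
  open Configurations n

  -- Coordinates are read along `o`. A segment parallel to `o` cannot bound a face in that
  -- direction; the bar on which it ends does.
  lowerLine upperLine : Orientation → ℕ → ℕ
  lowerLine o zero    = 0
  lowerLine o (suc k) = if does (d C (suc k) ≟ₒ o) then lo C (suc k) else suc k
  -- The guard keeps `d C` from being read at `N`, where its value is junk.
  upperLine o k = if does (k <? N) ∧ does (d C k ≟ₒ o) then hi C k else k

  lowerLine-along : ∀ {o k} → 0 < k → d C k ≡ o → lowerLine o k ≡ lo C k
  lowerLine-along {o} {suc k} _ dk≡o rewrite dec-true (d C (suc k) ≟ₒ o) dk≡o = refl

  lowerLine-across : ∀ {o k} → 0 < k → d C k ≢ o → lowerLine o k ≡ k
  lowerLine-across {o} {suc k} _ dk≢o rewrite dec-false (d C (suc k) ≟ₒ o) dk≢o = refl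

  upperLine-along : ∀ {o k} → k < N → d C k ≡ o → upperLine o k ≡ hi C k
  upperLine-along {o} {k} k<N dk≡o rewrite dec-true (k <? N) k<N | dec-true (d C k ≟ₒ o) dk≡o = refl

  upperLine-across : ∀ {o k} → d C k ≢ o → upperLine o k ≡ k
  upperLine-across {o} {k} dk≢o rewrite dec-false (d C k ≟ₒ o) dk≢o with does (k <? N)
  ... | true  = refl
  ... | false = refl

  upperLine-N : ∀ {o} → upperLine o N ≡ N
  upperLine-N rewrite dec-false (N <? N) (<-irrefl refl) = refl

  data Lower (o : Orientation) (k : ℕ) : Set where
    corner : k ≡ 0 → lowerLine o k ≡ 0 → Lower o k
    parallel  : In k → d C k ≡ o → lowerLine o k ≡ lo C k → Lower o k
    crossing : In k → d C k ≢ o → lowerLine o k ≡ k → Lower o k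

  data Upper (o : Orientation) (k : ℕ) : Set where
    corner : k ≡ N → upperLine o k ≡ N → Upper o k
    parallel  : In k → d C k ≡ o → upperLine o k ≡ hi C k → Upper o k
    crossing : In k → d C k ≢ o → upperLine o k ≡ k → Upper o k

  lowerView : ∀ o {k} → k < N → Lower o k
  lowerView o {zero}  k<N = corner refl refl
  lowerView o {suc k} k<N with d C (suc k) ≟ₒ o
  ... | yes e = parallel (z<s , k<N) e (lowerLine-along z<s e)
  ... | no ne = crossing (z<s , k<N) ne (lowerLine-across z<s ne)

  upperView : ∀ o {k} → 0 < k → k ≤ N → Upper o k
  upperView o {k} 0<k k≤N with m≤n⇒m<n∨m≡n k≤N
  ... | inj₂ refl = corner refl upperLine-N
  ... | inj₁ k<N with d C k ≟ₒ o
  ...   | yes e = parallel (0<k , k<N) e (upperLine-along k<N e)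
  ...   | no ne = crossing (0<k , k<N) ne (upperLine-across ne)

  lowerLine-≤ : ∀ o {k} → k < N → lowerLine o k ≤ k
  lowerLine-≤ o {k} k<N with lowerView o k<N
  ... | corner _ e    = subst (_≤ k) (sym e) z≤n
  ... | parallel k∈ _ e  = subst (_≤ k) (sym e) (<⇒≤ (lo< C k∈))
  ... | crossing k∈ _ e = ≤-reflexive e

  ≤-upperLine : ∀ o {k} → 0 < k → k ≤ N → k ≤ upperLine o k
  ≤-upperLine o {k} 0<k k≤N with upperView o 0<k k≤N
  ... | corner _ e    = subst (k ≤_) (sym e) k≤N
  ... | parallel k∈ _ e  = subst (k ≤_) (sym e) (<⇒≤ (<hi C k∈))
  ... | crossing k∈ _ e = ≤-reflexive (sym e)

  upperLine≤N : ∀ o {k} → 0 < k → k ≤ N → upperLine o k ≤ N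
  upperLine≤N o 0<k k≤N with upperView o 0<k k≤N
  ... | corner _ e    = ≤-reflexive e
  ... | parallel k∈ _ e  = subst (_≤ N) (sym e) (hi≤N C k∈)
  ... | crossing k∈ _ e = subst (_≤ N) (sym e) k≤N

  -- If segment `k` is parallel to `t`, its low end is compared with that of `t` by `lo-laminar`;
  -- there `lo C t ≡ k` is impossible, because a stop is perpendicular to what it stops.
  lo≤lowerLine : ∀ {k t} → k < t → t < N → lo C t ≤ k → lo C t ≤ lowerLine (d C t) k
  lo≤lowerLine {k} {t} k<t t<N lo≤k with lowerView (d C t) (<-trans k<t t<N)
  ... | corner refl e  = subst (lo C t ≤_) (sym e) lo≤k
  ... | crossing _ _ e   = subst (lo C t ≤_) (sym e) lo≤k
  ... | parallel k∈ dk e  = subst (lo C t ≤_) (sym e) (case m≤n⇒m<n∨m≡n lo≤k of λ where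
        (inj₁ lo<k) → lo-laminar C (proj₁ k∈) k<t t<N dk lo<k
        (inj₂ refl) → contradiction dk (proj₁ (loT C (<-trans (proj₁ k∈) k<t , t<N) (proj₁ k∈))))

  upperLine≤hi : ∀ {k t} → 0 < t → t < k → k ≤ hi C t → t < N → upperLine (d C t) k ≤ hi C t
  upperLine≤hi {k} {t} 0<t t<k k≤hi t<N
    with upperView (d C t) (<-trans 0<t t<k) (≤-trans k≤hi (hi≤N C (0<t , t<N)))
  ... | corner refl e  = subst (_≤ hi C t) (sym e) k≤hi
  ... | crossing _ _ e   = subst (_≤ hi C t) (sym e) k≤hi
  ... | parallel k∈ dk e  = subst (_≤ hi C t) (sym e) (case m≤n⇒m<n∨m≡n k≤hi of λ where
        (inj₁ k<hi) → hi-laminar C 0<t t<k (proj₂ k∈) (sym dk) k<hi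
        (inj₂ k≡hi) → contradiction (trans (cong (d C) (sym k≡hi)) dk)
                        (proj₁ (hiT C (0<t , t<N) (subst (_< N) k≡hi (proj₂ k∈)))))

  -- The two inequalities make segment `t` cover the whole side of the face. The one at the far end
  -- is `upperLine≤hi`; at the near end it is immediate from `lo<`.
  lowerSide : ∀ o {k} → k < N → let t = lowerLine o k in
              t ≡ 0 ⊎ In t × d C t ≡ perp o × lo C t ≤ lowerLine (perp o) k × upperLine (perp o) (suc k) ≤ hi C t
  lowerSide o {k} k<N with lowerView o k<N
  ... | corner _ e = inj₁ e
  ... | crossing k∈ dk e rewrite e = inj₂ (k∈ , dk≡ , ≤-reflexive (sym (lowerLine-along (proj₁ k∈) dk≡)) ,
        subst (λ z → upperLine z (suc k) ≤ hi C k) dk≡ (upperLine≤hi (proj₁ k∈) (n<1+n k) (<hi C k∈) k<N))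
    where dk≡ = ≢⇒perp dk
  ... | parallel k∈ dk e rewrite e with lo C k ≟ 0
  ...   | yes l≡0 = inj₁ l≡0
  ...   | no l≢0 = inj₂ (l∈ , dl≡ ,
          subst (lo C (lo C k) ≤_) (sym (lowerLine-across (proj₁ k∈) λ e → perp≢ o (trans (sym e) dk)))
            (<⇒≤ (<-trans (lo< C l∈) (lo< C k∈))) ,
          subst (λ z → upperLine z (suc k) ≤ hi C (lo C k)) dl≡
            (upperLine≤hi (proj₁ l∈) (<-trans (lo< C k∈) (n<1+n k)) (proj₂ L) (proj₂ l∈)))
    where
    0<l = n≢0⇒n>0 l≢0
    l∈ = lo-In C k∈ 0<l
    L = loT C k∈ 0<l
    dl≡ : d C (lo C k) ≡ perp o
    dl≡ = ≢⇒perp (subst (d C (lo C k) ≢_) dk (proj₁ L))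

  upperSide : ∀ o {k} → k < N → let t = upperLine o (suc k) in
              t ≡ N ⊎ In t × d C t ≡ perp o × lo C t ≤ lowerLine (perp o) k × upperLine (perp o) (suc k) ≤ hi C t
  upperSide o {k} k<N with upperView o z<s k<N
  ... | corner _ e = inj₁ e
  ... | crossing k∈ dk e rewrite e = inj₂ (k∈ , dk≡ ,
        subst (λ z → lo C (suc k) ≤ lowerLine z k) dk≡ (lo≤lowerLine (n<1+n k) (proj₂ k∈) (s≤s⁻¹ (lo< C k∈))) ,
        ≤-reflexive (upperLine-along (proj₂ k∈) dk≡))
    where dk≡ = ≢⇒perp dk
  ... | parallel k∈ dk e rewrite e with m≤n⇒m<n∨m≡n (hi≤N C k∈)
  ...   | inj₂ h≡N = inj₁ h≡N
  ...   | inj₁ h<N = inj₂ (h∈ , dh≡ ,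
          subst (λ z → lo C (hi C (suc k)) ≤ lowerLine z k) dh≡
            (lo≤lowerLine (<-trans (n<1+n k) (<hi C k∈)) h<N (s≤s⁻¹ (proj₂ H))) ,
          subst (_≤ hi C (hi C (suc k))) (sym (upperLine-across λ e → perp≢ o (trans (sym e) dk)))
            (<⇒≤ (<-trans (<hi C k∈) (<hi C h∈))))
    where
    h∈ = hi-In C k∈ h<N
    H = hiT C k∈ h<N
    dh≡ : d C (hi C (suc k)) ≡ perp o
    dh≡ = ≢⇒perp (subst (d C (hi C (suc k)) ≢_) dk (proj₁ H))

-- Segments and points in terms of indices

module Representation {c ℓ₁ ℓ₂} (𝕃 : StrictTotalOrder c ℓ₁ ℓ₂) {m : ℕ}
                      (P : Fin (suc m) → Plane.Point 𝕃) (R : Plane.Rectangle 𝕃)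
                      (D : Plane.IsDiagonalSet 𝕃 P) (inR : ∀ i → Plane._∈int_ 𝕃 (P i) R) where
  open Grid 𝕃 P R D inR public

  rank≤N : ∀ i → rank i ≤ N
  rank≤N i = <⇒≤ (proj₂ (rank-In i))

  lo≤N : ∀ C {k} → In k → lo C k ≤ N
  lo≤N C k∈ = <⇒≤ (<-trans (lo< C k∈) (proj₂ k∈))

  On On° : Orientation → (k a b : ℕ) → Point → Set _
  On  o k a b q = along (perp o) q ≈ crd (perp o) k × crd o a ⊑ along o q × along o q ⊑ crd o b
  On° o k a b q = along (perp o) q ≈ crd (perp o) k × crd o a ⊏ along o q × along o q ⊏ crd o b

  OnSegment OnSegment° : Config → ℕ → Point → Set _
  OnSegment  C k = On  (d C k) k (lo C k) (hi C k)
  OnSegment° C k = On° (d C k) k (lo C k) (hi C k)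

  -- Positions agree only up to `_≈_`, the sense in which the ends of a given rectangulation lie on
  -- grid lines.
  record Rep (s : Segment) (C : Config) (k : ℕ) : Set (c Level.⊔ ℓ₁ Level.⊔ ℓ₂) where
    field
      dirᴿ : dir s ≡ d C k
      atᴿ  : at s ≈ crd (perp (dir s)) k
      loᴿ  : loˢ s ≈ crd (dir s) (lo C k)
      hiᴿ  : hiˢ s ≈ crd (dir s) (hi C k)
  open Rep public

  module _ {s : Segment} {C : Config} {k : ℕ} (ρ : Rep s C k) {q : Point} where

    ∈⇒On : q ∈ˢ s → OnSegment C k q
    ∈⇒On (e , l , h) = subst (λ o → On o k (lo C k) (hi C k) q) (dirᴿ ρ)
      ( subst (_≈ crd (perp (dir s)) k) (across-along (dir s) q) (Eq.trans e (atᴿ ρ))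
      , ⊑-trans (≈⇒⊑ (Eq.sym (loᴿ ρ))) l , ⊑-trans h (≈⇒⊑ (hiᴿ ρ)))

    On⇒∈ : OnSegment C k q → q ∈ˢ s
    On⇒∈ on with subst (λ o → On o k (lo C k) (hi C k) q) (sym (dirᴿ ρ)) on
    ... | e , l , h = Eq.trans (≡⇒≈ (across-along (dir s) q)) (Eq.trans e (Eq.sym (atᴿ ρ)))
      , ⊑-trans (≈⇒⊑ (loᴿ ρ)) l , ⊑-trans h (≈⇒⊑ (Eq.sym (hiᴿ ρ)))

    ∈⇒On° : q ∈relint s → OnSegment° C k q
    ∈⇒On° (e , l , h) = subst (λ o → On° o k (lo C k) (hi C k) q) (dirᴿ ρ)
      ( subst (_≈ crd (perp (dir s)) k) (across-along (dir s) q) (Eq.trans e (atᴿ ρ))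
      , ⊑-⊏-trans (≈⇒⊑ (Eq.sym (loᴿ ρ))) l , ⊏-⊑-trans h (≈⇒⊑ (hiᴿ ρ)))

    On⇒∈° : OnSegment° C k q → q ∈relint s
    On⇒∈° on with subst (λ o → On° o k (lo C k) (hi C k) q) (sym (dirᴿ ρ)) on
    ... | e , l , h = Eq.trans (≡⇒≈ (across-along (dir s) q)) (Eq.trans e (Eq.sym (atᴿ ρ)))
      , ⊑-⊏-trans (≈⇒⊑ (loᴿ ρ)) l , ⊏-⊑-trans h (≈⇒⊑ (Eq.sym (hiᴿ ρ)))

  record At (o : Orientation) (q : Point) (a b : ℕ) : Set ℓ₁ where
    constructor _⨯_
    field
      along≈  : along o q ≈ crd o a
      across≈ : along (perp o) q ≈ crd (perp o) b
  open At public

  At-≈ₚ : ∀ o {p q a b} → At o p a b → At o q a b → p ≈ₚ q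
  At-≈ₚ horizontal (e ⨯ f) (e′ ⨯ f′) = Eq.trans e (Eq.sym e′) , Eq.trans f (Eq.sym f′)
  At-≈ₚ vertical   (e ⨯ f) (e′ ⨯ f′) = Eq.trans f (Eq.sym f′) , Eq.trans e (Eq.sym e′)

  At-P : ∀ o i → At o (P i) (rank i) (rank i)
  At-P o i = (≡⇒≈ (sym (crd-rank o i))) ⨯ (≡⇒≈ (sym (crd-rank (perp o) i)))

  end : Config → End → ℕ → ℕ
  end C low  = lo C
  end C high = hi C

  along-from : ∀ o a b → along o (fromCoords o a b) ≡ a
  along-from horizontal a b = refl
  along-from vertical   a b = refl

  across-from : ∀ o a b → along (perp o) (fromCoords o a b) ≡ b
  across-from horizontal a b = refl
  across-from vertical   a b = refl

  At-endpoint : ∀ {s C k} → Rep s C k → ∀ e → At (d C k) (endpoint s e) (end C e k) k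
  At-endpoint {s} {C} {k} ρ e = subst (λ o → At o (endpoint s e) (end C e k) k) (dirᴿ ρ) (coords e)
    where
    coords : ∀ e → At (dir s) (endpoint s e) (end C e k) k
    coords low  = (Eq.trans (≡⇒≈ (along-from (dir s) (loˢ s) (at s))) (loᴿ ρ)) ⨯
                  (Eq.trans (≡⇒≈ (across-from (dir s) (loˢ s) (at s))) (atᴿ ρ))
    coords high = (Eq.trans (≡⇒≈ (along-from (dir s) (hiˢ s) (at s))) (hiᴿ ρ)) ⨯
                  (Eq.trans (≡⇒≈ (across-from (dir s) (hiˢ s) (at s))) (atᴿ ρ))

  ∈ᴿ-crd : ∀ {q} o → (crd o 0 ⊑ along o q × along o q ⊑ crd o N) →
           (crd (perp o) 0 ⊑ along (perp o) q × along (perp o) q ⊑ crd (perp o) N) → q ∈ᴿ R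
  ∈ᴿ-crd {q} horizontal h v = side-∈ᴿ {q} {R} λ where
    horizontal → proj₁ h , subst (x q ⊑_) (crd-N horizontal) (proj₂ h)
    vertical   → proj₁ v , subst (y q ⊑_) (crd-N vertical) (proj₂ v)
  ∈ᴿ-crd vertical v h = ∈ᴿ-crd horizontal h v

  crd-within : ∀ o {k} → k ≤ N → ∀ {v} → v ≈ crd o k → crd o 0 ⊑ v × v ⊑ crd o N
  crd-within o k≤N e = ⊑-trans (crd-mono-≤ o z≤n k≤N) (≈⇒⊑ (Eq.sym e)) ,
                       ⊑-trans (≈⇒⊑ e) (crd-mono-≤ o k≤N ≤-refl)

  On⇒∈ᴿ : ∀ {q} o {k a b} → k ≤ N → a ≤ N → b ≤ N → On o k a b q → q ∈ᴿ R
  On⇒∈ᴿ o k≤N a≤N b≤N (e , l , h) = ∈ᴿ-crd o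
    (⊑-trans (crd-mono-≤ o z≤n a≤N) l , ⊑-trans h (crd-mono-≤ o b≤N ≤-refl))
    (crd-within (perp o) k≤N e)

  At⇒∈ᴿ : ∀ {q} o {a b} → a ≤ N → b ≤ N → At o q a b → q ∈ᴿ R
  At⇒∈ᴿ o a≤N b≤N (e ⨯ f) = ∈ᴿ-crd o (crd-within o a≤N e) (crd-within (perp o) b≤N f)

  ≡0⇒∈∂ : ∀ {q} o {k} → q ∈ᴿ R → along o q ≈ crd o k → k ≡ 0 → q ∈∂ R
  ≡0⇒∈∂ {q} o q∈ e refl = ∈∂-low {q} {R} o q∈ e

  ≡N⇒∈∂ : ∀ {q} o {k} → q ∈ᴿ R → along o q ≈ crd o k → k ≡ N → q ∈∂ R
  ≡N⇒∈∂ {q} o q∈ e refl = ∈∂-high {q} {R} o q∈ (Eq.trans e (≡⇒≈ (crd-N o)))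

  strictly⇒∉∂ : ∀ {q} o {a b k} → a ≤ N → b ≤ N → k ≤ N → 0 < k → k < N → along (perp o) q ≈ crd (perp o) k →
                crd o a ⊏ along o q → along o q ⊏ crd o b → ¬ (q ∈∂ R)
  strictly⇒∉∂ {q} o {a} {b} {k} a≤N b≤N k≤N 0<k k<N e l h (_ , ¬int) = ¬int (interior o l′ h′ l″ h″)
    where
    l′ = ⊑-⊏-trans (crd-mono-≤ o {0} z≤n a≤N) l
    h′ = subst (along o q ⊏_) (crd-N o) (⊏-⊑-trans h (crd-mono-≤ o b≤N ≤-refl))
    l″ = ⊏-⊑-trans (crd-mono-< (perp o) 0<k k≤N) (≈⇒⊑ (Eq.sym e))
    h″ = subst (along (perp o) q ⊏_) (crd-N (perp o)) (⊑-⊏-trans (≈⇒⊑ e) (crd-mono-< (perp o) k<N ≤-refl))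
    interior : ∀ o → side R o low ⊏ along o q → along o q ⊏ side R o high →
               side R (perp o) low ⊏ along (perp o) q → along (perp o) q ⊏ side R (perp o) high → q ∈int R
    interior horizontal a b c d = (a , b) , (c , d)
    interior vertical   a b c d = (c , d) , (a , b)

  Represents : Rectangulation P R → Config → Set _
  Represents r C = ∀ i → Rep (seg r i) C (rank i)

-- From configurations to rectangulations

module Realization {c ℓ₁ ℓ₂} (𝕃 : StrictTotalOrder c ℓ₁ ℓ₂) {m : ℕ}
                   (P : Fin (suc m) → Plane.Point 𝕃) (R : Plane.Rectangle 𝕃)
                   (D : Plane.IsDiagonalSet 𝕃 P) (inR : ∀ i → Plane._∈int_ 𝕃 (P i) R)
                   (C : Configurations.Config (suc m)) where
  open Representation 𝕃 P R D inR
  open Faces (suc m) C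

  segment : Fin (suc m) → Segment
  segment i = record
    { dir = d C k ; at = crd (perp (d C k)) k ; lo = crd (d C k) (lo C k) ; hi = crd (d C k) (hi C k)
    ; lo<hi = crd-mono-< (d C k) (<-trans (lo< C k∈) (<hi C k∈)) (hi≤N C k∈) }
    where
    k = rank i
    k∈ = rank-In i

  rep : ∀ i → Rep (segment i) C (rank i)
  rep i = record { dirᴿ = refl ; atᴿ = Eq.refl ; loᴿ = Eq.refl ; hiᴿ = Eq.refl }

  On⇒segment : ∀ {t q} → In t → OnSegment C t q → ∃[ i ] q ∈ˢ segment i
  On⇒segment {t} {q} t∈ on = idx t , On⇒∈ (rep (idx t)) (subst (λ z → OnSegment C z q) (sym (rank-idx t∈)) on)

  -- A common point is the crossing of the grid lines `i` and `k`. That it is interior to both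
  -- segments says `k < hi C i` and `lo C k < i`, the situation that `nc` forbids.
  noncrossingPerp : ∀ {i k q} → 0 < i → i < k → k < N → d C k ≡ perp (d C i) →
                    OnSegment° C i q → OnSegment° C k q → ⊥
  noncrossingPerp {i} {k} {q} 0<i i<k k<N dk≡ (e , l , h) onK rewrite dk≡ =
    [ (λ hi≤k → <⇒≱ k<hi hi≤k) , (λ i≤lo → <⇒≱ lo<i i≤lo) ]′
      (nc C 0<i i<k k<N λ e → perp≢ (d C i) (trans (sym dk≡) (sym e)))
    where
    e′ : along (d C i) q ≈ crd (d C i) k
    e′ = subst (λ o → along o q ≈ crd o k) (perp-perp (d C i)) (proj₁ onK)
    k<hi : k < hi C i
    k<hi = crd-cancel-< (d C i) (<⇒≤ k<N) (⊑-⊏-trans (≈⇒⊑ (Eq.sym e′)) h)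
    lo<i : lo C k < i
    lo<i = crd-cancel-< (perp (d C i)) (lo≤N C (<-trans 0<i i<k , k<N))
             (⊏-⊑-trans (proj₁ (proj₂ onK)) (≈⇒⊑ e))

  face : ∀ {k} → k < N → Rectangle
  face {k} k<N = record
    { left = crd horizontal (lowerLine horizontal k) ; right = crd horizontal (upperLine horizontal (suc k))
    ; bottom = crd vertical (lowerLine vertical k)   ; top = crd vertical (upperLine vertical (suc k))
    ; left<right = l<u horizontal ; bottom<top = l<u vertical }
    where
    l<u : ∀ o → crd o (lowerLine o k) ⊏ crd o (upperLine o (suc k))
    l<u o = crd-mono-< o (≤-<-trans (lowerLine-≤ o k<N) (≤-upperLine o z<s k<N)) (upperLine≤N o z<s k<N)

  face-low : ∀ {k} (k<N : k < N) o → side (face k<N) o low ≡ crd o (lowerLine o k)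
  face-low k<N horizontal = refl
  face-low k<N vertical   = refl

  face-high : ∀ {k} (k<N : k < N) o → side (face k<N) o high ≡ crd o (upperLine o (suc k))
  face-high k<N horizontal = refl
  face-high k<N vertical   = refl

  module _ {k} (k<N : k < N) {q : Point} where

    ∈face : q ∈ᴿ face k<N → ∀ o → crd o (lowerLine o k) ⊑ along o q × along o q ⊑ crd o (upperLine o (suc k))
    ∈face q∈ horizontal = proj₁ q∈
    ∈face q∈ vertical   = proj₂ q∈

    ∈face° : q ∈int face k<N → ∀ o → crd o (lowerLine o k) ⊏ along o q × along o q ⊏ crd o (upperLine o (suc k))
    ∈face° q∈ horizontal = proj₁ q∈
    ∈face° q∈ vertical   = proj₂ q∈

    face-inside : q ∈ᴿ face k<N → q ∈ᴿ R
    face-inside q∈ = ∈ᴿ-crd horizontal (bounds horizontal) (bounds vertical)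
      where
      bounds : ∀ o → crd o 0 ⊑ along o q × along o q ⊑ crd o N
      bounds o = ⊑-trans (crd-mono-≤ o z≤n (≤-trans (lowerLine-≤ o k<N) (<⇒≤ k<N))) (proj₁ (∈face q∈ o)) ,
                 ⊑-trans (proj₂ (∈face q∈ o)) (crd-mono-≤ o (upperLine≤N o z<s k<N) ≤-refl)

    -- Suppose `i ≤ k`. Meeting the interior puts `i` above the lower line in direction `b`, so
    -- segment `k` is perpendicular to `i` and has `lo C k < i`; it also gives `k < hi C i`, and the
    -- two segments would cross. For `i > k` the same argument applies to `suc k`.
    face-empty : q ∈int face k<N → ∀ {i} → In i → ¬ OnSegment C i q
    face-empty q∈ {i} i∈ (e , l , h) with i ≤? k
    ... | yes i≤k = lowerCase (lowerView b k<N)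
      where
      a = d C i
      b = perp a
      line<i : lowerLine b k < i
      line<i = crd-cancel-< b (≤-trans (lowerLine-≤ b k<N) (<⇒≤ k<N)) (⊏-⊑-trans (proj₁ (∈face° q∈ b)) (≈⇒⊑ e))
      lowerCase : Lower b k → ⊥
      lowerCase (corner refl _) = contradiction (proj₁ i∈) (≤⇒≯ i≤k)
      lowerCase (crossing _ _ eq) = contradiction i≤k (<⇒≱ (subst (_< i) eq line<i))
      lowerCase (parallel k∈ dk eq) = case nc C (proj₁ i∈) i<k k<N (λ e → perp≢ a (trans (sym dk) (sym e))) of λ where
          (inj₁ hi≤k) → contradiction hi≤k (<⇒≱ k<hi)
          (inj₂ i≤lo) → contradiction i≤lo (<⇒≱ (subst (_< i) eq line<i))
        where
        i<k : i < k
        i<k = ≤∧≢⇒< i≤k λ { refl → perp≢ a (sym dk) }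
        k<hi : k < hi C i
        k<hi = subst (_< hi C i) (lowerLine-across (proj₁ k∈) λ e → perp≢ a (trans (sym dk) e))
          (crd-cancel-< a (≤-trans (lowerLine-≤ a k<N) (<⇒≤ k<N)) (⊏-⊑-trans (proj₁ (∈face° q∈ a)) h))
    ... | no i≰k = upperCase (upperView b z<s k<N)
      where
      a = d C i
      b = perp a
      k<i = ≰⇒> i≰k
      i<line : i < upperLine b (suc k)
      i<line = crd-cancel-< b (<⇒≤ (proj₂ i∈)) (⊑-⊏-trans (≈⇒⊑ (Eq.sym e)) (proj₂ (∈face° q∈ b)))
      upperCase : Upper b (suc k) → ⊥
      upperCase (corner refl _) = contradiction (proj₂ i∈) (≤⇒≯ k<i)
      upperCase (crossing _ _ eq) = contradiction k<i (<⇒≱ (subst (i <_) eq i<line))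
      upperCase (parallel k∈ dk eq) = case nc C z<s sk<i (proj₂ i∈) (λ e → perp≢ a (trans (sym dk) e)) of λ where
          (inj₁ hi≤i) → contradiction hi≤i (<⇒≱ (subst (i <_) eq i<line))
          (inj₂ k≤lo) → contradiction k≤lo (<⇒≱ lo<k)
        where
        sk<i : suc k < i
        sk<i = ≤∧≢⇒< k<i λ { refl → perp≢ a (sym dk) }
        lo<k : lo C i < suc k
        lo<k = subst (lo C i <_) (upperLine-across λ e → perp≢ a (trans (sym dk) e))
          (crd-cancel-< a (lo≤N C i∈) (⊑-⊏-trans l (proj₂ (∈face° q∈ a))))

    onSide : ∀ o {t} → q ∈ᴿ face k<N → along o q ≈ crd o t → In t → d C t ≡ perp o →
             lo C t ≤ lowerLine (perp o) k → upperLine (perp o) (suc k) ≤ hi C t → OnSegment C t q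
    onSide o {t} q∈ e t∈ dt lo≤ ≤hi rewrite dt =
        subst (λ z → along z q ≈ crd z t) (sym (perp-perp o)) e
      , ⊑-trans (crd-mono-≤ (perp o) lo≤ (≤-trans (lowerLine-≤ (perp o) k<N) (<⇒≤ k<N))) (proj₁ (∈face q∈ (perp o)))
      , ⊑-trans (proj₂ (∈face q∈ (perp o))) (crd-mono-≤ (perp o) ≤hi (hi≤N C t∈))

    face-sides : q ∈∂ face k<N → q ∈∂ R ⊎ ∃[ i ] q ∈ˢ segment i
    face-sides (q∈ , ¬int) with ∈∂-cases {q} {face k<N} (q∈ , ¬int)
    ... | o , inj₁ e = case lowerSide o k<N of λ where
          (inj₁ t≡0) → inj₁ (≡0⇒∈∂ o (face-inside q∈) e′ t≡0)
          (inj₂ (t∈ , dt , lo≤ , ≤hi)) → inj₂ (On⇒segment t∈ (onSide o q∈ e′ t∈ dt lo≤ ≤hi))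
      where e′ = Eq.trans e (≡⇒≈ (face-low k<N o))
    ... | o , inj₂ e = case upperSide o k<N of λ where
          (inj₁ t≡N) → inj₁ (≡N⇒∈∂ o (face-inside q∈) e′ t≡N)
          (inj₂ (t∈ , dt , lo≤ , ≤hi)) → inj₂ (On⇒segment t∈ (onSide o q∈ e′ t∈ dt lo≤ ≤hi))
      where e′ = Eq.trans e (≡⇒≈ (face-high k<N o))

  -- q lies in the last face whose lower sides are below q in both coordinates.
  module _ {q : Point} (q∈ : q ∈int R) (off : ∀ i → ¬ (q ∈ˢ segment i)) where
    private
      AboveLower : ℕ → Set _
      AboveLower k = ∀ o → crd o (lowerLine o k) ⊏ along o q

      AboveLower? : Decidable AboveLower
      AboveLower? k = map′ (λ (h , v) → λ { horizontal → h ; vertical → v }) (λ a → a horizontal , a vertical)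
        ((crd horizontal (lowerLine horizontal k) ⊏? along horizontal q) ×-dec
         (crd vertical (lowerLine vertical k) ⊏? along vertical q))

      off′ : ∀ {t} → In t → ¬ OnSegment C t q
      off′ t∈ on = let i , i∈ = On⇒segment t∈ on in off i i∈

      below-top : ∀ o → along o q ⊏ crd o N
      below-top o = subst (along o q ⊏_) (sym (crd-N o)) (proj₂ (∈int-side {q} {R} q∈ o))

    module _ {k} (k<N : k < N) (above : AboveLower k) (max : ∀ j → k < j → j < N → ¬ AboveLower j) where
      private
        above-line : ∀ {t} → k < t → t < N → lo C t ≤ k → crd (d C t) (lo C t) ⊏ along (d C t) q
        above-line {t} k<t t<N lo≤k = ⊑-⊏-trans
          (crd-mono-≤ (d C t) (lo≤lowerLine k<t t<N lo≤k) (≤-trans (lowerLine-≤ (d C t) k<N) (<⇒≤ k<N)))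
          (above (d C t))

        both : ∀ {A : Orientation → Set ℓ₂} a → A a → A (perp a) → ∀ o → A o
        both horizontal p q horizontal = p
        both horizontal p q vertical   = q
        both vertical   p q horizontal = q
        both vertical   p q vertical   = p

        AboveLower-intro : ∀ {t} → In t → crd (d C t) (lo C t) ⊏ along (d C t) q →
                           crd (perp (d C t)) t ⊏ along (perp (d C t)) q → AboveLower t
        AboveLower-intro {t} t∈ p r = both {λ o → crd o (lowerLine o t) ⊏ along o q} (d C t)
          (subst (λ z → crd (d C t) z ⊏ along (d C t) q) (sym (lowerLine-along (proj₁ t∈) refl)) p)
          (subst (λ z → crd (perp (d C t)) z ⊏ along (perp (d C t)) q)
                 (sym (lowerLine-across (proj₁ t∈) (perp≢ (d C t) ∘ sym))) r)

        -- `q` is above the low end of `suc k`, so it cannot be above the line of `suc k` too, or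
        -- `suc k` would contradict the maximality of `k`. Beyond the bar `hi C (suc k)` that bar
        -- would be a larger candidate. Points on either segment are excluded by `off`.
        below : suc k < N → ∀ o → along o q ⊏ crd o (upperLine o (suc k))
        below sk<N = both {λ o → along o q ⊏ crd o (upperLine o (suc k))} a
          (subst (λ z → along a q ⊏ crd a z) (sym (upperLine-along sk<N refl)) belowHi)
          (subst (λ z → along b q ⊏ crd b z) (sym (upperLine-across (perp≢ a ∘ sym))) belowK)
          where
          sk∈ = z<s , sk<N
          a = d C (suc k)
          b = perp a

          aboveLo : crd a (lo C (suc k)) ⊏ along a q
          aboveLo = above-line (n<1+n k) sk<N (s≤s⁻¹ (lo< C sk∈))

          weaklyBelowK : along b q ⊑ crd b (suc k)
          weaklyBelowK = ≮⇒⊒ λ r → max (suc k) (n<1+n k) sk<N (AboveLower-intro sk∈ aboveLo r)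

          notAbove : ¬ (crd a (hi C (suc k)) ⊑ along a q)
          notAbove hi⊑ = case m≤n⇒m<n∨m≡n (hi≤N C sk∈) of λ where
              (inj₂ hi≡N) → ⊏⇒⋢ (below-top a) (subst (λ z → crd a z ⊑ along a q) hi≡N hi⊑)
              (inj₁ hi<N) → blocked hi<N
            where
            t = hi C (suc k)
            k<t = <-trans (n<1+n k) (<hi C sk∈)
            blocked : ¬ (t < N)
            blocked t<N = case hi⊑ of λ where
                (inj₁ t⊏) → max t k<t t<N (AboveLower-intro t∈ lo⊏
                  (subst (λ z → crd z t ⊏ along z q) (sym perp-dt) t⊏))
                (inj₂ t≈) → off′ t∈
                  ( subst (λ z → along z q ≈ crd z t) (sym perp-dt) (Eq.sym t≈)
                  , inj₁ lo⊏
                  , subst (λ z → along z q ⊑ crd z (hi C t)) (sym dt≡)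
                      (⊑-trans weaklyBelowK (crd-mono-≤ b (<⇒≤ (<-trans (<hi C sk∈) (<hi C t∈))) (hi≤N C t∈))))
              where
              t∈ = hi-In C sk∈ t<N
              dt≡ : d C t ≡ b
              dt≡ = ≢⇒perp (proj₁ (hiT C sk∈ t<N))
              perp-dt : perp (d C t) ≡ a
              perp-dt = trans (cong perp dt≡) (perp-perp a)
              lo⊏ : crd (d C t) (lo C t) ⊏ along (d C t) q
              lo⊏ = above-line k<t t<N (s≤s⁻¹ (proj₂ (hiT C sk∈ t<N)))

          belowHi : along a q ⊏ crd a (hi C (suc k))
          belowHi with compare (along a q) (crd a (hi C (suc k)))
          ... | tri< lt _ _ = lt
          ... | tri≈ _ e _  = contradiction (≈⇒⊑ (Eq.sym e)) notAbove
          ... | tri> _ _ gt = contradiction (inj₁ gt) notAbove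

          belowK : along b q ⊏ crd b (suc k)
          belowK with weaklyBelowK
          ... | inj₁ lt = lt
          ... | inj₂ e  = contradiction (e , inj₁ aboveLo , inj₁ belowHi) (off′ sk∈)

      ∈face-interior : q ∈int face k<N
      ∈face-interior = (above horizontal , below′ horizontal) , (above vertical , below′ vertical)
        where
        below′ : ∀ o → along o q ⊏ crd o (upperLine o (suc k))
        below′ = case m≤n⇒m<n∨m≡n k<N of λ where
          (inj₁ sk<N) → below sk<N
          (inj₂ refl) → λ o → subst (λ z → along o q ⊏ crd o z) (sym (upperLine-N {o})) (below-top o)

    inSomeFace : ∃[ k ] ∃[ k<N ] q ∈int face {k} k<N
    inSomeFace with greatest AboveLower? N
    ... | inj₁ (k , k<N , above , max) = k , k<N , ∈face-interior k<N above max
    -- Face 0 always qualifies, since its lower sides lie on the boundary of `R`.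
    ... | inj₂ none = contradiction (λ { horizontal → proj₁ (∈int-side {q} {R} q∈ horizontal)
                                       ; vertical   → proj₁ (∈int-side {q} {R} q∈ vertical) }) (none 0 z<s)

  segment-isRectangulation : IsRectangulation P R segment
  segment-isRectangulation = record
    { inside = λ i q q∈ → On⇒∈ᴿ (d C (rank i)) (rank≤N i)
        (lo≤N C (rank-In i)) (hi≤N C (rank-In i)) (∈⇒On (rep i) q∈)
    ; contains = λ i → On⇒∈° (rep i) (let e ⨯ f = At-P (d C (rank i)) i in
        f , ⊏-⊑-trans (crd-mono-< _ (lo< C (rank-In i)) (rank≤N i)) (≈⇒⊑ (Eq.sym e))
          , ⊑-⊏-trans (≈⇒⊑ e) (crd-mono-< _ (<hi C (rank-In i)) (hi≤N C (rank-In i))))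
    ; onlyPoint = λ i j Pj∈ → rank-injective (crd-injective (perp (d C (rank i))) (rank≤N j) (rank≤N i)
        (Eq.trans (Eq.sym (across≈ (At-P (d C (rank i)) j))) (proj₁ (∈⇒On (rep i) Pj∈))))
    ; noncrossing = λ i j i≢j q (q∈i , q∈j) → cross (i≢j ∘ rank-injective) (rank-In i) (rank-In j)
        (∈⇒On° (rep i) q∈i) (∈⇒On° (rep j) q∈j)
    ; subdivides = λ q q∈ off → let k , k<N , q∈face = inSomeFace q∈ off in face k<N , record
        { inside = λ q → face-inside k<N
        ; empty = λ q q∈ i q∈i → face-empty k<N q∈ (rank-In i) (∈⇒On (rep i) q∈i)
        ; sides = λ q → face-sides k<N } , q∈face
    ; ends = ends
    }
    where
    cross : ∀ {i j q} → i ≢ j → In i → In j → OnSegment° C i q → OnSegment° C j q → ⊥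
    cross {i} {j} {q} i≢j i∈ j∈ on-i on-j with d C j ≟ₒ d C i | <-cmp i j
    ... | _ | tri≈ _ i≡j _ = i≢j i≡j
    ... | yes e | _ = i≢j (crd-injective (perp (d C i)) (<⇒≤ (proj₂ i∈)) (<⇒≤ (proj₂ j∈))
          (Eq.trans (Eq.sym (proj₁ on-i)) (subst (λ o → along (perp o) q ≈ crd (perp o) j) e (proj₁ on-j))))
    ... | no ne | tri< i<j _ _ = noncrossingPerp (proj₁ i∈) i<j (proj₂ j∈) (≢⇒perp ne) on-i on-j
    ... | no ne | tri> _ _ j<i = noncrossingPerp (proj₁ j∈) j<i (proj₂ i∈) (≢⇒perp (ne ∘ sym)) on-j on-i

    bar : ∀ {k t q} → In t → d C t ≡ perp (d C k) → lo C t < k → k < hi C t → At (d C k) q t k →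
          ∃[ j ] dir (segment j) ≡ perp (d C k) × q ∈relint segment j
    bar {k} {t} {q} t∈ dt lo<k k<hi (e ⨯ f) = idx t , trans (cong (d C) (rank-idx t∈)) dt ,
      On⇒∈° (rep (idx t)) (subst (λ z → OnSegment° C z q) (sym (rank-idx t∈)) on)
      where
      on : OnSegment° C t q
      on rewrite dt = subst (λ o → along o q ≈ crd o t) (sym (perp-perp (d C k))) e
        , ⊏-⊑-trans (crd-mono-< _ lo<k (<⇒≤ (<-≤-trans k<hi (hi≤N C t∈)))) (≈⇒⊑ (Eq.sym f))
        , ⊑-⊏-trans (≈⇒⊑ f) (crd-mono-< _ k<hi (hi≤N C t∈))

    ends : ∀ i e → endpoint (segment i) e ∈∂ R ⊎
           ∃[ j ] dir (segment j) ≡ perp (dir (segment i)) × endpoint (segment i) e ∈relint segment j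
    ends i low with lo C (rank i) ≟ 0
    ... | yes l≡0 = inj₁ (≡0⇒∈∂ (d C (rank i)) (At⇒∈ᴿ _ (lo≤N C (rank-In i)) (rank≤N i) (At-endpoint (rep i) low))
                       (along≈ (At-endpoint (rep i) low)) l≡0)
    ... | no l≢0 = let d≢ , k<hi = loT C (rank-In i) (n≢0⇒n>0 l≢0) ; l∈ = lo-In C (rank-In i) (n≢0⇒n>0 l≢0) in
          inj₂ (bar l∈ (≢⇒perp d≢) (<-trans (lo< C l∈) (lo< C (rank-In i))) k<hi (At-endpoint (rep i) low))
    ends i high with m≤n⇒m<n∨m≡n (hi≤N C (rank-In i))
    ... | inj₂ h≡N = inj₁ (≡N⇒∈∂ (d C (rank i)) (At⇒∈ᴿ _ (hi≤N C (rank-In i)) (rank≤N i) (At-endpoint (rep i) high))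
                       (along≈ (At-endpoint (rep i) high)) h≡N)
    ... | inj₁ h<N = let d≢ , lo<k = hiT C (rank-In i) h<N ; h∈ = hi-In C (rank-In i) h<N in
          inj₂ (bar h∈ (≢⇒perp d≢) lo<k (<-trans (<hi C (rank-In i)) (<hi C h∈)) (At-endpoint (rep i) high))

  realize : Rectangulation P R
  realize = record { seg = segment ; isRectangulation = segment-isRectangulation }

-- From rectangulations to configurations

module Extraction {c ℓ₁ ℓ₂} (𝕃 : StrictTotalOrder c ℓ₁ ℓ₂) {m : ℕ}
                  (P : Fin (suc m) → Plane.Point 𝕃) (R : Plane.Rectangle 𝕃)
                  (D : Plane.IsDiagonalSet 𝕃 P) (inR : ∀ i → Plane._∈int_ 𝕃 (P i) R)
                  (r : Plane.Rectangulation 𝕃 P R) where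
  open Representation 𝕃 P R D inR
  open IsRectangulation (isRectangulation r)

  private
    s : Fin (suc m) → Segment
    s = seg r

    o : Fin (suc m) → Orientation
    o i = dir (s i)

    hiOf loOf : Fin (suc m) → ℕ
    hiOf i = [ (λ _ → N) , (λ (j , _) → rank j) ]′ (ends i high)
    loOf i = [ (λ _ → 0) , (λ (j , _) → rank j) ]′ (ends i low)

    at≈ : ∀ i → at (s i) ≈ crd (perp (o i)) (rank i)
    at≈ i = Eq.trans (Eq.sym (proj₁ (contains i)))
      (≡⇒≈ (trans (across-along (o i) (P i)) (sym (crd-rank (perp (o i)) i))))

    lo⊏ : ∀ i → loˢ (s i) ⊏ crd (o i) (rank i)
    lo⊏ i = subst (loˢ (s i) ⊏_) (sym (crd-rank (o i) i)) (proj₁ (proj₂ (contains i)))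

    ⊏hi : ∀ i → crd (o i) (rank i) ⊏ hiˢ (s i)
    ⊏hi i = subst (_⊏ hiˢ (s i)) (sym (crd-rank (o i) i)) (proj₂ (proj₂ (contains i)))

    across-end : ∀ i e → along (perp (o i)) (endpoint (s i) e) ≈ crd (perp (o i)) (rank i)
    across-end i low  = Eq.trans (≡⇒≈ (across-from (o i) (loˢ (s i)) (at (s i)))) (at≈ i)
    across-end i high = Eq.trans (≡⇒≈ (across-from (o i) (hiˢ (s i)) (at (s i)))) (at≈ i)

    along-low : ∀ i → along (o i) (endpoint (s i) low) ≡ loˢ (s i)
    along-low i = along-from (o i) (loˢ (s i)) (at (s i))

    along-high : ∀ i → along (o i) (endpoint (s i) high) ≡ hiˢ (s i)
    along-high i = along-from (o i) (hiˢ (s i)) (at (s i))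

    -- In the perpendicular direction the endpoint is strictly inside `R`, and along the segment it
    -- precedes `P i`; only the low side of `R` remains.
    boundary-low : ∀ i → endpoint (s i) low ∈∂ R → loˢ (s i) ≈ crd (o i) 0
    boundary-low i q∈∂ = Eq.sym (⊑-antisym
      (subst (side R (o i) low ⊑_) (along-low i) (proj₁ (∈ᴿ-side (proj₁ q∈∂) (o i))))
      (≮⇒⊒ λ low⊏ → strictly⇒∉∂ (o i) {0} {rank i} z≤n (rank≤N i) (rank≤N i) (proj₁ (rank-In i)) (proj₂ (rank-In i))
        (across-end i low) (subst (side R (o i) low ⊏_) (sym (along-low i)) low⊏)
        (subst (_⊏ crd (o i) (rank i)) (sym (along-low i)) (lo⊏ i)) q∈∂))

    boundary-high : ∀ i → endpoint (s i) high ∈∂ R → hiˢ (s i) ≈ crd (o i) N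
    boundary-high i q∈∂ = ⊑-antisym
      (subst₂ _⊑_ (along-high i) (sym (crd-N (o i))) (proj₂ (∈ᴿ-side (proj₁ q∈∂) (o i))))
      (≮⇒⊒ λ ⊏high → strictly⇒∉∂ (o i) {rank i} {N} (rank≤N i) ≤-refl (rank≤N i) (proj₁ (rank-In i)) (proj₂ (rank-In i))
        (across-end i high) (subst (crd (o i) (rank i) ⊏_) (sym (along-high i)) (⊏hi i))
        (subst (_⊏ crd (o i) N) (sym (along-high i)) ⊏high) q∈∂)

    on-bar : ∀ i j {q} → o j ≡ perp (o i) → q ∈relint s j → along (o i) q ≈ crd (o i) (rank j)
    on-bar i j {q} oj (e , _) = subst (λ z → along z q ≈ crd z (rank j)) (trans (cong perp oj) (perp-perp (o i)))
      (Eq.trans (≡⇒≈ (sym (across-along (o j) q))) (Eq.trans e (at≈ j)))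

    lo≈ : ∀ i → loˢ (s i) ≈ crd (o i) (loOf i)
    lo≈ i with ends i low
    ... | inj₁ q∈∂ = boundary-low i q∈∂
    ... | inj₂ (j , oj , q∈) = Eq.trans (≡⇒≈ (sym (along-low i))) (on-bar i j oj q∈)

    hi≈ : ∀ i → hiˢ (s i) ≈ crd (o i) (hiOf i)
    hi≈ i with ends i high
    ... | inj₁ q∈∂ = boundary-high i q∈∂
    ... | inj₂ (j , oj , q∈) = Eq.trans (≡⇒≈ (sym (along-high i))) (on-bar i j oj q∈)

    hiOf≤N : ∀ i → hiOf i ≤ N
    hiOf≤N i with ends i high
    ... | inj₁ _       = ≤-refl
    ... | inj₂ (j , _) = rank≤N j

    loOf≤N : ∀ i → loOf i ≤ N
    loOf≤N i with ends i low
    ... | inj₁ _       = z≤n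
    ... | inj₂ (j , _) = rank≤N j

    loOf< : ∀ i → loOf i < rank i
    loOf< i = crd-cancel-< (o i) (loOf≤N i) (⊑-⊏-trans (≈⇒⊑ (Eq.sym (lo≈ i))) (lo⊏ i))

    <hiOf : ∀ i → rank i < hiOf i
    <hiOf i = crd-cancel-< (o i) (rank≤N i) (⊏-⊑-trans (⊏hi i) (≈⇒⊑ (hi≈ i)))

    -- The endpoint lies on the line through `P i`; being in the relative interior of `s j`, it puts
    -- that line strictly between the ends of `s j`.
    under-bar : ∀ i j e → o j ≡ perp (o i) → endpoint (s i) e ∈relint s j → loOf j < rank i × rank i < hiOf j
    under-bar i j e oj (_ , l , h) =
        crd-cancel-< (o j) (loOf≤N j) (⊑-⊏-trans (≈⇒⊑ (Eq.sym (lo≈ j))) (⊏-⊑-trans l (≈⇒⊑ pos)))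
      , crd-cancel-< (o j) (rank≤N i) (⊑-⊏-trans (≈⇒⊑ (Eq.sym pos)) (⊏-⊑-trans h (≈⇒⊑ (hi≈ j))))
      where
      pos : along (o j) (endpoint (s i) e) ≈ crd (o j) (rank i)
      pos = subst (λ z → along z (endpoint (s i) e) ≈ crd z (rank i)) (sym oj) (across-end i e)

    perp≢⁻ : ∀ {i j} → o j ≡ perp (o i) → o j ≢ o i
    perp≢⁻ {i} e e′ = perp≢ (o i) (trans (sym e) e′)

    barAbove : ∀ i → hiOf i ≡ N ⊎ ∃[ j ] hiOf i ≡ rank j × o j ≡ perp (o i) × endpoint (s i) high ∈relint s j
    barAbove i with ends i high
    ... | inj₁ _             = inj₁ refl
    ... | inj₂ (j , oj , q∈) = inj₂ (j , refl , oj , q∈)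

    barBelow : ∀ i → loOf i ≡ 0 ⊎ ∃[ j ] loOf i ≡ rank j × o j ≡ perp (o i) × endpoint (s i) low ∈relint s j
    barBelow i with ends i low
    ... | inj₁ _             = inj₁ refl
    ... | inj₂ (j , oj , q∈) = inj₂ (j , refl , oj , q∈)

    hiT′ : ∀ i → hiOf i < N → o (idx (hiOf i)) ≢ o i × loOf (idx (hiOf i)) < rank i
    hiT′ i h<N = [ (λ h≡N → contradiction h≡N (<⇒≢ h<N)) , (λ (j , e , oj , q∈) →
      subst (λ z → o z ≢ o i × loOf z < rank i) (sym (trans (cong idx e) (idx-rank j)))
            (perp≢⁻ {i} {j} oj , proj₁ (under-bar i j high oj q∈))) ]′ (barAbove i)

    loT′ : ∀ i → 0 < loOf i → o (idx (loOf i)) ≢ o i × rank i < hiOf (idx (loOf i))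
    loT′ i 0<l = [ (λ l≡0 → contradiction l≡0 (>⇒≢ 0<l)) , (λ (j , e , oj , q∈) →
      subst (λ z → o z ≢ o i × rank i < hiOf z) (sym (trans (cong idx e) (idx-rank j)))
            (perp≢⁻ {i} {j} oj , proj₂ (under-bar i j low oj q∈))) ]′ (barBelow i)

    nc′ : ∀ i j → rank i < rank j → o i ≢ o j → hiOf i ≤ rank j ⊎ rank i ≤ loOf j
    nc′ i j i<j oi≢oj with hiOf i ≤? rank j | rank i ≤? loOf j
    ... | yes h≤ | _      = inj₁ h≤
    ... | no _   | yes ≤l = inj₂ ≤l
    ... | no h≰  | no ≰l  = contradiction (q∈i , q∈j) (noncrossing i j (oi≢oj ∘ cong o) q)
      where
      oj : o j ≡ perp (o i)
      oj = ≢⇒perp (oi≢oj ∘ sym)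
      -- The crossing of the lines of `i` and `j`: if both alternatives fail, it is interior to both
      -- segments.
      q = fromCoords (o i) (crd (o i) (rank j)) (crd (perp (o i)) (rank i))
      along-q : along (o i) q ≡ crd (o i) (rank j)
      along-q = along-from (o i) _ _
      across-q : along (perp (o i)) q ≡ crd (perp (o i)) (rank i)
      across-q = across-from (o i) _ _

      q∈i : q ∈relint s i
      q∈i = Eq.trans (≡⇒≈ (trans (across-along (o i) q) across-q)) (Eq.sym (at≈ i))
        , subst (loˢ (s i) ⊏_) (sym along-q) (⊏-⊑-trans (lo⊏ i) (crd-mono-≤ _ (<⇒≤ i<j) (rank≤N j)))
        , subst (_⊏ hiˢ (s i)) (sym along-q)
            (⊏-⊑-trans (crd-mono-< _ (≰⇒> h≰) (hiOf≤N i)) (≈⇒⊑ (Eq.sym (hi≈ i))))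

      along-qʲ : along (o j) q ≡ crd (o j) (rank i)
      along-qʲ = subst (λ z → along z q ≡ crd z (rank i)) (sym oj) across-q
      across-qʲ : along (perp (o j)) q ≡ crd (perp (o j)) (rank j)
      across-qʲ = subst (λ z → along z q ≡ crd z (rank j)) (sym (trans (cong perp oj) (perp-perp (o i)))) along-q

      q∈j : q ∈relint s j
      q∈j = Eq.trans (≡⇒≈ (trans (across-along (o j) q) across-qʲ)) (Eq.sym (at≈ j))
        , subst (loˢ (s j) ⊏_) (sym along-qʲ)
            (⊑-⊏-trans (≈⇒⊑ (lo≈ j)) (crd-mono-< _ (≰⇒> ≰l) (rank≤N i)))
        , subst (_⊏ hiˢ (s j)) (sym along-qʲ)
            (⊑-⊏-trans (crd-mono-≤ _ (<⇒≤ i<j) (rank≤N j)) (⊏hi j))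

  config : Config
  config = record
    { d = o ∘ idx ; lo = loOf ∘ idx ; hi = hiOf ∘ idx
    ; lo< = λ {k} k∈ → subst (loOf (idx k) <_) (rank-idx k∈) (loOf< (idx k))
    ; <hi = λ {k} k∈ → subst (_< hiOf (idx k)) (rank-idx k∈) (<hiOf (idx k))
    ; hi≤N = λ {k} _ → hiOf≤N (idx k)
    ; hiT = λ {k} k∈ h<N → let d≢ , l = hiT′ (idx k) h<N in d≢ , subst (loOf (idx (hiOf (idx k))) <_) (rank-idx k∈) l
    ; loT = λ {k} k∈ 0<l → let d≢ , h = loT′ (idx k) 0<l in d≢ , subst (_< hiOf (idx (loOf (idx k)))) (rank-idx k∈) h
    ; nc = λ {i} {j} 0<i i<j j<N d≢ →
        let i∈ = rank-idx (0<i , <-trans i<j j<N) ; j∈ = rank-idx (<-trans 0<i i<j , j<N) in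
        subst₂ (λ a b → hiOf (idx i) ≤ b ⊎ a ≤ loOf (idx j)) i∈ j∈
          (nc′ (idx i) (idx j) (subst₂ _<_ (sym i∈) (sym j∈) i<j) d≢)
    }

  represents : Represents r config
  represents i = record
    { dirᴿ = sym (cong o (idx-rank i))
    ; atᴿ  = at≈ i
    ; loᴿ  = Eq.trans (lo≈ i) (≡⇒≈ (cong (crd (o i) ∘ loOf) (sym (idx-rank i))))
    ; hiᴿ  = Eq.trans (hi≈ i) (≡⇒≈ (cong (crd (o i) ∘ hiOf) (sym (idx-rank i))))
    }

-- Moves of configurations as flips and rotations

module Moves {c ℓ₁ ℓ₂} (𝕃 : StrictTotalOrder c ℓ₁ ℓ₂) {m : ℕ}
             (P : Fin (suc m) → Plane.Point 𝕃) (R : Plane.Rectangle 𝕃)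
             (D : Plane.IsDiagonalSet 𝕃 P) (inR : ∀ i → Plane._∈int_ 𝕃 (P i) R) where
  open Representation 𝕃 P R D inR

  ∈[]-swap : ∀ {q u v} → q ∈[ u , v ] → q ∈[ v , u ]
  ∈[]-swap (h , v) = swap h , swap v

  ∈⟨⟩-swap : ∀ {q u v} → q ∈⟨ u , v ⟩ → q ∈⟨ v , u ⟩
  ∈⟨⟩-swap {q} {u} {v} (q∈ , q≉u , q≉v) = ∈[]-swap {q} {u} {v} q∈ , q≉v , q≉u

  ∈[]-between : ∀ o {q u v} → q ∈[ u , v ] →
                Between (along o u) (along o v) (along o q) ×
                Between (along (perp o) u) (along (perp o) v) (along (perp o) q)
  ∈[]-between horizontal (h , v) = h , v
  ∈[]-between vertical   (h , v) = v , h

  between-∈[] : ∀ o {q u v} → Between (along o u) (along o v) (along o q) →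
                Between (along (perp o) u) (along (perp o) v) (along (perp o) q) → q ∈[ u , v ]
  between-∈[] horizontal h v = h , v
  between-∈[] vertical   v h = h , v

  At-perp⁻ : ∀ o {q a b} → At (perp o) q a b → At o q b a
  At-perp⁻ horizontal (e ⨯ f) = f ⨯ e
  At-perp⁻ vertical   (e ⨯ f) = f ⨯ e

  span-intro : ∀ o {p u v a b e k} → At o u a k → At o p b k → At o v e k →
               a ≤ b → b ≤ e → e ≤ N → p ∈[ u , v ]
  span-intro o (u₁ ⨯ u₂) (p₁ ⨯ p₂) (v₁ ⨯ v₂) a≤b b≤e e≤N = between-∈[] o
    (inj₁ ( ⊑-trans (≈⇒⊑ u₁) (⊑-trans (crd-mono-≤ o a≤b (≤-trans b≤e e≤N)) (≈⇒⊑ (Eq.sym p₁)))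
          , ⊑-trans (≈⇒⊑ p₁) (⊑-trans (crd-mono-≤ o b≤e e≤N) (≈⇒⊑ (Eq.sym v₁)))))
    (inj₁ (≈⇒⊑ (Eq.trans u₂ (Eq.sym p₂)) , ≈⇒⊑ (Eq.trans p₂ (Eq.sym v₂))))

  span-elim : ∀ o {p u v a e k} → At o u a k → At o v e k → a ≤ e → e ≤ N → p ∈[ u , v ] →
              along (perp o) p ≈ crd (perp o) k × crd o a ⊑ along o p × along o p ⊑ crd o e
  span-elim o {p} {u} {v} {a} {e} {k} (u₁ ⨯ u₂) (v₁ ⨯ v₂) a≤e e≤N p∈ with ∈[]-between o p∈
  ... | along-p , across-p = level across-p , within along-p
    where
    level : Between (along (perp o) u) (along (perp o) v) (along (perp o) p) → along (perp o) p ≈ crd (perp o) k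
    level (inj₁ (u⊑p , p⊑v)) = ⊑-antisym (⊑-trans p⊑v (≈⇒⊑ v₂)) (⊑-trans (≈⇒⊑ (Eq.sym u₂)) u⊑p)
    level (inj₂ (v⊑p , p⊑u)) = ⊑-antisym (⊑-trans p⊑u (≈⇒⊑ u₂)) (⊑-trans (≈⇒⊑ (Eq.sym v₂)) v⊑p)
    a⊑e : crd o a ⊑ crd o e
    a⊑e = crd-mono-≤ o a≤e e≤N
    within : Between (along o u) (along o v) (along o p) → crd o a ⊑ along o p × along o p ⊑ crd o e
    within (inj₁ (u⊑p , p⊑v)) = ⊑-trans (≈⇒⊑ (Eq.sym u₁)) u⊑p , ⊑-trans p⊑v (≈⇒⊑ v₁)
    within (inj₂ (v⊑p , p⊑u)) = ⊑-trans a⊑e (⊑-trans (≈⇒⊑ (Eq.sym v₁)) v⊑p) ,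
                                ⊑-trans (⊑-trans p⊑u (≈⇒⊑ u₁)) a⊑e

  span-elim° : ∀ o {p u v a e k} → At o u a k → At o v e k → a ≤ e → e ≤ N → p ∈⟨ u , v ⟩ →
               along (perp o) p ≈ crd (perp o) k × crd o a ⊏ along o p × along o p ⊏ crd o e
  span-elim° o {p} {u} {v} {k = k} at-u at-v a≤e e≤N (p∈ , p≉u , p≉v)
    with span-elim o {p} {u} {v} {k = k} at-u at-v a≤e e≤N p∈
  ... | level , inj₁ l , inj₁ h = level , l , h
  ... | level , inj₂ e , _      = contradiction (At-≈ₚ o {p} {u} {b = k} (Eq.sym e ⨯ level) at-u) p≉u
  ... | level , _      , inj₂ e = contradiction (At-≈ₚ o {p} {v} {b = k} (e ⨯ level) at-v) p≉v

  onBar : ∀ C o {t k q} → d C t ≡ perp o → In t → k ≤ N → lo C t ≤ k → k ≤ hi C t → At o q t k → OnSegment C t q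
  onBar C o {t} {k} {q} dt t∈ k≤N lo≤k k≤hi (e ⨯ f) rewrite dt =
      subst (λ z → along z q ≈ crd z t) (sym (perp-perp o)) e
    , ⊑-trans (crd-mono-≤ _ lo≤k k≤N) (≈⇒⊑ (Eq.sym f))
    , ⊑-trans (≈⇒⊑ f) (crd-mono-≤ _ k≤hi (hi≤N C t∈))

  meets : ∀ C o {t k q} → In t → k ≤ N → OnSegment C t q → along (perp o) q ≈ crd (perp o) k → t ≢ k →
          d C t ≡ perp o × along o q ≈ crd o t × lo C t ≤ k × k ≤ hi C t
  meets C o {t} {k} {q} t∈ k≤N on e t≢k with d C t ≟ₒ o
  ... | yes refl = contradiction (crd-injective (perp o) (<⇒≤ (proj₂ t∈)) k≤N (Eq.trans (Eq.sym (proj₁ on)) e)) t≢k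
  ... | no ne = dt
      , subst (λ z → along z q ≈ crd z t) (trans (cong perp dt) (perp-perp o)) (proj₁ on)
      , crd-cancel-≤ (perp o) (lo≤N C t∈)
          (⊑-trans (subst (λ z → crd z (lo C t) ⊑ along z q) dt (proj₁ (proj₂ on))) (≈⇒⊑ e))
      , crd-cancel-≤ (perp o) k≤N
          (⊑-trans (≈⇒⊑ (Eq.sym e)) (subst (λ z → along z q ⊑ crd z (hi C t)) dt (proj₂ (proj₂ on))))
    where dt = ≢⇒perp ne

  end≤N : ∀ C i e → end C e (rank i) ≤ N
  end≤N C i low  = lo≤N C (rank-In i)
  end≤N C i high = hi≤N C (rank-In i)

  SameAt : Config → Config → ℕ → Set
  SameAt A B t = d A t ≡ d B t × lo A t ≡ lo B t × hi A t ≡ hi B t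

  Rep-≈ₛ : ∀ {s s′ A B k} → Rep s A k → Rep s′ B k → SameAt A B k → s′ ≈ₛ s
  Rep-≈ₛ {s} {s′} {A} {B} {k} ρ ρ′ (dd , ll , hh) = dirs
    , Eq.trans (atᴿ ρ′) (Eq.trans (≡⇒≈ (cong (λ z → crd (perp z) k) dirs)) (Eq.sym (atᴿ ρ)))
    , Eq.trans (loᴿ ρ′) (Eq.trans (≡⇒≈ (cong₂ crd dirs (sym ll))) (Eq.sym (loᴿ ρ)))
    , Eq.trans (hiᴿ ρ′) (Eq.trans (≡⇒≈ (cong₂ crd dirs (sym hh))) (Eq.sym (hiᴿ ρ)))
    where dirs = trans (dirᴿ ρ′) (trans (sym dd) (sym (dirᴿ ρ)))

  module _ {r r′ : Rectangulation P R} {A B : Config} (ρ : Represents r A) (ρ′ : Represents r′ B) where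

    On⇒∈seg : ∀ {t q} → In t → OnSegment A t q → q ∈ˢ seg r (idx t)
    On⇒∈seg {t} {q} t∈ on = On⇒∈ (ρ (idx t)) (subst (λ z → OnSegment A z q) (sym (rank-idx t∈)) on)

    -- Serves flips and rotations alike: `b` is the index where the extension starts, that of the
    -- point itself or of the other segment in the rotation. An obstacle on the way is
    -- perpendicular; `nc` of `B` keeps it from crossing the new arm, and `noTouch` keeps its end
    -- off it.
    extendsLow : ∀ i {u b} → At (d B (rank i)) u b (rank i) → lo B (rank i) < b → b ≤ rank i →
                 (∀ {t} → In t → t < b → SameAt A B t) →
                 (∀ {t} → In t → t < b → hi A t ≢ rank i) →
                 ExtendsUntil P R r i u (endpoint (seg r′ i) low)
    extendsLow i {u} {b} at-u l<b b≤k same noTouch = blocked , clear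
      where
      k = rank i
      o = d B k
      l = lo B k
      v = endpoint (seg r′ i) low
      k∈ = rank-In i
      k≤N = rank≤N i
      b≤N = ≤-trans b≤k k≤N

      at-v : At o v l k
      at-v = At-endpoint (ρ′ i) low

      blocked : Blocked P R r i v
      blocked with l ≟ 0
      ... | yes l≡0 = inj₁ (≡0⇒∈∂ o (At⇒∈ᴿ o (lo≤N B k∈) k≤N at-v) (along≈ at-v) l≡0)
      ... | no l≢0 = inj₂ (idx l , (λ e → <⇒≢ (<-≤-trans l<b b≤k) (trans (sym (rank-idx l∈)) (cong rank e))) ,
            On⇒∈seg l∈ (onBar A o (trans dd (≢⇒perp (proj₁ T))) l∈ k≤N
              (<⇒≤ (<-trans (lo< A l∈) (<-≤-trans l<b b≤k))) (subst (k ≤_) (sym hh) (<⇒≤ (proj₂ T))) at-v))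
        where
        l∈ = lo-In B k∈ (n≢0⇒n>0 l≢0)
        T = loT B k∈ (n≢0⇒n>0 l≢0)
        dd = proj₁ (same l∈ l<b)
        hh = proj₂ (proj₂ (same l∈ l<b))

      clear : ∀ q → q ∈⟨ u , v ⟩ → ¬ Blocked P R r i q
      clear q q∈ with span-elim° o {q} {v} {u} {k = k} at-v at-u (<⇒≤ l<b) b≤N (∈⟨⟩-swap {q} {u} {v} q∈)
      ... | level , l⊏ , ⊏b = λ where
          (inj₁ q∈∂) → strictly⇒∉∂ o (lo≤N B k∈) b≤N k≤N (proj₁ k∈) (proj₂ k∈) level l⊏ ⊏b q∈∂
          (inj₂ (j , j≢i , q∈j)) → hit (rank-In j) (j≢i ∘ rank-injective) (∈⇒On (ρ j) q∈j)
        where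
        hit : ∀ {t} → In t → t ≢ k → ¬ OnSegment A t q
        hit {t} t∈ t≢k on with meets A o t∈ k≤N on level t≢k
        ... | dt , pos , _ , k≤hi = case nc B (proj₁ t∈) (<-≤-trans t<b b≤k) (proj₂ k∈)
                                          (λ e → perp≢ o (trans (sym dt) (trans dd e))) of λ where
            (inj₁ hi≤k) → noTouch t∈ t<b (≤-antisym (subst (_≤ k) (sym hh) hi≤k) k≤hi)
            (inj₂ t≤l)  → <⇒≱ l<t t≤l
          where
          t<b = crd-cancel-< o (<⇒≤ (proj₂ t∈)) (⊑-⊏-trans (≈⇒⊑ (Eq.sym pos)) ⊏b)
          l<t = crd-cancel-< o (lo≤N B k∈) (⊏-⊑-trans l⊏ (≈⇒⊑ pos))
          dd = proj₁ (same t∈ t<b)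
          hh = proj₂ (proj₂ (same t∈ t<b))

    extendsHigh : ∀ i {u b} → At (d B (rank i)) u b (rank i) → b < hi B (rank i) → rank i ≤ b →
                  (∀ {t} → In t → b < t → SameAt A B t) →
                  (∀ {t} → In t → b < t → lo A t ≢ rank i) →
                  ExtendsUntil P R r i u (endpoint (seg r′ i) high)
    extendsHigh i {u} {b} at-u b<h k≤b same noTouch = blocked , clear
      where
      k = rank i
      o = d B k
      h = hi B k
      v = endpoint (seg r′ i) high
      k∈ = rank-In i
      k≤N = rank≤N i
      h≤N = hi≤N B k∈
      b≤N = ≤-trans (<⇒≤ b<h) h≤N

      at-v : At o v h k
      at-v = At-endpoint (ρ′ i) high

      blocked : Blocked P R r i v
      blocked with m≤n⇒m<n∨m≡n h≤N
      ... | inj₂ h≡N = inj₁ (≡N⇒∈∂ o (At⇒∈ᴿ o h≤N k≤N at-v) (along≈ at-v) h≡N)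
      ... | inj₁ h<N = inj₂ (idx h , (λ e → >⇒≢ (≤-<-trans k≤b b<h) (trans (sym (rank-idx h∈)) (cong rank e))) ,
            On⇒∈seg h∈ (onBar A o (trans dd (≢⇒perp (proj₁ T))) h∈ k≤N
              (subst (_≤ k) (sym ll) (<⇒≤ (proj₂ T))) (<⇒≤ (<-trans (≤-<-trans k≤b b<h) (<hi A h∈))) at-v))
        where
        h∈ = hi-In B k∈ h<N
        T = hiT B k∈ h<N
        dd = proj₁ (same h∈ b<h)
        ll = proj₁ (proj₂ (same h∈ b<h))

      clear : ∀ q → q ∈⟨ u , v ⟩ → ¬ Blocked P R r i q
      clear q q∈ with span-elim° o {q} {u} {v} {k = k} at-u at-v (<⇒≤ b<h) h≤N q∈
      ... | level , b⊏ , ⊏h = λ where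
          (inj₁ q∈∂) → strictly⇒∉∂ o b≤N h≤N k≤N (proj₁ k∈) (proj₂ k∈) level b⊏ ⊏h q∈∂
          (inj₂ (j , j≢i , q∈j)) → hit (rank-In j) (j≢i ∘ rank-injective) (∈⇒On (ρ j) q∈j)
        where
        hit : ∀ {t} → In t → t ≢ k → ¬ OnSegment A t q
        hit {t} t∈ t≢k on with meets A o t∈ k≤N on level t≢k
        ... | dt , pos , lo≤k , _ = case nc B (proj₁ k∈) (≤-<-trans k≤b b<t) (proj₂ t∈)
                                          (λ e → perp≢ o (trans (sym dt) (trans dd (sym e)))) of λ where
            (inj₁ h≤t) → <⇒≱ t<h h≤t
            (inj₂ k≤l) → noTouch t∈ b<t (≤-antisym lo≤k (subst (k ≤_) (sym ll) k≤l))
          where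
          b<t = crd-cancel-< o b≤N (⊏-⊑-trans b⊏ (≈⇒⊑ pos))
          t<h = crd-cancel-< o (<⇒≤ (proj₂ t∈)) (⊑-⊏-trans (≈⇒⊑ (Eq.sym pos)) ⊏h)
          dd = proj₁ (same t∈ b<t)
          ll = proj₁ (proj₂ (same t∈ b<t))

    at-end : ∀ i e → At (d A (rank i)) (endpoint (seg r i) e) (end A e (rank i)) (rank i)
    at-end i = At-endpoint (ρ i)

    at-end′ : ∀ i e → d A (rank i) ≡ d B (rank i) →
              At (d A (rank i)) (endpoint (seg r′ i) e) (end B e (rank i)) (rank i)
    at-end′ i e dd = subst (λ o → At o (endpoint (seg r′ i) e) (end B e (rank i)) (rank i)) (sym dd)
                           (At-endpoint (ρ′ i) e)

    -- Parallel segments of distinct points lie on distinct lines, so `seg r j` is perpendicular to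
    -- `seg r i` and has this end on the grid line of `i`.
    endpoint-on : ∀ i j e → rank j ≢ rank i → endpoint (seg r j) e ∈ˢ seg r i → end A e (rank j) ≡ rank i
    endpoint-on i j e j≢i p∈ with d A (rank j) ≟ₒ d A (rank i)
    ... | yes eq = contradiction
          (crd-injective (perp (d A (rank i))) (rank≤N j) (rank≤N i)
            (Eq.trans (Eq.sym (subst (λ o → along (perp o) p ≈ crd (perp o) (rank j)) eq (across≈ (at-end j e))))
                      (proj₁ (∈⇒On (ρ i) p∈))))
          j≢i
      where p = endpoint (seg r j) e
    ... | no ne = crd-injective (d A (rank j)) (end≤N A j e) (rank≤N i)
          (Eq.trans (Eq.sym (along≈ (at-end j e)))
            (subst (λ o → along o p ≈ crd o (rank i))
                   (trans (cong perp (≢⇒perp (ne ∘ sym))) (perp-perp (d A (rank j))))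
                   (proj₁ (∈⇒On (ρ i) p∈))))
      where
      p = endpoint (seg r j) e

    turn⇒Flip : ∀ i → Turn (rank i) A B → Flip P R r i r′
    turn⇒Flip i t = record
      { noEndpoints = λ { j j≢i low p∈  → noLo (rank-In j) (endpoint-on i j low (j≢i ∘ rank-injective) p∈)
                        ; j j≢i high p∈ → noHi (rank-In j) (endpoint-on i j high (j≢i ∘ rank-injective) p∈) }
      ; unchanged = λ j j≢i → Rep-≈ₛ {A = A} {B} (ρ j) (ρ′ j) (same (rank-In j) (j≢i ∘ rank-injective))
      ; turned = trans (dirᴿ (ρ′ i)) (trans (≢⇒perp turned) (cong perp (sym (dirᴿ (ρ i)))))
      ; extended = λ { low  → extendsLow i (At-P (d B k) i) (lo< B i∈) ≤-refl
                                (λ t∈ t<k → same t∈ (<⇒≢ t<k)) (λ t∈ _ → noHi t∈)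
                     ; high → extendsHigh i (At-P (d B k) i) (<hi B i∈) ≤-refl
                                (λ t∈ k<t → same t∈ (>⇒≢ k<t)) (λ t∈ _ → noLo t∈) }
      }
      where
      open Turn t
      k = rank i

      -- An end on `i` would still be there in `B`, and a stop is perpendicular to what it stops in
      -- both configurations; yet of the two segments only `i` turns.
      noHi : ∀ {t} → In t → hi A t ≢ k
      noHi {t} t∈ e = turned (≢∧≢⇒≡ dB≢ dA≢)
        where
        t≢k : t ≢ k
        t≢k t≡k = <⇒≢ (<hi A t∈) (trans t≡k (sym e))
        dd = proj₁ (same t∈ t≢k)
        hh = proj₂ (proj₂ (same t∈ t≢k))
        dA≢ : d A k ≢ d A t
        dA≢ = subst (λ z → d A z ≢ d A t) e (proj₁ (hiT A t∈ (subst (_< N) (sym e) (proj₂ i∈))))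
        dB≢ : d B k ≢ d A t
        dB≢ = subst₂ (λ z w → d B z ≢ w) (trans (sym hh) e) (sym dd)
                (proj₁ (hiT B t∈ (subst (_< N) (trans (sym e) hh) (proj₂ i∈))))

      noLo : ∀ {t} → In t → lo A t ≢ k
      noLo {t} t∈ e = turned (≢∧≢⇒≡ dB≢ dA≢)
        where
        t≢k : t ≢ k
        t≢k t≡k = >⇒≢ (lo< A t∈) (trans t≡k (sym e))
        dd = proj₁ (same t∈ t≢k)
        ll = proj₁ (proj₂ (same t∈ t≢k))
        dA≢ : d A k ≢ d A t
        dA≢ = subst (λ z → d A z ≢ d A t) e (proj₁ (loT A t∈ (subst (0 <_) (sym e) (proj₁ i∈))))
        dB≢ : d B k ≢ d A t
        dB≢ = subst₂ (λ z w → d B z ≢ w) (trans (sym ll) e) (sym dd)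
                (proj₁ (loT B t∈ (subst (0 <_) (trans (sym e) ll) (proj₁ i∈))))

    dir-kept : ∀ i → d A (rank i) ≡ d B (rank i) → dir (seg r′ i) ≡ dir (seg r i)
    dir-kept i dd = trans (dirᴿ (ρ′ i)) (trans (sym dd) (sym (dirᴿ (ρ i))))

    on°-at : ∀ i {q b} → d A (rank i) ≡ d B (rank i) → b ≤ N → lo B (rank i) < b → b < hi B (rank i) →
             At (d A (rank i)) q b (rank i) → q ∈relint seg r′ i
    on°-at i {q} {b} dd b≤N l<b b<h at-q with subst (λ o → At o q b (rank i)) dd at-q
    ... | e ⨯ f = On⇒∈° (ρ′ i) ( f
        , ⊏-⊑-trans (crd-mono-< _ l<b b≤N) (≈⇒⊑ (Eq.sym e))
        , ⊑-⊏-trans (≈⇒⊑ e) (crd-mono-< _ b<h (hi≤N B (rank-In i))))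

    endpoint-between : ∀ o i j e {x z : ℕ} {u v} → d A (rank i) ≡ o → rank j ≢ rank i →
                       At o u x (rank i) → At o v z (rank i) → x ≤ z → z ≤ N →
                       endpoint (seg r j) e ∈[ u , v ] →
                       end A e (rank j) ≡ rank i × x ≤ rank j × rank j ≤ z
    endpoint-between o i j e {x} {z} {u} {v} refl j≢i at-u at-v x≤z z≤N p∈
      with span-elim o {endpoint (seg r j) e} {u} {v} {k = rank i} at-u at-v x≤z z≤N p∈
    ... | level , l , h with d A (rank j) ≟ₒ o
    ...   | yes eq = contradiction
            (crd-injective (perp o) (rank≤N j) (rank≤N i)
              (Eq.trans (Eq.sym (subst (λ o → along (perp o) (endpoint (seg r j) e) ≈ crd (perp o) (rank j)) eq
                                       (across≈ (at-end j e))))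
                        level))
            j≢i
    ...   | no ne with At-perp⁻ o (subst (λ o → At o (endpoint (seg r j) e) (end A e (rank j)) (rank j))
                                         (≢⇒perp ne) (at-end j e))
    ...     | pos ⨯ across-p =
              crd-injective (perp o) (end≤N A j e) (rank≤N i) (Eq.trans (Eq.sym across-p) level)
            , crd-cancel-≤ o (≤-trans x≤z z≤N) (⊑-trans l (≈⇒⊑ pos))
            , crd-cancel-≤ o (rank≤N j) (⊑-trans (≈⇒⊑ (Eq.sym pos)) h)

    -- The bar `k` plays `s₁` and loses the tip of its low arm; `i` plays `s₂`, with its high end on
    -- that arm.
    raise⇒Rotate : ∀ i k → Rot (rank i) (rank k) A B → Rotate P R r k low i high r′
    raise⇒Rotate i k rot = record
      { i≢k         = λ { refl → <-irrefl refl i<k }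
      ; onArm       = span-intro o {c₀} {e₁} {P k} at-e₁ at-c (At-P o k) (<⇒≤ lo<a) (<⇒≤ i<k) (rank≤N k)
      ; noEndpoints = noEndpoints
      ; unchanged   = λ j j≢k j≢i → Rep-≈ₛ {A = A} {B} (ρ j) (ρ′ j)
          ( sameD (rank-In j) , sameLo (rank-In j) (j≢k ∘ rank-injective)
          , sameHi (rank-In j) (j≢i ∘ rank-injective))
      ; dir₁        = dir-kept k db
      ; keepB       = At-≈ₚ o
          (subst (λ z → At o (endpoint (seg r′ k) high) z b)
                 (sym (sameHi k∈ (>⇒≢ i<k))) (at-end′ k high db))
          (at-end k high)
      ; shortened   = At-≈ₚ o
          (subst (λ z → At o (endpoint (seg r′ k) low) z b)
                 loB (at-end′ k low db))
          at-c
      ; dir₂        = dir-kept i da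
      ; keepD       = At-≈ₚ (d A a)
          (subst (λ z → At (d A a) (endpoint (seg r′ i) low) z a)
                 (sym (sameLo i∈ (<⇒≢ i<k))) (at-end′ i low da))
          (at-end i low)
      ; beyondC     = on°-at i da (rank≤N k) (<-trans (lo< B i∈) i<k) b<hi at-c′
      ; extended    = extendsHigh i (subst (λ o → At o c₀ b a) da at-c′) b<hi (<⇒≤ i<k)
          (λ t∈ b<t → sameD t∈ , sameLo t∈ (>⇒≢ b<t) , sameHi t∈ (>⇒≢ (<-trans i<k b<t)))
          -- In `A` segment `i` ends at `k`, so nothing beyond `k` can end on it.
          (λ {t} t∈ b<t e → <-asym b<t (subst (t <_) (trans (cong (hi A) e) hiA)
            (proj₂ (loT A t∈ (subst (0 <_) (sym e) (proj₁ i∈))))))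
      }
      where
      open Rot rot
      a = rank i
      b = rank k
      o = d A b
      c₀ = endpoint (seg r i) high
      e₁ = endpoint (seg r k) low
      da = sameD i∈
      db = sameD k∈
      H : d A b ≢ d A a × lo A b < a
      H = subst (λ z → d A z ≢ d A a × lo A z < a) hiA (hiT A i∈ (subst (_< N) (sym hiA) (proj₂ k∈)))
      lo<a = proj₂ H
      b<hi : b < hi B a
      b<hi = subst (λ z → b < hi B z) loB (proj₂ (loT B k∈ (subst (0 <_) (sym loB) (proj₁ i∈))))
      at-c′ : At (d A a) c₀ b a
      at-c′ = subst (λ z → At (d A a) c₀ z a) hiA (at-end i high)
      at-c : At o c₀ a b
      at-c = At-perp⁻ o {c₀} (subst (λ o → At o c₀ b a) (≢⇒perp (proj₁ H ∘ sym)) at-c′)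
      at-e₁ : At o e₁ (lo A b) b
      at-e₁ = at-end k low

      -- Any other end on `k` is still there in `B`, where `k` starts at `i`; so it lies above `i`,
      -- off the piece that is cut away.
      noEndpoints : ∀ j → j ≢ k → j ≢ i → ∀ e → ¬ (endpoint (seg r j) e ∈[ e₁ , c₀ ])
      noEndpoints j j≢k j≢i e p∈
        with endpoint-between o k j e refl (j≢k ∘ rank-injective) at-e₁ at-c (<⇒≤ lo<a) (rank≤N i) p∈
      noEndpoints j j≢k j≢i low  p∈ | e , _ , t≤a =
        <-irrefl e (<-trans (lo< A (rank-In j)) (≤-<-trans t≤a i<k))
      noEndpoints j j≢k j≢i high p∈ | e , _ , t≤a = <⇒≱ a<t t≤a
        where
        hiB : hi B (rank j) ≡ b
        hiB = trans (sym (sameHi (rank-In j) (j≢i ∘ rank-injective))) e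
        a<t : a < rank j
        a<t = subst (_< rank j) loB (subst (λ z → lo B z < rank j) hiB
                (proj₂ (hiT B (rank-In j) (subst (_< N) (sym hiB) (proj₂ k∈)))))

    -- Now `i` plays `s₁` and loses the tip of its high arm, while `k` plays `s₂`, with its low end
    -- on that arm.
    lower⇒Rotate : ∀ i k → Rot (rank i) (rank k) B A → Rotate P R r i high k low r′
    lower⇒Rotate i k rot = record
      { i≢k         = λ { refl → <-irrefl refl i<k }
      ; onArm       = ∈[]-swap {c₀} {P i} {e₁}
          (span-intro o {c₀} {P i} {e₁} (At-P o i) at-c at-e₁ (<⇒≤ i<k) (<⇒≤ b<hi) (hi≤N A i∈))
      ; noEndpoints = noEndpoints
      ; unchanged   = λ j j≢i j≢k → Rep-≈ₛ {A = A} {B} (ρ j) (ρ′ j)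
          ( sym (sameD (rank-In j)) , sym (sameLo (rank-In j) (j≢k ∘ rank-injective))
          , sym (sameHi (rank-In j) (j≢i ∘ rank-injective)))
      ; dir₁        = dir-kept i da
      ; keepB       = At-≈ₚ o
          (subst (λ z → At o (endpoint (seg r′ i) low) z a)
                 (sameLo i∈ (<⇒≢ i<k)) (at-end′ i low da))
          (at-end i low)
      ; shortened   = At-≈ₚ o
          (subst (λ z → At o (endpoint (seg r′ i) high) z a)
                 hiA (at-end′ i high da))
          at-c
      ; dir₂        = dir-kept k db
      ; keepD       = At-≈ₚ (d A b)
          (subst (λ z → At (d A b) (endpoint (seg r′ k) high) z b)
                 (sameHi k∈ (>⇒≢ i<k)) (at-end′ k high db))
          (at-end k high)
      ; beyondC     = on°-at k db (rank≤N i) lo<a (<-trans i<k (<hi B k∈)) at-c′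
      ; extended    = extendsLow k (subst (λ o → At o c₀ a b) db at-c′) lo<a (<⇒≤ i<k)
          (λ t∈ t<a → sym (sameD t∈) , sym (sameLo t∈ (<⇒≢ (<-trans t<a i<k))) , sym (sameHi t∈ (<⇒≢ t<a)))
          (λ {t} t∈ t<a e → <-asym t<a (subst (_< t) (trans (cong (lo A) e) loB)
            (proj₂ (hiT A t∈ (subst (_< N) (sym e) (proj₂ k∈))))))
      }
      where
      open Rot rot
      a = rank i
      b = rank k
      o = d A a
      c₀ = endpoint (seg r k) low
      e₁ = endpoint (seg r i) high
      da = sym (sameD i∈)
      db = sym (sameD k∈)
      L : d A a ≢ d A b × b < hi A a
      L = subst (λ z → d A z ≢ d A b × b < hi A z) loB (loT A k∈ (subst (0 <_) (sym loB) (proj₁ i∈)))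
      b<hi = proj₂ L
      lo<a : lo B b < a
      lo<a = subst (λ z → lo B z < a) hiA (proj₂ (hiT B i∈ (subst (_< N) (sym hiA) (proj₂ k∈))))
      at-c′ : At (d A b) c₀ a b
      at-c′ = subst (λ z → At (d A b) c₀ z b) loB (at-end k low)
      at-c : At o c₀ b a
      at-c = At-perp⁻ o {c₀} (subst (λ o → At o c₀ a b) (≢⇒perp (proj₁ L ∘ sym)) at-c′)
      at-e₁ : At o e₁ (hi A a) a
      at-e₁ = at-end i high

      noEndpoints : ∀ j → j ≢ i → j ≢ k → ∀ e → ¬ (endpoint (seg r j) e ∈[ e₁ , c₀ ])
      noEndpoints j j≢i j≢k e p∈
        with endpoint-between o i j e {u = c₀} {v = e₁} refl (j≢i ∘ rank-injective) at-c at-e₁ (<⇒≤ b<hi) (hi≤N A i∈)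
               (∈[]-swap {endpoint (seg r j) e} {e₁} {c₀} p∈)
      noEndpoints j j≢i j≢k high p∈ | e , b≤t , _ =
        <-irrefl (sym e) (<-trans (<-≤-trans i<k b≤t) (<hi A (rank-In j)))
      noEndpoints j j≢i j≢k low  p∈ | e , b≤t , _ = <⇒≱ t<b b≤t
        where
        loB′ : lo B (rank j) ≡ a
        loB′ = trans (sameLo (rank-In j) (j≢k ∘ rank-injective)) e
        t<b : rank j < b
        t<b = subst (rank j <_) hiA (subst (λ z → rank j < hi B z) loB′
                (proj₂ (loT B (rank-In j) (subst (0 <_) (sym loB′) (proj₁ i∈)))))

    Adj⇒Adjacent : Adj A B → Adjacent P R r r′
    Adj⇒Adjacent (turn {i} t) =
      inj₁ (idx i , turn⇒Flip (idx i) (subst (λ z → Turn z A B) (sym (rank-idx (Turn.i∈ t))) t))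
    Adj⇒Adjacent (raise {i} {k} rot) =
      inj₂ (idx k , low , idx i , high , raise⇒Rotate (idx i) (idx k)
        (subst₂ (λ y z → Rot y z A B) (sym (rank-idx (Rot.i∈ rot))) (sym (rank-idx (Rot.k∈ rot))) rot))
    Adj⇒Adjacent (lower {i} {k} rot) =
      inj₂ (idx i , high , idx k , low , lower⇒Rotate (idx i) (idx k)
        (subst₂ (λ y z → Rot y z B A) (sym (rank-idx (Rot.i∈ rot))) (sym (rank-idx (Rot.k∈ rot))) rot))

-- Transfer of walks to the graph of rectangulations

module Walks {c ℓ₁ ℓ₂} (𝕃 : StrictTotalOrder c ℓ₁ ℓ₂) {m : ℕ}
             (P : Fin (suc m) → Plane.Point 𝕃) (R : Plane.Rectangle 𝕃)
             (D : Plane.IsDiagonalSet 𝕃 P) (inR : ∀ i → Plane._∈int_ 𝕃 (P i) R) where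
  open Representation 𝕃 P R D inR
  open Moves 𝕃 P R D inR using (Rep-≈ₛ; Adj⇒Adjacent)
  open Realization 𝕃 P R D inR using (realize; rep)
  open Extraction 𝕃 P R D inR using (config; represents)
  open Diameter (suc m) using (connected)

  -- Intermediate configurations are realized canonically, while at both ends any represented
  -- rectangulation is allowed, so the walk joins the given ones.
  CWalk⇒Walk : ∀ {A B k} → CWalk A B k → ∀ {r r′} → Represents r A → Represents r′ B → Walk P R r r′ k
  CWalk⇒Walk {A} {B} (stop A≗B) ρ ρ′ =
    stop λ i → Rep-≈ₛ {A = B} {A} (ρ′ i) (ρ i) (≗-sym {A} {B} A≗B (rank-In i))
  CWalk⇒Walk (step {B = C} a w) {r} ρ ρ′ =
    step (Adj⇒Adjacent {r = r} {realize C} ρ (rep C) a) (CWalk⇒Walk w {realize C} (rep C) ρ′)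

  diameter : DiameterAtMost P R (11 * suc m)
  diameter r r′ = let k , k≤ , w = connected (config r) (config r′) in
    k , k≤ , CWalk⇒Walk w {r} {r′} (represents r) (represents r′)

theorem3 : ∀ {c ℓ₁ ℓ₂} (𝕃 : StrictTotalOrder c ℓ₁ ℓ₂) → let open Plane 𝕃 in
    (n : ℕ) .{{_ : NonZero n}} (P : Fin n → Point) (R : Rectangle) →
    IsDiagonalSet P → (∀ i → P i ∈int R) →
    DiameterAtMost P R (11 * n)
theorem3 𝕃 (suc m) P R D inR = Walks.diameter 𝕃 P R D inR
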